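{- There exist an absolute constant $C>0$ and an integer $h_0$ such that the following holds. Define $$G(h)=\exp\left(h^{182}\cdot\exp\left(\left(C e^{h^{32770}}\right)^{h(h+1)-1}\right)\right).$$ Let $h\ge h_0$ be an integer and let $X,Y$ be finite sets of positive integers with $\frac{1}{h^{29}}|Y|\geq|X|\geq G(h)$. Then $Y$ contains a subset $Z$ of size $h$ which is disjoint from $X$ and is sum-free with respect to $X\cup Y$.
   Context: For finite sets of numbers $S$ and $B$, $B$ is sum-free with respect to $S$ if the set $\{b+b' : b,b'\in B,\ b\neq b'\}$ is disjoint from $S$. -}

module Defs where

open import Data.Nat as ℕ using (ℕ; zero; suc)
open import Data.Integer using (+_)
open import Data.Rational using (ℚ; _+_; _*_; _≤_; _<_; _/_; 0ℚ; 1ℚ)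
open import Data.Empty using (⊥)
open import Data.Product using (Σ; _×_; ∃)
open import Data.List using (List; length)
open import Data.List.Membership.Propositional using (_∈_; _∉_)
open import Data.List.Relation.Unary.All using (All)
open import Data.List.Relation.Unary.Unique.Propositional using (Unique)
open import Relation.Binary.PropositionalEquality using (_≢_)

record PosFinSet : Set where
  constructor mkSet
  field
    elems  : List ℕ
    unique : Unique elems
    pos    : All (λ x → 0 ℕ.< x) elems
open PosFinSet public

∣_∣ : PosFinSet → ℕ
∣ A ∣ = length (elems A)

_∈ˢ_ : ℕ → PosFinSet → Set
x ∈ˢ A = x ∈ elems A

_∉ˢ_ : ℕ → PosFinSet → Set
x ∉ˢ A = x ∉ elems A

SumFreeWrt : PosFinSet → (ℕ → Set) → Set
SumFreeWrt B S = ∀ b b' → b ∈ˢ B → b' ∈ˢ B → b ≢ b' → S (b ℕ.+ b') → ⊥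

-- Positive real numbers, represented by their lower Dedekind cuts:
-- a positive real x is represented by the predicate  q ↦ (q < x)  on ℚ.

Cut : Set₁
Cut = ℚ → Set

ℕtoℚ : ℕ → ℚ
ℕtoℚ n = + n / 1

_^ℚ_ : ℚ → ℕ → ℚ
p ^ℚ zero  = 1ℚ
p ^ℚ suc m = p * (p ^ℚ m)

expTerm : ℕ → ℚ → ℚ
expTerm zero    p = 1ℚ
expTerm (suc j) p = (expTerm j p * p) * (+ 1 / suc j)

expSum : ℕ → ℚ → ℚ
expSum zero    p = 0ℚ
expSum (suc k) p = expSum k p + expTerm k p

natC : ℕ → Cut
natC n q = q < ℕtoℚ n

expC : Cut → Cut
expC L q = Σ ℚ λ p → L p × 0ℚ ≤ p × ∃ λ k → q < expSum k p

-- c · x  (c > 0 rational, x > 0)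
scaleC : ℚ → Cut → Cut
scaleC c L q = Σ ℚ λ p → L p × 0ℚ ≤ p × q < c * p

powC : Cut → ℕ → Cut
powC L m q = Σ ℚ λ p → L p × 0ℚ ≤ p × q < p ^ℚ m

_≤ᶜ_ : Cut → ℕ → Set
L ≤ᶜ n = ∀ q → L q → q ≤ ℕtoℚ n

G : ℚ → ℕ → Cut
G C h =
  expC (scaleC (ℕtoℚ (h ℕ.^ 182))
    (expC (powC (scaleC C (expC (natC (h ℕ.^ 32770))))
                (h ℕ.* (h ℕ.+ 1) ℕ.∸ 1))))

{-# OPTIONS --safe #-}
module Submission where

-- Let S = X ∪ Y.  If no h elements of Y ∖ X work, then every large L ⊆ Y ∖ X spans ≫ |L|² / h pairs with sum in S
-- (greedy choice among vertices of small degree).  Following v, 2v, 4v, … through Y one finds B ⊆ Y ∖ X with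
-- |B| ≫ |Y| / h such that y + y ∉ S for all y ∈ B.  By Balog–Szemerédi–Gowers a large A ⊆ B has |A − A| ≤ K |A| with
-- K polynomial in h.  It remains to find 2^r ≥ h points of A all of whose midpoints lie in A: their pairwise sums are
-- 2y with y ∈ B, hence not in S.
-- For this A is first localised to a long arithmetic progression on which it has density ≥ 1 / 4K.  On a progression,
-- 3-term progressions (y − d, y, y + d) with a common difference d are produced by a density increment argument, and
-- r rounds (y ↦ y ± d) give the 2^r points.  Both steps rest on the Croot–Sisask sampling method, applied to the shifts
-- by t, 2t, 4t, … simultaneously, so that one gets progressions of almost periods of length exp (log^c N).

open import Defs
open import Data.Nat
open import Data.Nat.Properties
open import Data.Nat.Tactic.RingSolver using (solve-∀)
open import Data.Nat.Coprimality using (1-coprimeTo)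
import Data.Nat.Coprimality as Coprimality
open import Data.Nat.DivMod using (m/n*n≤m; /-mono-≤; m*n/n≡m; m≥n⇒m/n>0)
open import Data.Nat.ListAction using (sum)
open import Data.Integer as ℤ using (ℤ; +_)
import Data.Integer.Properties as ℤₚ
import Data.Integer.Tactic.RingSolver as ℤ-Solver
open import Data.Rational as ℚ using (ℚ; mkℚ; 0ℚ; 1ℚ)
import Data.Rational.Properties as ℚₚ
import Data.Rational.Unnormalised as ℚᵘ
import Data.Rational.Unnormalised.Properties as ℚᵘₚ
open import Data.Product using (Σ; ∃; _×_; _,_; proj₁; proj₂)
open import Data.Sum using (_⊎_; inj₁; inj₂; [_,_]′)
open import Data.Empty using (⊥-elim)
open import Data.Vec as Vec using (Vec; []; _∷_)
open import Data.List using (List; []; _∷_; _++_; map; length; filter; upTo; deduplicate; cartesianProductWith; take)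
open import Data.List.Properties using (length-upTo; length-map; length-++; length-take; take++drop≡id; map-upTo)
open import Data.List.Membership.Propositional using (_∈_; _∉_; find; lose)
open import Data.List.Membership.Propositional.Properties using (∈-++⁺ˡ; ∈-++⁺ʳ; ∈-++⁻; ∈-∃++; ∈-map⁺; ∈-map⁻; ∈-upTo⁺; ∈-upTo⁻; ∈-filter⁺; ∈-filter⁻; ∈-deduplicate⁺; ∈-deduplicate⁻; ∈-cartesianProductWith⁺; ∈-cartesianProductWith⁻)
open import Data.List.Membership.DecPropositional _≟_ using (_∈?_)
open import Data.List.Membership.DecPropositional ℤ._≟_ using () renaming (_∈?_ to _∈ℤ?_)
open import Data.List.Relation.Binary.Subset.Propositional using (_⊆_)
open import Data.List.Relation.Unary.Any using (Any; any?; here; there)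
open import Data.List.Relation.Unary.All as All using (All; []; _∷_)
open import Data.List.Relation.Unary.AllPairs using (AllPairs; []; _∷_)
open import Data.List.Relation.Unary.Unique.Propositional using (Unique)
open import Data.List.Relation.Unary.Unique.Propositional.Properties using (upTo⁺)
import Data.List.Relation.Unary.Unique.Propositional.Properties as Uniqueₚ
open import Data.List.Relation.Unary.Unique.DecPropositional.Properties ℤ._≟_ using () renaming (deduplicate-! to deduplicate-!ℤ)
open import Data.List.Relation.Unary.Unique.DecPropositional.Properties _≟_ using () renaming (deduplicate-! to deduplicate-!ℕ)
open import Function using (_∘_)
open import Relation.Nullary using (¬_; Dec; yes; no)
open import Relation.Nullary.Decidable using (_×-dec_; ¬?)
open import Relation.Unary using (Decidable)
open import Relation.Binary.Definitions using (Tri; tri<; tri≈; tri>)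
open import Relation.Binary.PropositionalEquality hiding ([_]; J)

-- The set `S` is arbitrary, so the only sums known to avoid it are doubles of elements of `B`; this
-- is why midpoints inside `A` are sought. The quantitative obstacle is the length of progressions.
-- There are about log₂ h rounds; a round turns density 2^(-κ) into 2^(-(5 + 3κ)) and may spend 64
-- (κ + 1) density increments, so there are polynomially many increments in h. If an increment took
-- a length N to log N, a tower of height polynomial in h would result. Asking one sampling argument
-- for almost periods at all scales 2^l at once costs only a power of the logarithm of the
-- progression, so that, read backwards, an increment roughly cubes log N. Hence N up to
-- 2^(2^(2^(h^5))) suffices, which matches the three nested exponentials of `G`. Everything is
-- counted in ℕ: a density a / b is an inequality a · length ≤ b · count, and an expectation is a
-- sum over all samples.

-- Finite sums over lists and counting

∑ : {I : Set} → List I → (I → ℕ) → ℕ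
∑ xs f = sum (map f xs)

syntax ∑ xs (λ x → e) = ∑[ x ∈ xs ] e
infixr 8 ∑

∑-mono : {I : Set} (xs : List I) {f g : I → ℕ} → (∀ x → x ∈ xs → f x ≤ g x) → ∑ xs f ≤ ∑ xs g
∑-mono []       h = z≤n
∑-mono (x ∷ xs) h = +-mono-≤ (h x (here refl)) (∑-mono xs λ y y∈ → h y (there y∈))

∑-cong : {I : Set} (xs : List I) {f g : I → ℕ} → (∀ x → x ∈ xs → f x ≡ g x) → ∑ xs f ≡ ∑ xs g
∑-cong []       h = refl
∑-cong (x ∷ xs) h = cong₂ _+_ (h x (here refl)) (∑-cong xs λ y y∈ → h y (there y∈))

∑-+ : {I : Set} (xs : List I) (f g : I → ℕ) → ∑[ x ∈ xs ] (f x + g x) ≡ ∑ xs f + ∑ xs g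
∑-+ []       f g = refl
∑-+ (x ∷ xs) f g = trans (cong (_+_ (f x + g x)) (∑-+ xs f g)) (lemma (f x) (g x) _ _)
  where
  lemma : ∀ a b c d → a + b + (c + d) ≡ a + c + (b + d)
  lemma = solve-∀

∑-*ˡ : {I : Set} (xs : List I) (c : ℕ) (f : I → ℕ) → ∑[ x ∈ xs ] (c * f x) ≡ c * ∑ xs f
∑-*ˡ []       c f = sym (*-zeroʳ c)
∑-*ˡ (x ∷ xs) c f = trans (cong (_+_ (c * f x)) (∑-*ˡ xs c f)) (sym (*-distribˡ-+ c (f x) _))

∑-*ʳ : {I : Set} (xs : List I) (f : I → ℕ) (c : ℕ) → ∑[ x ∈ xs ] (f x * c) ≡ ∑ xs f * c
∑-*ʳ xs f c = trans (∑-cong xs λ x _ → *-comm (f x) c) (trans (∑-*ˡ xs c f) (*-comm c _))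

∑-const : {I : Set} (xs : List I) (c : ℕ) → ∑[ _ ∈ xs ] c ≡ length xs * c
∑-const []       c = refl
∑-const (x ∷ xs) c = cong (_+_ c) (∑-const xs c)

∑-0 : {I : Set} (xs : List I) → ∑[ _ ∈ xs ] 0 ≡ 0
∑-0 xs = trans (∑-const xs 0) (*-zeroʳ (length xs))

∑-1 : {I : Set} (xs : List I) → ∑[ _ ∈ xs ] 1 ≡ length xs
∑-1 xs = trans (∑-const xs 1) (*-identityʳ _)

∑-≤ : {I : Set} (xs : List I) {f : I → ℕ} {c : ℕ} → (∀ x → x ∈ xs → f x ≤ c) → ∑ xs f ≤ length xs * c
∑-≤ xs h = ≤-trans (∑-mono xs h) (≤-reflexive (∑-const xs _))

∑-≥ : {I : Set} (xs : List I) {f : I → ℕ} {c : ℕ} → (∀ x → x ∈ xs → c ≤ f x) → length xs * c ≤ ∑ xs f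
∑-≥ xs h = ≤-trans (≤-reflexive (sym (∑-const xs _))) (∑-mono xs h)

∑-swap : {I J : Set} (xs : List I) (ys : List J) (f : I → J → ℕ) →
         ∑[ x ∈ xs ] ∑[ y ∈ ys ] f x y ≡ ∑[ y ∈ ys ] ∑[ x ∈ xs ] f x y
∑-swap []       ys f = sym (∑-0 ys)
∑-swap (x ∷ xs) ys f = trans (cong (_+_ (∑ ys (f x))) (∑-swap xs ys f)) (sym (∑-+ ys (f x) _))

∑-++ : {I : Set} (xs ys : List I) (f : I → ℕ) → ∑ (xs ++ ys) f ≡ ∑ xs f + ∑ ys f
∑-++ []       ys f = refl
∑-++ (x ∷ xs) ys f = trans (cong (_+_ (f x)) (∑-++ xs ys f)) (sym (+-assoc (f x) _ _))

∑-map : {I J : Set} (φ : I → J) (xs : List I) (f : J → ℕ) → ∑ (map φ xs) f ≡ ∑ xs (f ∘ φ)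
∑-map φ []       f = refl
∑-map φ (x ∷ xs) f = cong (_+_ (f (φ x))) (∑-map φ xs f)

∈⇒≤∑ : {I : Set} {xs : List I} {x : I} (f : I → ℕ) → x ∈ xs → f x ≤ ∑ xs f
∈⇒≤∑ f (here refl) = m≤m+n _ _
∈⇒≤∑ f (there x∈)  = ≤-trans (∈⇒≤∑ f x∈) (m≤n+m _ _)

∑-⊆ : {I : Set} {xs ys : List I} (f : I → ℕ) → Unique xs → xs ⊆ ys → ∑ xs f ≤ ∑ ys f
∑-⊆ {xs = []} f u s = z≤n
∑-⊆ {xs = x ∷ xs} f (x∉ ∷ u) s with ∈-∃++ (s (here refl))
... | as , bs , refl = begin
  f x + ∑ xs f ≤⟨ +-monoʳ-≤ (f x) (∑-⊆ f u sub) ⟩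
  f x + ∑ (as ++ bs) f ≡⟨ cong (_+_ (f x)) (∑-++ as bs f) ⟩
  f x + (∑ as f + ∑ bs f) ≡⟨ lemma (f x) (∑ as f) (∑ bs f) ⟩
  ∑ as f + (f x + ∑ bs f) ≡⟨ sym (∑-++ as (x ∷ bs) f) ⟩
  ∑ (as ++ x ∷ bs) f ∎
  where
  open ≤-Reasoning
  lemma : ∀ a b c → a + (b + c) ≡ b + (a + c)
  lemma = solve-∀
  sub : xs ⊆ as ++ bs
  sub z∈ with ∈-++⁻ as (s (there z∈))
  ... | inj₁ p           = ∈-++⁺ˡ p
  ... | inj₂ (here refl) = ⊥-elim (All.lookup x∉ z∈ refl)
  ... | inj₂ (there p)   = ∈-++⁺ʳ as p

Unique-map : {I J : Set} (φ : I → J) {xs : List I} → (∀ {x y} → x ∈ xs → y ∈ xs → φ x ≡ φ y → x ≡ y) →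
             Unique xs → Unique (map φ xs)
Unique-map φ {[]}     inj u = []
Unique-map φ {x ∷ xs} inj (x∉ ∷ u) =
  All.tabulate (λ {z} z∈ eq → let (y , y∈ , z≡) = ∈-map⁻ φ z∈ in
    All.lookup x∉ y∈ (inj (here refl) (there y∈) (trans eq z≡)))
  ∷ Unique-map φ (λ p q → inj (there p) (there q)) u

∑-inj : {I J : Set} (φ : I → J) {xs : List I} {ys : List J} (f : J → ℕ) → Unique xs →
        (∀ {x y} → x ∈ xs → y ∈ xs → φ x ≡ φ y → x ≡ y) → (∀ {x} → x ∈ xs → φ x ∈ ys) →
        ∑ xs (f ∘ φ) ≤ ∑ ys f
∑-inj φ {xs} f u inj sub = ≤-trans (≤-reflexive (sym (∑-map φ xs f)))
  (∑-⊆ f (Unique-map φ inj u) λ z∈ → let (y , y∈ , z≡) = ∈-map⁻ φ z∈ in subst (_∈ _) (sym z≡) (sub y∈))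

length-⊆ : {I : Set} {xs ys : List I} → Unique xs → xs ⊆ ys → length xs ≤ length ys
length-⊆ {xs = xs} {ys} u s = subst₂ _≤_ (∑-1 xs) (∑-1 ys) (∑-⊆ (λ _ → 1) u s)

length-inj : {I J : Set} (φ : I → J) {xs : List I} {ys : List J} → Unique xs →
        (∀ {x y} → x ∈ xs → y ∈ xs → φ x ≡ φ y → x ≡ y) → (∀ {x} → x ∈ xs → φ x ∈ ys) →
        length xs ≤ length ys
length-inj φ {xs} {ys} u inj sub = subst₂ _≤_ (∑-1 xs) (∑-1 ys) (∑-inj φ (λ _ → 1) u inj sub)

-- The form of pigeonhole behind the random choices below: if f exceeded g at every point, so would
-- its sum. A good sample, vertex, block or difference is found by comparing two sums.
averaging : {I : Set} (xs : List I) (f g : I → ℕ) → 0 < length xs → ∑ xs f ≤ ∑ xs g →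
            ∃ λ x → x ∈ xs × f x ≤ g x
averaging []       f g ()
averaging (x ∷ xs) f g _ = go x xs
  where
  go : ∀ x xs → ∑ (x ∷ xs) f ≤ ∑ (x ∷ xs) g → ∃ λ z → z ∈ x ∷ xs × f z ≤ g z
  go x [] le = x , here refl , subst₂ _≤_ (+-identityʳ _) (+-identityʳ _) le
  go x (y ∷ xs) le with go y xs | f x ≤? g x
  ... | _   | yes p = x , here refl , p
  ... | rec | no ¬p with rec (+-cancelˡ-≤ (f x) _ _ (≤-trans le (+-monoˡ-≤ _ (<⇒≤ (≰⇒> ¬p)))))
  ...   | z , z∈ , q = z , there z∈ , q

𝟙 : {P : Set} → Dec P → ℕ
𝟙 (yes _) = 1
𝟙 (no _)  = 0

𝟙≤1 : {P : Set} (d : Dec P) → 𝟙 d ≤ 1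
𝟙≤1 (yes _) = ≤-refl
𝟙≤1 (no _)  = z≤n

𝟙-yes : {P : Set} (d : Dec P) → P → 𝟙 d ≡ 1
𝟙-yes (yes _) p = refl
𝟙-yes (no ¬p) p = ⊥-elim (¬p p)

𝟙-no : {P : Set} (d : Dec P) → ¬ P → 𝟙 d ≡ 0
𝟙-no (yes p) ¬p = ⊥-elim (¬p p)
𝟙-no (no _)  ¬p = refl

𝟙>0 : {P : Set} (d : Dec P) → 0 < 𝟙 d → P
𝟙>0 (yes p) _ = p

𝟙-mono : {P Q : Set} (d : Dec P) (e : Dec Q) → (P → Q) → 𝟙 d ≤ 𝟙 e
𝟙-mono (yes p) e f = ≤-reflexive (sym (𝟙-yes e (f p)))
𝟙-mono (no _)  e f = z≤n

∑-filter : {I : Set} {P : I → Set} (P? : Decidable P) (xs : List I) (f : I → ℕ) →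
           ∑ (filter P? xs) f ≡ ∑[ x ∈ xs ] (𝟙 (P? x) * f x)
∑-filter P? []       f = refl
∑-filter P? (x ∷ xs) f with P? x
... | yes _ = cong₂ _+_ (sym (+-identityʳ (f x))) (∑-filter P? xs f)
... | no _  = ∑-filter P? xs f

length-filter : {I : Set} {P : I → Set} (P? : Decidable P) (xs : List I) →
                length (filter P? xs) ≡ ∑[ x ∈ xs ] 𝟙 (P? x)
length-filter P? xs = trans (sym (∑-1 (filter P? xs)))
  (trans (∑-filter P? xs (λ _ → 1)) (∑-cong xs λ x _ → *-identityʳ (𝟙 (P? x))))

-- Quadratic inequalities and squared distances

amgm : ∀ a b → 2 * (a * b) ≤ a * a + b * b
amgm a b with ≤-total a b
... | inj₁ p = subst (λ b → 2 * (a * b) ≤ a * a + b * b) (m+[n∸m]≡n p) (go a (b ∸ a))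
  where
  go : ∀ a k → 2 * (a * (a + k)) ≤ a * a + (a + k) * (a + k)
  go a k = ≤-trans (m≤m+n _ (k * k)) (≤-reflexive (lemma a k))
    where
    lemma : ∀ a k → 2 * (a * (a + k)) + k * k ≡ a * a + (a + k) * (a + k)
    lemma = solve-∀
... | inj₂ p = subst (λ a → 2 * (a * b) ≤ a * a + b * b) (m+[n∸m]≡n p) (go b (a ∸ b))
  where
  go : ∀ b k → 2 * ((b + k) * b) ≤ (b + k) * (b + k) + b * b
  go b k = ≤-trans (m≤m+n _ (k * k)) (≤-reflexive (lemma b k))
    where
    lemma : ∀ b k → 2 * ((b + k) * b) + k * k ≡ (b + k) * (b + k) + b * b
    lemma = solve-∀

cauchy : {I : Set} (xs : List I) (f : I → ℕ) → ∑ xs f * ∑ xs f ≤ length xs * ∑[ x ∈ xs ] (f x * f x)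
cauchy xs f = *-cancelˡ-≤ 2 (begin
  2 * (s * s) ≡⟨ e1 ⟩
  ∑[ x ∈ xs ] ∑[ y ∈ xs ] (2 * (f x * f y)) ≤⟨ ∑-mono xs (λ x _ → ∑-mono xs λ y _ → amgm (f x) (f y)) ⟩
  ∑[ x ∈ xs ] ∑[ y ∈ xs ] (f x * f x + f y * f y) ≡⟨ ∑-cong xs
      (λ x _ → trans (∑-+ xs _ _) (cong (_+ q) (∑-const xs _))) ⟩
  ∑[ x ∈ xs ] (length xs * (f x * f x) + q) ≡⟨ trans (∑-+ xs _ _) (cong₂ _+_ (∑-*ˡ xs (length xs) _) (∑-const xs q)) ⟩
  length xs * q + length xs * q ≡⟨ cong (_+_ (length xs * q)) (sym (+-identityʳ _)) ⟩
  2 * (length xs * q) ∎)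
  where
  open ≤-Reasoning
  s = ∑ xs f
  q = ∑[ x ∈ xs ] (f x * f x)
  e1 : 2 * (s * s) ≡ ∑[ x ∈ xs ] ∑[ y ∈ xs ] (2 * (f x * f y))
  e1 = sym (trans (∑-cong xs (λ x _ → trans (∑-*ˡ xs 2 _) (cong (2 *_) (∑-*ˡ xs (f x) f))))
       (trans (∑-*ˡ xs 2 _) (cong (2 *_) (∑-*ʳ xs f s))))

infix 9 _²
_² : ℕ → ℕ
n ² = n * n

dist² : ℕ → ℕ → ℕ
dist² m n = ∣ m - n ∣ ²

-- The square of m - n with the cross term moved across, which keeps the variance computation inside
-- ℕ.
dist²-eq : ∀ m n → m ² + n ² ≡ 2 * (m * n) + dist² m n
dist²-eq m n with ≤-total m n
... | inj₁ p rewrite m≤n⇒∣m-n∣≡n∸m p = subst (λ n → m ² + n ² ≡ 2 * (m * n) + (n ∸ m) ²) (m+[n∸m]≡n p) (go (n ∸ m))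
  where
  lemma : ∀ m k → m * m + (m + k) * (m + k) ≡ 2 * (m * (m + k)) + k * k
  lemma = solve-∀
  go : ∀ k → m ² + (m + k) ² ≡ 2 * (m * (m + k)) + (m + k ∸ m) ²
  go k rewrite m+n∸m≡n m k = lemma m k
... | inj₂ p rewrite m≤n⇒∣n-m∣≡n∸m p = subst (λ m → m ² + n ² ≡ 2 * (m * n) + (m ∸ n) ²) (m+[n∸m]≡n p) (go (m ∸ n))
  where
  lemma : ∀ n k → (n + k) * (n + k) + n * n ≡ 2 * ((n + k) * n) + k * k
  lemma = solve-∀
  go : ∀ k → (n + k) ² + n ² ≡ 2 * ((n + k) * n) + (n + k ∸ n) ²
  go k rewrite m+n∸m≡n n k = lemma n k

dist²-sym : ∀ m n → dist² m n ≡ dist² n m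
dist²-sym m n = cong _² (∣-∣-comm m n)

dist²-*ˡ : ∀ k m n → dist² (k * m) (k * n) ≡ k ² * dist² m n
dist²-*ˡ k m n = trans (cong _² (sym (*-distribˡ-∣-∣ k m n))) (lemma k ∣ m - n ∣)
  where
  lemma : ∀ k d → k * d * (k * d) ≡ k * k * (d * d)
  lemma = solve-∀

-- The constants of this chain rule add up to i² after i steps.
dist²-chain : ∀ c m n o → c * dist² m o ≤ suc c * dist² m n + c * suc c * dist² n o
dist²-chain c m n o = begin
  c * (∣ m - o ∣) ² ≤⟨ *-monoʳ-≤ c (*-mono-≤ tri tri) ⟩
  c * (u + v) ² ≡⟨ lemma₁ c u v ⟩
  c * u ² + c * c * 0 + (2 * (u * (c * v)) + c * v ²) ≤⟨ +-monoʳ-≤ (c * u ² + c * c * 0)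
      (+-monoˡ-≤ _ (amgm u (c * v))) ⟩
  c * u ² + c * c * 0 + (u ² + (c * v) ² + c * v ²) ≡⟨ lemma₂ c u v ⟩
  suc c * u ² + c * suc c * v ² ∎
  where
  open ≤-Reasoning
  u = ∣ m - n ∣
  v = ∣ n - o ∣
  tri = ∣-∣-triangle m n o
  lemma₁ : ∀ c u v → c * ((u + v) * (u + v)) ≡ c * (u * u) + c * c * 0 + (2 * (u * (c * v)) + c * (v * v))
  lemma₁ = solve-∀
  lemma₂ : ∀ c u v → c * (u * u) + c * c * 0 + (u * u + (c * v) * (c * v) + c * (v * v)) ≡
      (1 + c) * (u * u) + c * (1 + c) * (v * v)
  lemma₂ = solve-∀

^-distribʳ-* : ∀ k m n → (m * n) ^ k ≡ m ^ k * n ^ k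
^-distribʳ-* zero    m n = refl
^-distribʳ-* (suc k) m n = trans (cong (m * n *_) (^-distribʳ-* k m n)) (lemma m n (m ^ k) (n ^ k))
  where
  lemma : ∀ m n p q → m * n * (p * q) ≡ m * p * (n * q)
  lemma = solve-∀

-- Almost periods by random sampling

-- Equals length xs ^ k times the expectation over k independent uniform samples from `xs`;
-- probabilities are never divided out.
∑ᵏ : (k : ℕ) → List ℕ → (Vec ℕ k → ℕ) → ℕ
∑ᵏ zero    xs f = f []
∑ᵏ (suc k) xs f = ∑[ x ∈ xs ] ∑ᵏ k xs (λ z → f (x ∷ z))

∑ᵏ-mono : ∀ k xs {f g : Vec ℕ k → ℕ} → (∀ z → f z ≤ g z) → ∑ᵏ k xs f ≤ ∑ᵏ k xs g
∑ᵏ-mono zero    xs h = h []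
∑ᵏ-mono (suc k) xs h = ∑-mono xs λ x _ → ∑ᵏ-mono k xs λ z → h (x ∷ z)

∑ᵏ-cong : ∀ k xs {f g : Vec ℕ k → ℕ} → (∀ z → f z ≡ g z) → ∑ᵏ k xs f ≡ ∑ᵏ k xs g
∑ᵏ-cong zero    xs h = h []
∑ᵏ-cong (suc k) xs h = ∑-cong xs λ x _ → ∑ᵏ-cong k xs λ z → h (x ∷ z)

∑ᵏ-+ : ∀ k xs (f g : Vec ℕ k → ℕ) → ∑ᵏ k xs (λ z → f z + g z) ≡ ∑ᵏ k xs f + ∑ᵏ k xs g
∑ᵏ-+ zero    xs f g = refl
∑ᵏ-+ (suc k) xs f g = trans (∑-cong xs λ x _ → ∑ᵏ-+ k xs _ _) (∑-+ xs _ _)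

∑ᵏ-*ˡ : ∀ k xs c (f : Vec ℕ k → ℕ) → ∑ᵏ k xs (λ z → c * f z) ≡ c * ∑ᵏ k xs f
∑ᵏ-*ˡ zero    xs c f = refl
∑ᵏ-*ˡ (suc k) xs c f = trans (∑-cong xs λ x _ → ∑ᵏ-*ˡ k xs c _) (∑-*ˡ xs c _)

∑ᵏ-const : ∀ k xs c → ∑ᵏ k xs (λ _ → c) ≡ length xs ^ k * c
∑ᵏ-const zero    xs c = sym (+-identityʳ c)
∑ᵏ-const (suc k) xs c = trans (∑-cong xs λ x _ → ∑ᵏ-const k xs c)
  (trans (∑-const xs _) (sym (*-assoc (length xs) (length xs ^ k) c)))

∑ᵏ-swap : {I : Set} → ∀ k xs (ys : List I) (f : I → Vec ℕ k → ℕ) →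
          ∑ᵏ k xs (λ z → ∑[ y ∈ ys ] f y z) ≡ ∑[ y ∈ ys ] ∑ᵏ k xs (f y)
∑ᵏ-swap zero    xs ys f = refl
∑ᵏ-swap (suc k) xs ys f = trans (∑-cong xs λ x _ → ∑ᵏ-swap k xs ys _) (∑-swap xs ys _)

averagingᵏ : ∀ k xs (f g : Vec ℕ k → ℕ) → 0 < length xs → ∑ᵏ k xs f ≤ ∑ᵏ k xs g → ∃ λ z → f z ≤ g z
averagingᵏ zero    xs f g pos le = [] , le
averagingᵏ (suc k) xs f g pos le with averaging xs _ _ pos le
... | x , _ , le′ with averagingᵏ k xs _ _ pos le′
...   | z , p = x ∷ z , p

-- Translation by s embeds the samples from `xs` into those from any list containing `xs` + s.
-- Counting inside one larger list is what lets different shifts share a sample.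
∑ᵏ-shift : ∀ k {xs ys : List ℕ} s (f : Vec ℕ k → ℕ) → Unique xs → (∀ {x} → x ∈ xs → x + s ∈ ys) →
           ∑ᵏ k xs (λ z → f (Vec.map (_+ s) z)) ≤ ∑ᵏ k ys f
∑ᵏ-shift zero    s f u sub = ≤-refl
∑ᵏ-shift (suc k) {xs} {ys} s f u sub = ≤-trans
  (∑-mono xs λ x _ → ∑ᵏ-shift k s (λ z → f (x + s ∷ z)) u sub)
  (∑-inj (_+ s) (λ b → ∑ᵏ k ys (λ z → f (b ∷ z))) u (λ _ _ → +-cancelʳ-≡ s _ _) sub)

total : (ℕ → ℕ) → ∀ {k} → Vec ℕ k → ℕ
total w []      = 0
total w (y ∷ z) = w y + total w z

first-moment : ∀ k xs (w : ℕ → ℕ) → length xs * ∑ᵏ k xs (total w) ≡ k * length xs ^ k * ∑ xs w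
first-moment zero    xs w = *-zeroʳ (length xs)
first-moment (suc k) xs w = trans (cong (n *_) step) (trans (lemma₁ n (n ^ k) F A)
    (trans (cong (λ e → n * (n ^ k * F) + n * e) (first-moment k xs w)) (lemma₂ n (n ^ k) F k)))
  where
  n = length xs
  F = ∑ xs w
  A = ∑ᵏ k xs (total w)
  step : ∑[ x ∈ xs ] ∑ᵏ k xs (λ z → w x + total w z) ≡ n ^ k * F + n * A
  step = trans (∑-cong xs λ x _ → trans (∑ᵏ-+ k xs _ _) (cong (_+ A) (∑ᵏ-const k xs (w x))))
    (trans (∑-+ xs _ _) (cong₂ _+_ (∑-*ˡ xs (n ^ k) w) (∑-const xs A)))
  lemma₁ : ∀ n p F A → n * (p * F + n * A) ≡ n * (p * F) + n * (n * A)
  lemma₁ = solve-∀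
  lemma₂ : ∀ n p F k → n * (p * F) + n * (k * p * F) ≡ (1 + k) * (n * p) * F
  lemma₂ = solve-∀

-- Divided by n^(k+2), with μ = F / n, this is E T² + kμ² ≤ kμ + k²μ²; the diagonal terms use w² ≤
-- w. The term kμ² stands on the left to avoid a subtraction.
second-moment : ∀ k xs (w : ℕ → ℕ) → (∀ y → w y ≤ 1) →
  length xs ² * ∑ᵏ k xs (λ z → total w z ²) + k * length xs ^ k * ∑ xs w ²
    ≤ k * length xs ^ suc k * ∑ xs w + k ² * length xs ^ k * ∑ xs w ²
second-moment zero    xs w w≤1 = ≤-reflexive (trans (+-identityʳ _) (*-zeroʳ (length xs ²)))
second-moment (suc k) xs w w≤1 = begin
  n ² * Q′ + suc k * (n * p) * F ² ≤⟨ +-monoˡ-≤ _ (*-monoʳ-≤ (n ²) step) ⟩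
  n ² * (p * F + (2 * (F * A) + n * Q)) + suc k * (n * p) * F ² ≡⟨ lemma₁ n p F A Q k ⟩
  n * (n * p) * F + n * p * F ² + 2 * n * F * (n * A) + n * (n ² * Q + k * p * F ²)
    ≤⟨ +-mono-≤ (≤-reflexive (cong (λ e → n * (n * p) * F + n * p * F ² + 2 * n * F * e) (first-moment k xs w)))
        (*-monoʳ-≤ n (second-moment k xs w w≤1)) ⟩
  n * (n * p) * F + n * p * F ² + 2 * n * F * (k * p * F) + n * (k * (n * p) * F + k ² * p * F ²)
    ≡⟨ lemma₂ n p F k ⟩
  suc k * (n * (n * p)) * F + suc k ² * (n * p) * F ² ∎
  where
  open ≤-Reasoning
  n = length xs
  p = n ^ k
  F = ∑ xs w
  A = ∑ᵏ k xs (total w)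
  Q = ∑ᵏ k xs (λ z → total w z ²)
  Q′ = ∑ᵏ (suc k) xs (λ z → total w z ²)
  sq : ∀ a b → (a + b) * (a + b) ≡ a * a + (2 * a * b + b * b)
  sq = solve-∀
  re : ∀ p f A Q → p * f + (2 * f * A + Q) ≡ p * f + (2 * (f * A) + Q)
  re = solve-∀
  pointwise : ∀ x → ∑ᵏ k xs (λ z → (w x + total w z) ²) ≤ p * w x + (2 * (w x * A) + Q)
  pointwise x = begin
    ∑ᵏ k xs (λ z → (w x + total w z) ²) ≤⟨ ∑ᵏ-mono k xs (λ z → ≤-trans (≤-reflexive (sq (w x) (total w z)))
        (+-monoˡ-≤ _ (≤-trans (*-monoʳ-≤ (w x) (w≤1 x)) (≤-reflexive (*-identityʳ (w x)))))) ⟩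
    ∑ᵏ k xs (λ z → w x + (2 * w x * total w z + total w z ²)) ≡⟨ trans (∑ᵏ-+ k xs _ _)
        (cong₂ _+_ (∑ᵏ-const k xs (w x)) (trans (∑ᵏ-+ k xs _ _) (cong (_+ Q) (∑ᵏ-*ˡ k xs (2 * w x) (total w))))) ⟩
    p * w x + (2 * w x * A + Q) ≡⟨ re p (w x) A Q ⟩
    p * w x + (2 * (w x * A) + Q) ∎
  step : Q′ ≤ p * F + (2 * (F * A) + n * Q)
  step = ≤-trans (∑-mono xs λ x _ → pointwise x) (≤-reflexive
    (trans (∑-+ xs _ _) (cong₂ _+_ (∑-*ˡ xs p w) (trans (∑-+ xs _ _)
      (cong₂ _+_ (trans (∑-*ˡ xs 2 _) (cong (2 *_) (∑-*ʳ xs w A))) (∑-const xs Q))))))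
  lemma₁ : ∀ n p F A Q k → n * n * (p * F + (2 * (F * A) + n * Q)) + (1 + k) * (n * p) * (F * F)
    ≡ n * (n * p) * F + n * p * (F * F) + 2 * n * F * (n * A) + n * (n * n * Q + k * p * (F * F))
  lemma₁ = solve-∀
  lemma₂ : ∀ n p F k → n * (n * p) * F + n * p * (F * F) + 2 * n * F * (k * p * F) + n *
      (k * (n * p) * F + k * k * p * (F * F))
    ≡ (1 + k) * (n * (n * p)) * F + (1 + k) * (1 + k) * (n * p) * (F * F)
  lemma₂ = solve-∀

-- The mean of n · `total w` is k F, and independent samples with values at most 1 have variance at
-- most their mean. The right side is k n F times the number n^k of samples.
variance : ∀ k xs (w : ℕ → ℕ) → (∀ y → w y ≤ 1) →
  ∑ᵏ k xs (λ z → dist² (length xs * total w z) (k * ∑ xs w)) ≤ k * length xs ^ suc k * ∑ xs w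
variance k xs w w≤1 = +-cancelʳ-≤ (2 * (k * F * (k * p * F)) + k * p * F ²) _ _ (begin
  V + (2 * (k * F * (k * p * F)) + k * p * F ²) ≡⟨ lemma₀ V (2 * (k * F * (k * p * F))) (k * p * F ²) ⟩
  (2 * (k * F * (k * p * F)) + V) + k * p * F ² ≡⟨ cong (_+ k * p * F ²) (sym expand) ⟩
  n ² * Q + p * (k * F) ² + k * p * F ² ≡⟨ lemma₁ (n ² * Q) (p * (k * F) ²) (k * p * F ²) ⟩
  n ² * Q + k * p * F ² + p * (k * F) ² ≤⟨ +-monoˡ-≤ _ (second-moment k xs w w≤1) ⟩
  k * (n * p) * F + k ² * p * F ² + p * (k * F) ² ≡⟨ lemma₂ k (n * p) F p ⟩
  k * (n * p) * F + 2 * (k * F * (k * p * F)) ≤⟨ +-monoʳ-≤ (k * (n * p) * F) (m≤m+n (2 * (k * F * (k * p * F))) _) ⟩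
  k * (n * p) * F + (2 * (k * F * (k * p * F)) + k * p * F ²) ∎)
  where
  open ≤-Reasoning
  n = length xs
  p = n ^ k
  F = ∑ xs w
  A = ∑ᵏ k xs (total w)
  Q = ∑ᵏ k xs (λ z → total w z ²)
  V = ∑ᵏ k xs (λ z → dist² (n * total w z) (k * F))
  lemma₀ : ∀ a b c → a + (b + c) ≡ (b + a) + c
  lemma₀ = solve-∀
  lemma₁ : ∀ a b c → a + b + c ≡ a + c + b
  lemma₁ = solve-∀
  lemma₂ : ∀ k m F p → k * m * F + k * k * p * (F * F) + p * (k * F * (k * F)) ≡ k * m * F + 2 * (k * F * (k * p * F))
  lemma₂ = solve-∀
  sq : ∀ n t → n * t * (n * t) ≡ n * n * (t * t)
  sq = solve-∀
  cross : ∀ n t c → 2 * (n * t * c) ≡ 2 * c * n * t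
  cross = solve-∀
  fin : ∀ c n A → 2 * c * n * A ≡ 2 * (c * (n * A))
  fin = solve-∀
  expand : n ² * Q + p * (k * F) ² ≡ 2 * (k * F * (k * p * F)) + V
  expand = begin-equality
    n ² * Q + p * (k * F) ² ≡⟨ sym (cong₂ _+_ (∑ᵏ-*ˡ k xs (n ²) _) (∑ᵏ-const k xs _)) ⟩
    ∑ᵏ k xs (λ z → n ² * total w z ²) + ∑ᵏ k xs (λ _ → (k * F) ²) ≡⟨ sym (∑ᵏ-+ k xs _ _) ⟩
    ∑ᵏ k xs (λ z → n ² * total w z ² + (k * F) ²) ≡⟨ ∑ᵏ-cong k xs
        (λ z → trans (cong (_+ (k * F) ²) (sym (sq n (total w z))))
        (trans (dist²-eq (n * total w z) (k * F)) (cong (_+ dist² (n * total w z) (k * F))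
        (cross n (total w z) (k * F))))) ⟩
    ∑ᵏ k xs (λ z → 2 * (k * F) * n * total w z + dist² (n * total w z) (k * F)) ≡⟨ trans (∑ᵏ-+ k xs _ _)
        (cong (_+ V) (∑ᵏ-*ˡ k xs (2 * (k * F) * n) (total w))) ⟩
    2 * (k * F) * n * A + V ≡⟨ cong (_+ V) (trans (fin (k * F) n A)
        (cong (λ e → 2 * (k * F * e)) (first-moment k xs w))) ⟩
    2 * (k * F * (k * p * F)) + V ∎

-- A correlation rather than a convolution in the usual sense: the argument is x + y, so no negative
-- numbers arise.
convolve : List ℕ → (ℕ → ℕ) → ℕ → ℕ
convolve Y a x = ∑[ y ∈ Y ] a (x + y)

sampled : (ℕ → ℕ) → ∀ {k} → Vec ℕ k → ℕ → ℕ
sampled a z x = total (λ y → a (x + y)) z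

-- Squared L² distance on [0, W) between the empirical average over the sample and the averaged
-- correlation moved by s, both multiplied by k · length Y.
error : List ℕ → (ℕ → ℕ) → ℕ → ℕ → ∀ {k} → Vec ℕ k → ℕ
error Y a W s {k} z = ∑[ x ∈ upTo W ] dist² (length Y * sampled a z x) (k * convolve Y a (x + s))

sampled-shift : ∀ a {k} (z : Vec ℕ k) s x → sampled a (Vec.map (_+ s) z) x ≡ sampled a z (x + s)
sampled-shift a []      s x = refl
sampled-shift a (y ∷ z) s x = cong₂ _+_ (cong a (lemma x y s)) (sampled-shift a z s x)
  where
  lemma : ∀ x y s → x + (y + s) ≡ x + s + y
  lemma = solve-∀

∑-upTo-shift : ∀ W H s (g : ℕ → ℕ) → W + s ≤ H → ∑[ x ∈ upTo W ] g (x + s) ≤ ∑ (upTo H) g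
∑-upTo-shift W H s g le = ∑-inj (_+ s) g (upTo⁺ W) (λ _ _ → +-cancelʳ-≡ s _ _)
  λ x∈ → ∈-upTo⁺ (<-≤-trans (+-monoˡ-< s (∈-upTo⁻ x∈)) le)

∑-upTo-mono : ∀ {W H} (g : ℕ → ℕ) → W ≤ H → ∑ (upTo W) g ≤ ∑ (upTo H) g
∑-upTo-mono {W} {H} g le = ≤-trans (≤-reflexive (∑-cong (upTo W) λ x _ → cong g (sym (+-identityʳ x))))
  (∑-upTo-shift W H 0 g (≤-trans (≤-reflexive (+-identityʳ W)) le))

error-bound : List ℕ → ℕ → ℕ → ℕ
error-bound Y k m = 2 * (k * length Y ² * m)

error-shift : ∀ Y a {W H} s {k} (z : Vec ℕ k) → W + s ≤ H → error Y a W s (Vec.map (_+ s) z) ≤ error Y a H 0 z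
error-shift Y a {W} {H} s {k} z le = ≤-trans
  (≤-reflexive (∑-cong (upTo W) λ x _ → cong₂ (λ p q → dist² (length Y * p) (k * convolve Y a q))
      (sampled-shift a z s x) (sym (+-identityʳ (x + s)))))
  (∑-upTo-shift W H s (λ x → dist² (length Y * sampled a z x) (k * convolve Y a (x + 0))) le)

-- Markov's inequality: summing `variance` over x gives a mean error of at most M = k n² m, and
-- `error-bound` is 2M.
half-good : ∀ Y a H m k → (∀ x → a x ≤ 1) → (∀ {y} → y ∈ Y → ∑[ x ∈ upTo H ] a (x + y) ≤ m) →
  0 < length Y → 0 < m → 0 < k →
  length Y ^ k ≤ 2 * ∑ᵏ k Y (λ z → 𝟙 (error Y a H 0 z ≤? error-bound Y k m))
half-good Y a H m k a≤1 am n>0 m>0 k>0 = *-cancelˡ-≤ M {{>-nonZero M>0}} (+-cancelʳ-≤ (M * p) _ _ (begin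
  M * p + M * p ≡⟨ e₁ M p ⟩
  p * (2 * M) ≡⟨ sym (∑ᵏ-const k Y (2 * M)) ⟩
  ∑ᵏ k Y (λ _ → 2 * M) ≤⟨ ∑ᵏ-mono k Y markov ⟩
  ∑ᵏ k Y (λ z → 2 * M * good z + error Y a H 0 z) ≡⟨ trans (∑ᵏ-+ k Y _ _) (cong (_+ _) (∑ᵏ-*ˡ k Y (2 * M) good)) ⟩
  2 * M * ∑ᵏ k Y good + ∑ᵏ k Y (error Y a H 0) ≤⟨ +-monoʳ-≤ (2 * M * ∑ᵏ k Y good) errors ⟩
  2 * M * ∑ᵏ k Y good + M * p ≡⟨ cong (_+ M * p) (e₂ M (∑ᵏ k Y good)) ⟩
  M * (2 * ∑ᵏ k Y good) + M * p ∎))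
  where
  open ≤-Reasoning
  n = length Y
  p = n ^ k
  M = k * n ² * m
  M>0 : 0 < M
  M>0 = *-mono-< (*-mono-< k>0 (*-mono-< n>0 n>0)) m>0
  good : Vec ℕ k → ℕ
  good z = 𝟙 (error Y a H 0 z ≤? 2 * M)
  e₁ : ∀ M p → M * p + M * p ≡ p * (2 * M)
  e₁ = solve-∀
  e₂ : ∀ M G → 2 * M * G ≡ M * (2 * G)
  e₂ = solve-∀
  e₃ : ∀ k n p m → k * (n * p) * (n * m) ≡ k * (n * n) * m * p
  e₃ = solve-∀
  markov : ∀ z → 2 * M ≤ 2 * M * good z + error Y a H 0 z
  markov z with error Y a H 0 z ≤? 2 * M
  ... | yes _ = ≤-trans (≤-reflexive (sym (*-identityʳ (2 * M)))) (m≤m+n _ _)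
  ... | no ¬q = ≤-trans (<⇒≤ (≰⇒> ¬q)) (m≤n+m _ _)
  errors : ∑ᵏ k Y (error Y a H 0) ≤ M * p
  errors = begin
    ∑ᵏ k Y (error Y a H 0) ≡⟨ ∑ᵏ-swap k Y (upTo H) _ ⟩
    ∑[ x ∈ upTo H ] ∑ᵏ k Y (λ z → dist² (n * sampled a z x) (k * convolve Y a (x + 0))) ≤⟨ ∑-mono (upTo H)
        (λ x _ → subst (λ x′ → ∑ᵏ k Y (λ z → dist² (n * sampled a z x) (k * convolve Y a x′)) ≤ k *
        (n * p) * convolve Y a x) (sym (+-identityʳ x)) (variance k Y (λ y → a (x + y)) (λ y → a≤1 (x + y)))) ⟩
    ∑[ x ∈ upTo H ] (k * (n * p) * convolve Y a x) ≡⟨ ∑-*ˡ (upTo H) (k * (n * p)) _ ⟩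
    k * (n * p) * (∑[ x ∈ upTo H ] ∑[ y ∈ Y ] a (x + y)) ≡⟨ cong (k * (n * p) *_) (∑-swap (upTo H) Y _) ⟩
    k * (n * p) * (∑[ y ∈ Y ] ∑[ x ∈ upTo H ] a (x + y)) ≤⟨ *-monoʳ-≤ (k * (n * p)) (∑-≤ Y λ _ → am) ⟩
    k * (n * p) * (n * m) ≡⟨ e₃ k n p m ⟩
    M * p ∎

-- The Croot-Sisask pigeonhole. For each t at least half of the tuples from Y become, after
-- translation by τ t, tuples from V that are near the correlation moved by τ t. There are at most
-- v^k · |Y|^k tuples from V, so some b is near for a proportion 1 / (2 v^k) of the t.
common-target : ∀ Y a {W H} m k v (τ : ℕ → ℕ) (T V : List ℕ) → Unique Y → (∀ x → a x ≤ 1) →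
  (∀ {y} → y ∈ Y → ∑[ x ∈ upTo H ] a (x + y) ≤ m) → 0 < length Y → 0 < m → 0 < k →
  (∀ {y t} → y ∈ Y → t ∈ T → y + τ t ∈ V) → length V ≤ v * length Y → (∀ {t} → t ∈ T → W + τ t ≤ H) → 0 < length T →
  ∃ λ (b : Vec ℕ k) → length T ≤ 2 * v ^ k * length (filter (λ t → error Y a W (τ t) b ≤? error-bound Y k m) T)
common-target Y a {W} {H} m k v τ T V uY a≤1 am n>0 m>0 k>0 sub V≤ WH T>0 =
  let (b , le) = averagingᵏ k V (λ _ → length T * n ^ k) (λ b → length V ^ k * (2 * hits b)) V>0 main
  in b , *-cancelʳ-≤ _ _ (n ^ k) {{m^n≢0 n k {{>-nonZero n>0}}}} (≤-trans le (fin b))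
  where
  open ≤-Reasoning
  n = length Y
  near : ℕ → Vec ℕ k → ℕ
  near t b = 𝟙 (error Y a W (τ t) b ≤? error-bound Y k m)
  hits : Vec ℕ k → ℕ
  hits b = ∑[ t ∈ T ] near t b
  V>0 : 0 < length V
  V>0 = ∈⇒>0 (sub (proj₂ (∃∈ Y n>0)) (proj₂ (∃∈ T T>0)))
    where
    ∃∈ : ∀ (xs : List ℕ) → 0 < length xs → ∃ λ x → x ∈ xs
    ∃∈ (x ∷ _) _ = x , here refl
    ∈⇒>0 : ∀ {x : ℕ} {xs} → x ∈ xs → 0 < length xs
    ∈⇒>0 {xs = _ ∷ _} _ = z<s
  main : ∑ᵏ k V (λ _ → length T * n ^ k) ≤ ∑ᵏ k V (λ b → length V ^ k * (2 * hits b))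
  main = begin
    ∑ᵏ k V (λ _ → length T * n ^ k) ≡⟨ ∑ᵏ-const k V _ ⟩
    length V ^ k * (length T * n ^ k) ≤⟨ *-monoʳ-≤ (length V ^ k)
        (∑-≥ T λ t t∈ → ≤-trans (half-good Y a H m k a≤1 am n>0 m>0 k>0)
          (*-monoʳ-≤ 2 (≤-trans (∑ᵏ-mono k Y λ z → 𝟙-mono (error Y a H 0 z ≤? error-bound Y k m)
              (error Y a W (τ t) (Vec.map (_+ τ t) z) ≤? error-bound Y k m) (≤-trans (error-shift Y a (τ t) z (WH t∈))))
                                (∑ᵏ-shift k (τ t) (near t) uY (λ y∈ → sub y∈ t∈))))) ⟩
    length V ^ k * (∑[ t ∈ T ] (2 * ∑ᵏ k V (near t))) ≡⟨ cong (length V ^ k *_)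
        (trans (∑-*ˡ T 2 _) (cong (2 *_) (sym (∑ᵏ-swap k V T near)))) ⟩
    length V ^ k * (2 * ∑ᵏ k V hits) ≡⟨ sym (trans (∑ᵏ-*ˡ k V (length V ^ k) _)
        (cong (length V ^ k *_) (∑ᵏ-*ˡ k V 2 hits))) ⟩
    ∑ᵏ k V (λ b → length V ^ k * (2 * hits b)) ∎
  fin : ∀ b → length V ^ k * (2 * hits b) ≤ 2 * v ^ k * length
      (filter (λ t → error Y a W (τ t) b ≤? error-bound Y k m) T) * n ^ k
  fin b = begin
    length V ^ k * (2 * hits b) ≤⟨ *-monoˡ-≤ _ (^-monoˡ-≤ k V≤) ⟩
    (v * n) ^ k * (2 * hits b) ≡⟨ cong (_* (2 * hits b)) (^-distribʳ-* k v n) ⟩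
    v ^ k * n ^ k * (2 * hits b) ≡⟨ re (v ^ k) (n ^ k) (hits b) ⟩
    2 * v ^ k * hits b * n ^ k ≡⟨ cong (λ e → 2 * v ^ k * e * n ^ k)
        (sym (length-filter (λ t → error Y a W (τ t) b ≤? error-bound Y k m) T)) ⟩
    _ ∎
    where
    re : ∀ a b h → a * b * (2 * h) ≡ 2 * a * h * b
    re = solve-∀

-- The pigeonhole is applied once per dilation 2^l, each time to the survivors of the previous one,
-- at a cost of 2 v^k. The target b may depend on l but not on t, so the difference of two survivors
-- works at all dyadic scales simultaneously.
common-targets : ∀ Y a {W H} m k v (V : ℕ → List ℕ) → Unique Y → (∀ x → a x ≤ 1) →
  (∀ {y} → y ∈ Y → ∑[ x ∈ upTo H ] a (x + y) ≤ m) → 0 < length Y → 0 < m → 0 < k → 0 < v →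
  ∀ i c T → Unique T →
  (∀ {l y t} → l < i → y ∈ Y → t ∈ T → y + 2 ^ l * t ∈ V l) → (∀ {l} → l < i → length (V l) ≤ v * length Y) →
  (∀ {l t} → l < i → t ∈ T → W + 2 ^ l * t ≤ H) → 0 < c → (2 * v ^ k) ^ i * c ≤ length T →
  ∃ λ T′ → Unique T′ × T′ ⊆ T × c ≤ length T′ ×
    (∀ {l} → l < i → ∃ λ (b : Vec ℕ k) → ∀ {t} → t ∈ T′ → error Y a W (2 ^ l * t) b ≤ error-bound Y k m)
common-targets Y a m k v V uY a≤1 am n>0 m>0 k>0 v>0 zero c T uT sub V≤ WH c>0 big =
  T , uT , (λ t∈ → t∈) , ≤-trans (≤-reflexive (sym (+-identityʳ c))) big , λ ()
common-targets Y a {W} {H} m k v V uY a≤1 am n>0 m>0 k>0 v>0 (suc i) c T uT sub V≤ WH c>0 big =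
  let (b , le) = step
      (T′ , uT′ , T′⊆ , c≤ , targets) = rec b le
  in T′ , uT′ , (λ t∈ → proj₁ (∈-filter⁻ (near? b) (T′⊆ t∈))) , c≤ ,
     λ l< → [ targets , (λ { refl → b , λ t∈ → proj₂ (∈-filter⁻ (near? b) {xs = T} (T′⊆ t∈)) }) ]′
         (m≤n⇒m<n∨m≡n (s≤s⁻¹ l<))
  where
  near? : (b : Vec ℕ k) (t : ℕ) → Dec (error Y a W (2 ^ i * t) b ≤ error-bound Y k m)
  near? b t = error Y a W (2 ^ i * t) b ≤? error-bound Y k m
  q>0 : 0 < 2 * v ^ k
  q>0 = *-mono-< (z<s {1}) (m^n>0 v {{>-nonZero v>0}} k)
  step : ∃ λ (b : Vec ℕ k) → length T ≤ 2 * v ^ k * length (filter (near? b) T)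
  step = common-target Y a m k v (λ t → 2 ^ i * t) T (V i) uY a≤1 am n>0 m>0 k>0 (sub ≤-refl) (V≤ ≤-refl) (WH ≤-refl)
           (<-≤-trans (*-mono-< (m^n>0 (2 * v ^ k) {{>-nonZero q>0}} (suc i)) c>0) big)
  rec : ∀ b → length T ≤ 2 * v ^ k * length (filter (near? b) T) → _
  rec b le = common-targets Y a {W} {H} m k v V uY a≤1 am n>0 m>0 k>0 v>0 i c (filter (near? b) T)
      (Uniqueₚ.filter⁺ (near? b) uT)
    (λ l< y∈ t∈ → sub (m<n⇒m<1+n l<) y∈ (proj₁ (∈-filter⁻ (near? b) t∈))) (λ l< → V≤ (m<n⇒m<1+n l<))
    (λ l< t∈ → WH (m<n⇒m<1+n l<) (proj₁ (∈-filter⁻ (near? b) t∈))) c>0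
    (*-cancelˡ-≤ (2 * v ^ k) {{>-nonZero q>0}} (≤-trans (≤-reflexive (sym (*-assoc (2 * v ^ k) ((2 * v ^ k) ^ i) c)))
        (≤-trans big le)))

two-elements : {T : List ℕ} → Unique T → 2 ≤ length T → ∃ λ t → ∃ λ t′ → t ∈ T × t′ ∈ T × t′ < t
two-elements {x ∷ y ∷ T} ((x≢y ∷ _) ∷ _) _ with <-cmp x y
... | tri< x<y _ _  = y , x , there (here refl) , here refl , x<y
... | tri≈ _ x≡y _  = ⊥-elim (x≢y x≡y)
... | tri> _ _ y<x  = x , y , here refl , there (here refl) , y<x
two-elements {x ∷ []} _ (s≤s ())

dist²-triangle : ∀ m n o → dist² m o ≤ 2 * dist² m n + 2 * dist² n o
dist²-triangle m n o = subst₂ _≤_ (+-identityʳ _) refl (dist²-chain 1 m n o)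

-- Two translates near the same b are near each other. The sampling error grows like k while the
-- squared distance carries k², which leaves the gain k on the left.
same-target : ∀ Y a m k W s s′ (b : Vec ℕ k) → 0 < k →
  error Y a W s b ≤ error-bound Y k m → error Y a W s′ b ≤ error-bound Y k m →
  k * ∑[ x ∈ upTo W ] dist² (convolve Y a (x + s)) (convolve Y a (x + s′)) ≤ 8 * (length Y ² * m)
same-target Y a m k W s s′ b k>0 p q = *-cancelˡ-≤ k {{>-nonZero k>0}} (begin
  k * (k * ∑[ x ∈ upTo W ] dist² (F (x + s)) (F (x + s′))) ≡⟨ trans (sym (*-assoc k k _))
      (sym (∑-*ˡ (upTo W) (k * k) _)) ⟩
  ∑[ x ∈ upTo W ] (k ² * dist² (F (x + s)) (F (x + s′))) ≡⟨ ∑-cong (upTo W)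
      (λ x _ → sym (dist²-*ˡ k (F (x + s)) (F (x + s′)))) ⟩
  ∑[ x ∈ upTo W ] dist² (k * F (x + s)) (k * F (x + s′)) ≤⟨ ∑-mono (upTo W)
      (λ x _ → ≤-trans (dist²-triangle (k * F (x + s)) (c x) (k * F (x + s′)))
                                                                                   (≤-reflexive (cong (λ e →
                                                                                       2 * e + 2 * dist² (c x)
                                                                                       (k * F (x + s′))) (dist²-sym
                                                                                       (k * F (x + s)) (c x))))) ⟩
  ∑[ x ∈ upTo W ] (2 * dist² (c x) (k * F (x + s)) + 2 * dist² (c x) (k * F (x + s′)))
    ≡⟨ trans (∑-+ (upTo W) _ _) (cong₂ _+_ (∑-*ˡ (upTo W) 2 _) (∑-*ˡ (upTo W) 2 _)) ⟩
  2 * error Y a W s b + 2 * error Y a W s′ b ≤⟨ +-mono-≤ (*-monoʳ-≤ 2 p) (*-monoʳ-≤ 2 q) ⟩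
  2 * (2 * (k * length Y ² * m)) + 2 * (2 * (k * length Y ² * m)) ≡⟨ lemma k (length Y) m ⟩
  k * (8 * (length Y ² * m)) ∎)
  where
  open ≤-Reasoning
  F = convolve Y a
  c = λ x → length Y * sampled a b x
  lemma : ∀ k n m → 2 * (2 * (k * (n * n) * m)) + 2 * (2 * (k * (n * n) * m)) ≡ k * (8 * (n * n * m))
  lemma = solve-∀

-- Binary expansion of j: the periods 2^l d, l < i, generate all multiples of d below 2^i d.
binary-periods : ∀ (F : ℕ → ℕ) k C W₀ s d i →
  (∀ {l} → l < i → k * ∑[ x ∈ upTo W₀ ] dist² (F (x + 2 ^ l * (s + d))) (F (x + 2 ^ l * s)) ≤ C) →
  ∀ lo W → (∀ {l} → l < i → 2 ^ l * s ≤ lo) → lo + W + 2 ^ i * d ≤ W₀ → ∀ j → j < 2 ^ i →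
  k * ∑[ x ∈ upTo W ] dist² (F (lo + x + j * d)) (F (lo + x)) ≤ suc i ² * C
binary-periods F k C W₀ s d zero periods lo W lo≥ fits (suc j) (s≤s ())
binary-periods F k C W₀ s d zero periods lo W lo≥ fits zero j<  = ≤-trans (≤-reflexive eq) z≤n
  where
  eq : k * ∑[ x ∈ upTo W ] dist² (F (lo + x + 0)) (F (lo + x)) ≡ 0
  eq = trans (cong (k *_) (trans (∑-cong (upTo W) λ x _ → trans
      (cong (λ e → dist² (F e) (F (lo + x))) (+-identityʳ (lo + x))) (cong _² (∣n-n∣≡0 (F (lo + x)))))
         (∑-0 (upTo W)))) (*-zeroʳ k)
binary-periods F k C W₀ s d (suc i) periods lo W lo≥ fits j j< = go (j <? 2 ^ i)
  where
  go : Dec (j < 2 ^ i) → k * ∑[ x ∈ upTo W ] dist² (F (lo + x + j * d)) (F (lo + x)) ≤ suc (suc i) ² * C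
  go (yes j<′) = ≤-trans (binary-periods F k C W₀ s d i (λ l< → periods (m<n⇒m<1+n l<)) lo W (λ l< → lo≥ (m<n⇒m<1+n l<))
                  (≤-trans (+-monoʳ-≤ (lo + W) (*-monoˡ-≤ d (m≤m+n (2 ^ i) _))) fits) j j<′)
                (*-monoˡ-≤ C (*-mono-≤ (n≤1+n (suc i)) (n≤1+n (suc i))))
  go (no ¬j<)  = *-cancelˡ-≤ (suc i) (begin
    suc i * (k * ∑[ x ∈ upTo W ] dist² (f x) (h x)) ≡⟨ lemma₀ (suc i) k (∑[ x ∈ upTo W ] dist² (f x) (h x)) ⟩
    k * (suc i * ∑[ x ∈ upTo W ] dist² (f x) (h x)) ≡⟨ cong (k *_) (sym (∑-*ˡ (upTo W) (suc i) _)) ⟩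
    k * ∑[ x ∈ upTo W ] (suc i * dist² (f x) (h x)) ≤⟨ *-monoʳ-≤ k
        (∑-mono (upTo W) λ x _ → dist²-chain (suc i) (f x) (g x) (h x)) ⟩
    k * ∑[ x ∈ upTo W ] (suc (suc i) * dist² (f x) (g x) + suc i * suc (suc i) * dist² (g x) (h x))
      ≡⟨ cong (k *_) (trans (∑-+ (upTo W) _ _) (cong₂ _+_ (∑-*ˡ (upTo W) (suc (suc i)) _)
          (∑-*ˡ (upTo W) (suc i * suc (suc i)) _))) ⟩
    k * (suc (suc i) * S₁ + suc i * suc (suc i) * S₂) ≡⟨ lemma₁ k i S₁ S₂ ⟩
    suc (suc i) * (k * S₁) + suc i * suc (suc i) * (k * S₂) ≤⟨ +-mono-≤ (*-monoʳ-≤ (suc (suc i)) b₁)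
        (*-monoʳ-≤ (suc i * suc (suc i)) b₂) ⟩
    suc (suc i) * (suc i ² * C) + suc i * suc (suc i) * C ≡⟨ lemma₂ i C ⟩
    suc i * (suc (suc i) ² * C) ∎)
    where
    open ≤-Reasoning
    f = λ x → F (lo + x + j * d)
    g = λ x → F (lo + x + 2 ^ i * d)
    h = λ x → F (lo + x)
    S₁ = ∑[ x ∈ upTo W ] dist² (f x) (g x)
    S₂ = ∑[ x ∈ upTo W ] dist² (g x) (h x)
    j′ = j ∸ 2 ^ i
    j≡ : 2 ^ i + j′ ≡ j
    j≡ = m+[n∸m]≡n (≮⇒≥ ¬j<)
    j′< : j′ < 2 ^ i
    j′< = +-cancelˡ-< (2 ^ i) _ _ (subst₂ _<_ (sym j≡) (cong (_+_ (2 ^ i)) (+-identityʳ _)) j<)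
    lo′ = lo + 2 ^ i * d
    lemma₀ : ∀ a b c → a * (b * c) ≡ b * (a * c)
    lemma₀ = solve-∀
    lemma₁ : ∀ k i a b → k * ((2 + i) * a + (1 + i) * (2 + i) * b) ≡ (2 + i) * (k * a) + (1 + i) * (2 + i) * (k * b)
    lemma₁ = solve-∀
    lemma₂ : ∀ i C → (2 + i) * ((1 + i) * (1 + i) * C) + (1 + i) * (2 + i) * C ≡ (1 + i) * ((2 + i) * (2 + i) * C)
    lemma₂ = solve-∀
    re₁ : ∀ a x q d j′ → a + q * d + x + j′ * d ≡ a + x + (q + j′) * d
    re₁ = solve-∀
    re₂ : ∀ a x e → a + e + x ≡ a + x + e
    re₂ = solve-∀
    fits₁ : lo′ + W + 2 ^ i * d ≤ W₀
    fits₁ = ≤-trans (≤-reflexive (lemma lo W (2 ^ i) d)) fits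
      where
      lemma : ∀ a w q d → a + q * d + w + q * d ≡ a + w + (2 * q) * d
      lemma = solve-∀
    b₁ : k * S₁ ≤ suc i ² * C
    b₁ = ≤-trans (≤-reflexive (cong (k *_) (∑-cong (upTo W) λ x _ →
           cong₂ (λ p q → dist² (F p) (F q)) (trans (cong (λ e → lo + x + e * d) (sym j≡))
               (sym (re₁ lo x (2 ^ i) d j′))) (sym (re₂ lo x (2 ^ i * d))))))
         (binary-periods F k C W₀ s d i (λ l< → periods (m<n⇒m<1+n l<)) lo′ W
             (λ l< → ≤-trans (lo≥ (m<n⇒m<1+n l<)) (m≤m+n lo _)) fits₁ j′ j′<)
    -- `periods` compares only the offsets 2^i (s + d) and 2^i s. Because 2^i s ≤ lo, the window
    -- starting at lo is reached by moving x up by r.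
    e = 2 ^ i * s
    r = lo ∸ e
    r≡ : r + e ≡ lo
    r≡ = m∸n+n≡m (lo≥ ≤-refl)
    re₃ : ∀ x r e q → x + r + (e + q) ≡ r + e + x + q
    re₃ = solve-∀
    re₄ : ∀ x r e → x + r + e ≡ r + e + x
    re₄ = solve-∀
    b₂ : k * S₂ ≤ C
    b₂ = ≤-trans (*-monoʳ-≤ k (begin
      S₂ ≡⟨ ∑-cong (upTo W) (λ x _ → cong₂ (λ p q → dist² (F p) (F q))
                                                                                     (sym (trans (cong (_+_ (x + r))
                                                                                         (*-distribˡ-+ (2 ^ i) s d))
                                                                                         (trans (re₃ x r e (2 ^ i * d))
                                                                                         (cong (λ l → l + x + 2 ^ i *
                                                                                         d) r≡))))
                                                                                     (sym (trans (re₄ x r e)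
                                                                                         (cong (_+ x) r≡)))) ⟩
      ∑[ x ∈ upTo W ] dist² (F (x + r + 2 ^ i * (s + d))) (F (x + r + 2 ^ i * s)) ≤⟨ ∑-upTo-shift W W₀ r
          (λ x → dist² (F (x + 2 ^ i * (s + d))) (F (x + 2 ^ i * s)))
             (≤-trans (+-monoʳ-≤ W (m∸n≤m lo e)) (≤-trans (≤-reflexive (+-comm W lo)) (≤-trans (m≤m+n _ _) fits))) ⟩
      ∑[ x ∈ upTo W₀ ] dist² (F (x + 2 ^ i * (s + d))) (F (x + 2 ^ i * s)) ∎)) (periods ≤-refl)

-- Two survivors t′ < t of the dyadic pigeonhole have a difference d such that every 2^l d, l ≤ λ′,
-- is an almost period. Binary expansion then reaches 2^(λ′+1) multiples of d with a loss only
-- quadratic in λ′, the logarithm of their number.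
almost-periods : ∀ Y a W m k v (V : ℕ → List ℕ) λ′ T M → Unique Y → (∀ x → a x ≤ 1) →
  (∀ {y} → y ∈ Y → ∑[ x ∈ upTo (W + 4 * (2 ^ λ′ * M)) ] a (x + y) ≤ m) → 0 < length Y → 0 < m → 0 < k → 0 < v →
  Unique T → (∀ {t} → t ∈ T → t ≤ M) →
  (∀ {l y t} → l ≤ λ′ → y ∈ Y → t ∈ T → y + 2 ^ l * t ∈ V l) → (∀ {l} → l ≤ λ′ → length (V l) ≤ v * length Y) →
  (2 * v ^ k) ^ suc λ′ * 2 ≤ length T →
  ∃ λ t′ → ∃ λ d → 0 < d × t′ ∈ T × t′ + d ∈ T × (∀ j → j < 2 ^ suc λ′ →
    k * ∑[ x ∈ upTo W ] dist² (convolve Y a (2 ^ λ′ * M + x + j * d)) (convolve Y a (2 ^ λ′ * M + x))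
      ≤ (2 + λ′) ² * (8 * (length Y ² * m)))
almost-periods Y a W m k v V λ′ T M uY a≤1 am n>0 m>0 k>0 v>0 uT T≤M sub V≤ big =
  let (T′ , uT′ , T′⊆ , 2≤ , targets) = step
      (t , t′ , t∈ , t′∈ , t′<t) = two-elements uT′ 2≤
  in fin T′ T′⊆ targets t′ (t ∸ t′) (m<n⇒0<n∸m t′<t) t′∈ (subst (_∈ T′) (sym (m+[n∸m]≡n (<⇒≤ t′<t))) t∈)
  where
  -- Q bounds every shift 2^l t. One Q makes room for the base shift 2^l t′, two more for the
  -- multiples of d, and a last one for the shifts inside `error`.
  Q = 2 ^ λ′ * M
  W₀ = W + 3 * Q
  H = W + 4 * Q
  lemma : ∀ W Q → W + 3 * Q + Q ≡ W + 4 * Q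
  lemma = solve-∀
  lemma₂ : ∀ W Q → Q + W + 2 * Q ≡ W + 3 * Q
  lemma₂ = solve-∀
  Targets : List ℕ → Set
  Targets T′ = ∀ {l} → l < suc λ′ → ∃ λ (b : Vec ℕ k) → ∀ {t} → t ∈ T′ → error Y a W₀ (2 ^ l * t) b ≤ error-bound Y k m
  step : ∃ λ T′ → Unique T′ × T′ ⊆ T × 2 ≤ length T′ × Targets T′
  step = common-targets Y a {W₀} {H} m k v V uY a≤1 am n>0 m>0 k>0 v>0 (suc λ′) 2 T uT (λ l< → sub (s≤s⁻¹ l<))
      (λ l< → V≤ (s≤s⁻¹ l<))
    (λ {l} {t} l< t∈ → ≤-trans (+-monoʳ-≤ W₀ (*-mono-≤ (^-monoʳ-≤ 2 (s≤s⁻¹ l<)) (T≤M t∈))) (≤-reflexive (lemma W Q)))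
        z<s big
  fin : ∀ T′ → T′ ⊆ T → Targets T′ → ∀ t′ d → 0 < d → t′ ∈ T′ → t′ + d ∈ T′ →
    ∃ λ t′ → ∃ λ d → 0 < d × t′ ∈ T × t′ + d ∈ T × (∀ j → j < 2 ^ suc λ′ →
    k * ∑[ x ∈ upTo W ] dist² (convolve Y a (Q + x + j * d)) (convolve Y a (Q + x))
      ≤ (2 + λ′) ² * (8 * (length Y ² * m)))
  fin T′ T′⊆ targets t′ d d>0 t′∈ t∈ = t′ , d , d>0 , T′⊆ t′∈ , T′⊆ t∈ , λ j j< →
    binary-periods (convolve Y a) k (8 * (length Y ² * m)) W₀ t′ d (suc λ′) periods Q W
      (λ l< → *-mono-≤ (^-monoʳ-≤ 2 (s≤s⁻¹ l<)) (T≤M (T′⊆ t′∈)))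
      (≤-trans (+-monoʳ-≤ (Q + W) (≤-trans (≤-reflexive (*-assoc 2 (2 ^ λ′) d))
          (*-monoʳ-≤ 2 (*-monoʳ-≤ (2 ^ λ′) (≤-trans (m≤n+m d t′) (T≤M (T′⊆ t∈))))))) (≤-reflexive (lemma₂ W Q))) j j<
    where
    periods : ∀ {l} → l < suc λ′ → k * ∑[ x ∈ upTo W₀ ] dist² (convolve Y a (x + 2 ^ l * (t′ + d)))
        (convolve Y a (x + 2 ^ l * t′)) ≤ 8 * (length Y ² * m)
    periods {l} l< = let (b , near) = targets l< in
      same-target Y a m k W₀ (2 ^ l * (t′ + d)) (2 ^ l * t′) b k>0 (near t∈) (near t′∈)

-- Density increment on arithmetic progressions

∑-upTo-suc : ∀ n (f : ℕ → ℕ) → ∑ (upTo (suc n)) f ≡ f 0 + ∑[ i ∈ upTo n ] f (suc i)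
∑-upTo-suc n f = cong (_+_ (f 0)) (trans (cong (λ xs → ∑ xs f) (sym (map-upTo suc n))) (∑-map suc (upTo n) f))

∑-upTo-+ : ∀ m n (f : ℕ → ℕ) → ∑ (upTo (m + n)) f ≡ ∑ (upTo m) f + ∑[ i ∈ upTo n ] f (m + i)
∑-upTo-+ zero    n f = refl
∑-upTo-+ (suc m) n f = trans (∑-upTo-suc (m + n) f) (trans (cong (_+_ (f 0)) (∑-upTo-+ m n (λ i → f (suc i))))
  (trans (sym (+-assoc (f 0) _ _)) (cong (_+ ∑[ i ∈ upTo n ] f (suc m + i)) (sym (∑-upTo-suc m f)))))

∑-blocks : ∀ M J (f : ℕ → ℕ) → ∑ (upTo (M * J)) f ≡ ∑[ b ∈ upTo M ] ∑[ j ∈ upTo J ] f (b * J + j)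
∑-blocks zero    J f = refl
∑-blocks (suc M) J f = trans (∑-upTo-+ J (M * J) f) (trans (cong (_+_ (∑ (upTo J) f))
  (trans (∑-blocks M J (λ i → f (J + i))) (∑-cong (upTo M) λ b _ → ∑-cong (upTo J) λ j _ →
      cong f (sym (+-assoc J (b * J) j)))))
  (sym (∑-upTo-suc M (λ b → ∑[ j ∈ upTo J ] f (b * J + j)))))

dense-block : ∀ M J (f : ℕ → ℕ) a b → 0 < M → a * (M * J) ≤ b * ∑ (upTo (M * J)) f →
  ∃ λ p → a * J ≤ b * ∑[ j ∈ upTo J ] f (p + j)
dense-block M J f a b M>0 le =
  let (q , _ , r) = averaging (upTo M) (λ _ → a * J) (λ q → b * ∑[ j ∈ upTo J ] f (q * J + j))
          (subst (0 <_) (sym (length-upTo M)) M>0) (begin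
        ∑[ _ ∈ upTo M ] (a * J) ≡⟨ trans (∑-const (upTo M) (a * J)) (cong (_* (a * J)) (length-upTo M)) ⟩
        M * (a * J) ≡⟨ lemma M a J ⟩
        a * (M * J) ≤⟨ le ⟩
        b * ∑ (upTo (M * J)) f ≡⟨ cong (b *_) (∑-blocks M J f) ⟩
        b * (∑[ q ∈ upTo M ] ∑[ j ∈ upTo J ] f (q * J + j)) ≡⟨ sym (∑-*ˡ (upTo M) b _) ⟩
        ∑[ q ∈ upTo M ] (b * ∑[ j ∈ upTo J ] f (q * J + j)) ∎)
  in q * J , r
  where
  open ≤-Reasoning
  lemma : ∀ M a J → M * (a * J) ≡ a * (M * J)
  lemma = solve-∀

-- Sets with all midpoints inside a given set

Midpointed : ℕ → (ℕ → ℕ) → Set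
Midpointed m χ = ∃ λ Z → length Z ≡ m × Unique Z × (∀ {z} → z ∈ Z → 0 < χ z) ×
  (∀ {z z′} → z ∈ Z → z′ ∈ Z → ∃ λ y → z + z′ ≡ y + y × 0 < χ y)

midpointed-affine : ∀ {m} χ p D → 0 < D → Midpointed m (λ j → χ (p + j * D)) → Midpointed m χ
midpointed-affine {m} χ p D D>0 (Z , len , uZ , Z⊆ , mid) =
  map φ Z , trans (length-map φ Z) len , Unique-map φ (λ {x} {y} _ _ eq → *-cancelʳ-≡ x y D {{>-nonZero D>0}}
      (+-cancelˡ-≡ p _ _ eq)) uZ ,
  (λ z∈ → let (i , i∈ , z≡) = ∈-map⁻ φ z∈ in subst (λ z → 0 < χ z) (sym z≡) (Z⊆ i∈)) ,
  λ z∈ z′∈ → let (i , i∈ , z≡) = ∈-map⁻ φ z∈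
                 (i′ , i′∈ , z′≡) = ∈-map⁻ φ z′∈
                 (y , eq , y∈) = mid i∈ i′∈
             in φ y , trans (cong₂ _+_ z≡ z′≡) (trans (lemma p i i′ D)
                 (trans (cong (λ e → p + p + e * D) eq) (sym (lemma p y y D)))) , y∈
  where
  φ : ℕ → ℕ
  φ j = p + j * D
  lemma : ∀ p i i′ D → p + i * D + (p + i′ * D) ≡ p + p + (i + i′) * D
  lemma = solve-∀

-- Fixing d turns three-term progressions e + i, e + d + i, e + 2d + i inside `χ` into a set of
-- offsets i, to which the next round can be applied.
centred : (ℕ → ℕ) → ℕ → ℕ → ℕ → ℕ → ℕ
centred χ w e d i = 𝟙 (i <? w) * (χ (e + i) * (χ (e + d + i) * χ (e + d + d + i)))

>0-*ˡ : ∀ m n → 0 < m * n → 0 < m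
>0-*ˡ (suc m) n _ = z<s

>0-*ʳ : ∀ m n → 0 < m * n → 0 < n
>0-*ʳ m n p = >0-*ˡ n m (subst (0 <_) (*-comm m n) p)

-- The new points are e + Z and e + 2d + Z. If y is the midpoint of two offsets, the new midpoints
-- are e + y and e + 2d + y within a copy and e + d + y across the copies. Offsets are below w ≤ d,
-- so the copies are disjoint.
midpointed-double : ∀ {m} χ w e d → w ≤ d → Midpointed m (centred χ w e d) → Midpointed (2 * m) χ
midpointed-double {m} χ w e d w≤d (Z , len , uZ , Z⊆ , mid) =
  map left Z ++ map right Z ,
  trans (length-++ (map left Z)) (cong₂ _+_ (trans (length-map left Z) len)
      (trans (length-map right Z) (trans len (sym (+-identityʳ m))))) ,
  Uniqueₚ.++⁺ (Unique-map left (λ _ _ → +-cancelˡ-≡ e _ _) uZ)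
      (Unique-map right (λ _ _ → +-cancelˡ-≡ (e + d + d) _ _) uZ) disjoint ,
  (λ z∈ → [ (λ p → let (i , i∈ , z≡) = ∈-map⁻ left p in subst (λ z → 0 < χ z) (sym z≡) (proj₁ (parts (Z⊆ i∈)))) ,
            (λ p → let (i , i∈ , z≡) = ∈-map⁻ right p in subst (λ z → 0 < χ z) (sym z≡) (proj₂ (proj₂ (parts (Z⊆ i∈)))))
                ]′ (∈-++⁻ (map left Z) z∈)) ,
  λ z∈ z′∈ → cases (∈-++⁻ (map left Z) z∈) (∈-++⁻ (map left Z) z′∈)
  where
  left right : ℕ → ℕ
  left i = e + i
  right i = e + d + d + i
  parts : ∀ {i} → 0 < centred χ w e d i → 0 < χ (e + i) × 0 < χ (e + d + i) × 0 < χ (e + d + d + i)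
  parts {i} p = let q = >0-*ʳ (𝟙 (i <? w)) _ p
                    r = >0-*ʳ (χ (e + i)) _ q
                in >0-*ˡ (χ (e + i)) _ q , >0-*ˡ (χ (e + d + i)) _ r , >0-*ʳ (χ (e + d + i)) _ r
  disjoint : ∀ {z} → ¬ (z ∈ map left Z × z ∈ map right Z)
  disjoint (p , q) = let (i , i∈ , z≡) = ∈-map⁻ left p
                         (i′ , i′∈ , z′≡) = ∈-map⁻ right q
                         i<w = 𝟙>0 (i <? w) (>0-*ˡ (𝟙 (i <? w)) _ (Z⊆ i∈))
                     in <⇒≱ i<w (≤-trans w≤d (≤-trans (m≤n+m d (d + i′))
                         (≤-reflexive (sym (+-cancelˡ-≡ e _ _ (trans (trans (sym z≡) z′≡) (lemma₄ e d i′)))))))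
    where
    lemma₄ : ∀ e d i → e + d + d + i ≡ e + (d + i + d)
    lemma₄ = solve-∀
  lemma₁ : ∀ e i i′ → e + i + (e + i′) ≡ e + e + (i + i′)
  lemma₁ = solve-∀
  lemma₂ : ∀ e d i i′ → e + i + (e + d + d + i′) ≡ e + d + (e + d) + (i + i′)
  lemma₂ = solve-∀
  Mid : ℕ → ℕ → Set
  Mid z z′ = ∃ λ y → z + z′ ≡ y + y × 0 < χ y
  cases : ∀ {z z′} → z ∈ map left Z ⊎ z ∈ map right Z → z′ ∈ map left Z ⊎ z′ ∈ map right Z → Mid z z′
  cases (inj₁ p) (inj₁ q) =
    let (i , i∈ , z≡) = ∈-map⁻ left p ; (i′ , i′∈ , z′≡) = ∈-map⁻ left q ; (y , eq , y∈) = mid i∈ i′∈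
    in e + y , trans (cong₂ _+_ z≡ z′≡) (trans (lemma₁ e i i′) (trans (cong (_+_ (e + e)) eq) (sym (lemma₁ e y y)))) ,
        proj₁ (parts y∈)
  cases (inj₁ p) (inj₂ q) =
    let (i , i∈ , z≡) = ∈-map⁻ left p ; (i′ , i′∈ , z′≡) = ∈-map⁻ right q ; (y , eq , y∈) = mid i∈ i′∈
    in e + d + y , trans (cong₂ _+_ z≡ z′≡) (trans (lemma₂ e d i i′)
        (trans (cong (_+_ (e + d + (e + d))) eq) (sym (lemma₁ (e + d) y y)))) , proj₁ (proj₂ (parts y∈))
  cases (inj₂ p) (inj₁ q) =
    let (i , i∈ , z≡) = ∈-map⁻ right p ; (i′ , i′∈ , z′≡) = ∈-map⁻ left q ; (y , eq , y∈) = mid i′∈ i∈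
    in e + d + y , trans (cong₂ _+_ z≡ z′≡) (trans (+-comm (right i) (left i′))
        (trans (lemma₂ e d i′ i) (trans (cong (_+_ (e + d + (e + d))) eq) (sym (lemma₁ (e + d) y y))))) , proj₁
        (proj₂ (parts y∈))
  cases (inj₂ p) (inj₂ q) =
    let (i , i∈ , z≡) = ∈-map⁻ right p ; (i′ , i′∈ , z′≡) = ∈-map⁻ right q ; (y , eq , y∈) = mid i∈ i′∈
    in e + d + d + y , trans (cong₂ _+_ z≡ z′≡) (trans (lemma₁ (e + d + d) i i′)
        (trans (cong (_+_ (e + d + d + (e + d + d))) eq) (sym (lemma₁ (e + d + d) y y)))) , proj₂ (proj₂ (parts y∈))

-- Roth's count in the absence of a density increment

∑-product : {I J : Set} (xs : List I) (ys : List J) (f : I → ℕ) (g : J → ℕ) →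
            ∑ xs f * ∑ ys g ≡ ∑[ x ∈ xs ] ∑[ y ∈ ys ] (f x * g y)
∑-product xs ys f g = trans (sym (∑-*ʳ xs f (∑ ys g))) (∑-cong xs λ x _ → sym (∑-*ˡ ys (f x) g))

progression : (ℕ → ℕ) → ℕ → ℕ → ℕ → ℕ
progression χ D J p = ∑[ j ∈ upTo J ] χ (p + j * D)

-- The progression starting at z has less than half of the density a / b.
bad : (ℕ → ℕ) → ℕ → ℕ → ℕ → ℕ → ℕ → ℕ
bad χ a b D J z = 𝟙 (2 * (b * progression χ D J z) <? a * J)

-- Densities along progressions have mean about a / b and by assumption never exceed 65/64 of it, so
-- they rarely fall below half. The weights 66, 128, 130 balance both cases of `pointwise`; 66 = 2 ·
-- 32 + 2 collects the slack over 32 w starting points and the boundary loss.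
bad-count : ∀ χ a b w D J → (∀ x → χ x ≤ 1) → 0 < a → 0 < J →
  a * (32 * w) ≤ b * ∑ (upTo (32 * w)) χ →
  (∀ {p} → p < 32 * w → 64 * (b * progression χ D J p) ≤ 65 * (a * J)) →
  64 * (b * (J * D)) ≤ a * w →
  ∑[ z ∈ upTo (32 * w) ] bad χ a b D J z ≤ w
bad-count χ a b w D J χ≤1 a>0 J>0 dense noinc small =
  *-cancelˡ-≤ (66 * (a * J)) {{>-nonZero (*-mono-< (z<s {65}) (*-mono-< a>0 J>0))}}
    (+-cancelʳ-≤ (128 * (J * (a * N))) _ _ (begin
      66 * (a * J) * Bad + 128 * (J * (a * N)) ≤⟨ +-monoʳ-≤ (66 * (a * J) * Bad) (*-monoʳ-≤ 128 shifted) ⟩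
      66 * (a * J) * Bad + 128 * (b * ΣG + b * (J * (J * D))) ≡⟨ e₁ (66 * (a * J) * Bad) (b * ΣG) b J D ⟩
      66 * (a * J) * Bad + 128 * (b * ΣG) + 2 * (J * (64 * (b * (J * D)))) ≤⟨ +-mono-≤ summed
          (*-monoʳ-≤ 2 (*-monoʳ-≤ J small)) ⟩
      N * (130 * (a * J)) + 2 * (J * (a * w)) ≡⟨ e₂ a J w ⟩
      66 * (a * J) * w + 128 * (J * (a * N)) ∎))
  where
  open ≤-Reasoning
  N = 32 * w
  γ = progression χ D J
  ΣG = ∑ (upTo N) γ
  Bad = ∑[ z ∈ upTo N ] bad χ a b D J z
  e₁ : ∀ x g b J D → x + 128 * (g + b * (J * (J * D))) ≡ x + 128 * g + 2 * (J * (64 * (b * (J * D))))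
  e₁ = solve-∀
  e₂ : ∀ a J w → 32 * w * (130 * (a * J)) + 2 * (J * (a * w)) ≡ 66 * (a * J) * w + 128 * (J * (a * (32 * w)))
  e₂ = solve-∀
  pointwise : ∀ z → z < N → 66 * (a * J) * bad χ a b D J z + 128 * (b * γ z) ≤ 130 * (a * J)
  pointwise z z< with 2 * (b * γ z) <? a * J
  ... | yes p = begin
    66 * (a * J) * 1 + 128 * (b * γ z) ≡⟨ f₁ (a * J) (b * γ z) ⟩
    66 * (a * J) + 64 * (2 * (b * γ z)) ≤⟨ +-monoʳ-≤ (66 * (a * J)) (*-monoʳ-≤ 64 (<⇒≤ p)) ⟩
    66 * (a * J) + 64 * (a * J) ≡⟨ f₂ (a * J) ⟩
    130 * (a * J) ∎
    where
    f₁ : ∀ x g → 66 * x * 1 + 128 * g ≡ 66 * x + 64 * (2 * g)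
    f₁ = solve-∀
    f₂ : ∀ x → 66 * x + 64 * x ≡ 130 * x
    f₂ = solve-∀
  ... | no _ = begin
    66 * (a * J) * 0 + 128 * (b * γ z) ≡⟨ f₁ (a * J) (b * γ z) ⟩
    2 * (64 * (b * γ z)) ≤⟨ *-monoʳ-≤ 2 (noinc z<) ⟩
    2 * (65 * (a * J)) ≡⟨ f₂ (a * J) ⟩
    130 * (a * J) ∎
    where
    f₁ : ∀ x g → 66 * x * 0 + 128 * g ≡ 2 * (64 * g)
    f₁ = solve-∀
    f₂ : ∀ x → 2 * (65 * x) ≡ 130 * x
    f₂ = solve-∀
  summed : 66 * (a * J) * Bad + 128 * (b * ΣG) ≤ N * (130 * (a * J))
  summed = begin
    66 * (a * J) * Bad + 128 * (b * ΣG)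
      ≡⟨ cong₂ _+_ (sym (∑-*ˡ (upTo N) (66 * (a * J)) _)) (trans (cong (128 *_) (sym (∑-*ˡ (upTo N) b γ)))
          (sym (∑-*ˡ (upTo N) 128 _))) ⟩
    ∑[ z ∈ upTo N ] (66 * (a * J) * bad χ a b D J z) + ∑[ z ∈ upTo N ] (128 * (b * γ z)) ≡⟨ sym (∑-+ (upTo N) _ _) ⟩
    ∑[ z ∈ upTo N ] (66 * (a * J) * bad χ a b D J z + 128 * (b * γ z)) ≤⟨ ∑-≤ (upTo N)
        (λ z z∈ → pointwise z (∈-upTo⁻ z∈)) ⟩
    length (upTo N) * (130 * (a * J)) ≡⟨ cong (_* (130 * (a * J))) (length-upTo N) ⟩
    N * (130 * (a * J)) ∎
  shift : ∀ s → ∑ (upTo N) χ ≤ s + ∑[ z ∈ upTo N ] χ (z + s)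
  shift s = begin
    ∑ (upTo N) χ ≤⟨ ∑-upTo-mono χ (m≤n+m N s) ⟩
    ∑ (upTo (s + N)) χ ≡⟨ ∑-upTo-+ s N χ ⟩
    ∑ (upTo s) χ + ∑[ z ∈ upTo N ] χ (s + z) ≤⟨ +-mono-≤ (≤-trans (∑-≤ (upTo s) (λ x _ → χ≤1 x))
        (≤-reflexive (trans (*-identityʳ _) (length-upTo s))))
                                                                (≤-reflexive (∑-cong (upTo N) λ z _ →
                                                                    cong χ (+-comm s z))) ⟩
    s + ∑[ z ∈ upTo N ] χ (z + s) ∎
  shifted : J * (a * N) ≤ b * ΣG + b * (J * (J * D))
  shifted = begin
    J * (a * N) ≤⟨ *-monoʳ-≤ J dense ⟩
    J * (b * ∑ (upTo N) χ) ≡⟨ f₁ J b (∑ (upTo N) χ) ⟩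
    b * (J * ∑ (upTo N) χ) ≡⟨ cong (λ l → b * (l * ∑ (upTo N) χ)) (sym (length-upTo J)) ⟩
    b * (length (upTo J) * ∑ (upTo N) χ) ≤⟨ *-monoʳ-≤ b (∑-≥ (upTo J) λ j j∈ → ≤-trans (shift (j * D))
        (+-monoˡ-≤ _ (*-monoˡ-≤ D (<⇒≤ (∈-upTo⁻ j∈))))) ⟩
    b * (∑[ j ∈ upTo J ] (J * D + ∑[ z ∈ upTo N ] χ (z + j * D))) ≡⟨ cong (b *_)
        (trans (∑-+ (upTo J) _ _) (cong₂ _+_ (trans (∑-const (upTo J) (J * D)) (cong (_* (J * D)) (length-upTo J)))
        (∑-swap (upTo J) (upTo N) _))) ⟩
    b * (J * (J * D) + ΣG) ≡⟨ f₂ b (J * (J * D)) ΣG ⟩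
    b * ΣG + b * (J * (J * D)) ∎
    where
    f₁ : ∀ J b c → J * (b * c) ≡ b * (J * c)
    f₁ = solve-∀
    f₂ : ∀ b x y → b * (x + y) ≡ b * y + b * x
    f₂ = solve-∀

-- The interval has length 32 w; midpoints are taken from [16w, 17w) and left end points from (2w, 15w], so that the
-- difference is at least w and the right end point stays below 32 w.  Below, y stands for twice the midpoint.
reflected-product : ∀ χ a b w D J y → ∑[ z ∈ upTo (32 * w) ] bad χ a b D J z ≤ w →
  32 * w ≤ y → y < 34 * w →
  10 * w * (a * J) ² ≤ 4 * (b * b * ∑[ q ∈ upTo (12 * w) ] (progression χ D J (2 * w + suc q) * progression χ D J
      (y ∸ (2 * w + suc q))))
reflected-product χ a b w D J y bad≤ y≥ y< = +-cancelʳ-≤ ((a * J) ² * (w + w)) _ _ (begin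
  10 * w * (a * J) ² + (a * J) ² * (w + w) ≡⟨ e₁ w ((a * J) ²) ⟩
  12 * w * (a * J) ² ≡⟨ cong (_* (a * J) ²) (sym (length-upTo (12 * w))) ⟩
  length (upTo (12 * w)) * (a * J) ² ≤⟨ ∑-≥ (upTo (12 * w)) (λ q _ → pointwise (p q) (y ∸ p q)) ⟩
  ∑[ q ∈ upTo (12 * w) ] (4 * (b * b * (γ (p q) * γ (y ∸ p q))) + (a * J) ² * (B (p q) + B (y ∸ p q)))
    ≡⟨ trans (∑-+ (upTo (12 * w)) _ _) (cong₂ _+_ (trans (∑-*ˡ (upTo (12 * w)) 4 _)
        (cong (4 *_) (∑-*ˡ (upTo (12 * w)) (b * b) _)))
         (trans (∑-*ˡ (upTo (12 * w)) ((a * J) ²) _) (cong ((a * J) ² *_) (∑-+ (upTo (12 * w)) _ _)))) ⟩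
  4 * (b * b * S) + (a * J) ² * (∑[ q ∈ upTo (12 * w) ] B (p q) + ∑[ q ∈ upTo (12 * w) ] B (y ∸ p q))
    ≤⟨ +-monoʳ-≤ (4 * (b * b * S)) (*-monoʳ-≤ ((a * J) ²) (+-mono-≤
         (≤-trans (∑-inj p B (upTo⁺ (12 * w)) (λ _ _ → p-inj) (λ q∈ → ∈-upTo⁺ (p< (∈-upTo⁻ q∈)))) bad≤)
         (≤-trans (∑-inj (λ q → y ∸ p q) B (upTo⁺ (12 * w)) (λ q∈ q′∈ eq →
             p-inj (∸-cancelˡ-≡ (p≤y (∈-upTo⁻ q∈)) (p≤y (∈-upTo⁻ q′∈)) eq)) (λ q∈ → ∈-upTo⁺ (y∸p<))) bad≤))) ⟩
  4 * (b * b * S) + (a * J) ² * (w + w) ∎)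
  where
  open ≤-Reasoning
  γ = progression χ D J
  B = bad χ a b D J
  p : ℕ → ℕ
  p q = 2 * w + suc q
  S = ∑[ q ∈ upTo (12 * w) ] (γ (p q) * γ (y ∸ p q))
  e₁ : ∀ w s → 10 * w * s + s * (w + w) ≡ 12 * w * s
  e₁ = solve-∀
  p-inj : ∀ {q q′} → p q ≡ p q′ → q ≡ q′
  p-inj eq = suc-injective (+-cancelˡ-≡ (2 * w) _ _ eq)
  p≤14 : ∀ {q} → q < 12 * w → p q ≤ 14 * w
  p≤14 {q} q< = ≤-trans (+-monoʳ-≤ (2 * w) q<) (≤-reflexive (lemma w))
    where
    lemma : ∀ w → 2 * w + 12 * w ≡ 14 * w
    lemma = solve-∀
  0<w : ∀ {q} → q < 12 * w → 0 < w
  0<w q< = >0-*ʳ 12 w (≤-<-trans z≤n q<)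
  p< : ∀ {q} → q < 12 * w → p q < 32 * w
  p< {q} q< = ≤-<-trans (p≤14 q<) (*-monoˡ-< w {{>-nonZero (0<w q<)}} {14} {32} (≤ᵇ⇒≤ 15 32 _))
  p≤y : ∀ {q} → q < 12 * w → p q ≤ y
  p≤y q< = ≤-trans (<⇒≤ (p< q<)) y≥
  y∸p< : ∀ {q} → y ∸ p q < 32 * w
  y∸p< {q} = +-cancelˡ-< (2 * w) _ _ (begin-strict
    2 * w + (y ∸ p q) ≤⟨ +-monoʳ-≤ (2 * w) (∸-monoʳ-≤ y (m≤m+n (2 * w) (suc q))) ⟩
    2 * w + (y ∸ 2 * w) ≡⟨ m+[n∸m]≡n (≤-trans (*-monoˡ-≤ w {2} {32} (≤ᵇ⇒≤ 2 32 _)) y≥) ⟩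
    y <⟨ y< ⟩
    34 * w ≡⟨ lemma w ⟩
    2 * w + 32 * w ∎)
    where
    lemma : ∀ w → 34 * w ≡ 2 * w + 32 * w
    lemma = solve-∀
  -- Each bad end pays the full (a J)², and at most w choices of q make a given end bad; of 12 w
  -- choices this leaves 10 w.
  pointwise : ∀ p z → (a * J) ² ≤ 4 * (b * b * (γ p * γ z)) + (a * J) ² * (B p + B z)
  pointwise p z with 2 * (b * γ p) <? a * J | 2 * (b * γ z) <? a * J
  ... | yes _ | d     = ≤-trans (≤-reflexive (sym (*-identityʳ _)))
      (≤-trans (*-monoʳ-≤ ((a * J) ²) (m≤m+n 1 (𝟙 d))) (m≤n+m _ _))
  ... | no _  | yes _ = ≤-trans (≤-reflexive (sym (*-identityʳ _))) (m≤n+m _ _)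
  ... | no r  | no s  = ≤-trans (*-mono-≤ (≮⇒≥ r) (≮⇒≥ s)) (≤-trans (≤-reflexive (lemma b (γ p) (γ z))) (m≤m+n _ _))
    where
    lemma : ∀ b g h → 2 * (b * g) * (2 * (b * h)) ≡ 4 * (b * b * (g * h))
    lemma = solve-∀

-- With left point x = 15 w - v the right point is y - x + (i + j) D. The left factor then depends
-- on v alone, and the smoothing only shifts the correlation of `χ` with `ys` by (i + j) D, which
-- almost periodicity can remove.
smoothed-count : ∀ χ w D J (ys : List ℕ) → (∀ {y} → y ∈ ys → 32 * w ≤ y) → J * D ≤ w →
  ∑[ y ∈ ys ] ∑[ q ∈ upTo (12 * w) ] (progression χ D J (2 * w + suc q) * progression χ D J (y ∸ (2 * w + suc q)))
  ≤ ∑[ i ∈ upTo J ] ∑[ j ∈ upTo J ] ∑[ v ∈ upTo (13 * w) ] (χ (15 * w ∸ v) * ∑[ y ∈ ys ] χ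
      (v + (i + j) * D + y ∸ 15 * w))
smoothed-count χ w D J ys ys≥ JD≤ = begin
  ∑[ y ∈ ys ] ∑[ q ∈ upTo (12 * w) ] (γ (p q) * γ (y ∸ p q))
    ≡⟨ ∑-cong ys (λ y _ → trans (∑-cong (upTo (12 * w)) λ q _ → ∑-product (upTo J) (upTo J) _ _)
          (trans (∑-swap (upTo (12 * w)) (upTo J) _) (∑-cong (upTo J) λ i _ → ∑-swap (upTo (12 * w)) (upTo J) _))) ⟩
  ∑[ y ∈ ys ] ∑[ i ∈ upTo J ] ∑[ j ∈ upTo J ] ∑[ q ∈ upTo (12 * w) ] (χ (p q + i * D) * χ (y ∸ p q + j * D))
    ≤⟨ ∑-mono ys (λ y y∈ → ∑-mono (upTo J) λ i i∈ → ∑-mono (upTo J) λ j _ → substitute y i j (ys≥ y∈)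
        (<⇒≤ (∈-upTo⁻ i∈))) ⟩
  ∑[ y ∈ ys ] ∑[ i ∈ upTo J ] ∑[ j ∈ upTo J ] ∑[ v ∈ upTo (13 * w) ] (χ (15 * w ∸ v) * χ (v + (i + j) * D + y ∸ 15 * w))
    ≡⟨ trans (∑-swap ys (upTo J) _) (∑-cong (upTo J) λ i _ → trans (∑-swap ys (upTo J) _) (∑-cong (upTo J) λ j _ →
         trans (∑-swap ys (upTo (13 * w)) _) (∑-cong (upTo (13 * w)) λ v _ → ∑-*ˡ ys (χ (15 * w ∸ v)) _))) ⟩
  ∑[ i ∈ upTo J ] ∑[ j ∈ upTo J ] ∑[ v ∈ upTo (13 * w) ] (χ (15 * w ∸ v) * ∑[ y ∈ ys ] χ (v + (i + j) * D + y ∸ 15 * w))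
      ∎
  where
  open ≤-Reasoning
  γ = progression χ D J
  p : ℕ → ℕ
  p q = 2 * w + suc q
  substitute : ∀ y i j → 32 * w ≤ y → i ≤ J →
    ∑[ q ∈ upTo (12 * w) ] (χ (p q + i * D) * χ (y ∸ p q + j * D)) ≤ ∑[ v ∈ upTo (13 * w) ]
        (χ (15 * w ∸ v) * χ (v + (i + j) * D + y ∸ 15 * w))
  substitute y i j y≥ i≤ = ≤-trans (≤-reflexive (∑-cong (upTo (12 * w)) λ q q∈ → cong₂ _*_ (cong χ (x≡ q (∈-upTo⁻ q∈)))
      (cong χ (z≡ q (∈-upTo⁻ q∈)))))
    (∑-inj v (λ v → χ (15 * w ∸ v) * χ (v + (i + j) * D + y ∸ 15 * w)) (upTo⁺ (12 * w))
        (λ q∈ q′∈ eq → inj (∸-cancelˡ-≡ (x≤ _ (∈-upTo⁻ q∈)) (x≤ _ (∈-upTo⁻ q′∈)) eq))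
       (λ {q} q∈ → ∈-upTo⁺ (v< q (∈-upTo⁻ q∈))))
    where
    x : ℕ → ℕ
    x q = p q + i * D
    v : ℕ → ℕ
    v q = 15 * w ∸ x q
    inj : ∀ {q q′} → x q ≡ x q′ → q ≡ q′
    inj eq = suc-injective (+-cancelˡ-≡ (2 * w) _ _ (+-cancelʳ-≡ (i * D) _ _ eq))
    x≤ : ∀ q → q < 12 * w → x q ≤ 15 * w
    x≤ q q< = ≤-trans (+-mono-≤ (+-monoʳ-≤ (2 * w) q<) (≤-trans (*-monoˡ-≤ D i≤) JD≤)) (≤-reflexive (lemma w))
      where
      lemma : ∀ w → 2 * w + 12 * w + w ≡ 15 * w
      lemma = solve-∀
    x≡ : ∀ q → q < 12 * w → x q ≡ 15 * w ∸ v q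
    x≡ q q< = sym (m∸[m∸n]≡n (x≤ q q<))
    p≤y : ∀ q → q < 12 * w → p q ≤ y
    p≤y q q< = ≤-trans (≤-trans (m≤m+n (p q) (i * D)) (≤-trans (x≤ q q<) (*-monoˡ-≤ w {15} {32} (≤ᵇ⇒≤ 15 32 _)))) y≥
    z≡ : ∀ q → q < 12 * w → y ∸ p q + j * D ≡ v q + (i + j) * D + y ∸ 15 * w
    z≡ q q< = sym (begin-equality
      v q + (i + j) * D + y ∸ 15 * w ≡⟨ cong (λ e → v q + (i + j) * D + e ∸ 15 * w) (sym (m∸n+n≡m (p≤y q q<))) ⟩
      v q + (i + j) * D + (y ∸ p q + p q) ∸ 15 * w ≡⟨ cong (_∸ 15 * w) (lemma (v q) i j D (y ∸ p q) (p q)) ⟩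
      y ∸ p q + j * D + (v q + x q) ∸ 15 * w ≡⟨ cong (λ e → y ∸ p q + j * D + e ∸ 15 * w) (m∸n+n≡m (x≤ q q<)) ⟩
      y ∸ p q + j * D + 15 * w ∸ 15 * w ≡⟨ m+n∸n≡m _ (15 * w) ⟩
      y ∸ p q + j * D ∎)
      where
      lemma : ∀ v i j D z p → v + (i + j) * D + (z + p) ≡ z + j * D + (v + (p + i * D))
      lemma = solve-∀
    v< : ∀ q → q < 12 * w → v q < 13 * w
    v< q q< = +-cancelˡ-< (x q) _ _ (begin-strict
      x q + v q ≡⟨ m+[n∸m]≡n (x≤ q q<) ⟩
      15 * w ≡⟨ lemma w ⟩
      2 * w + 13 * w <⟨ +-monoˡ-< (13 * w) (m<m+n (2 * w) z<s) ⟩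
      p q + 13 * w ≤⟨ +-monoˡ-≤ (13 * w) (m≤m+n (p q) (i * D)) ⟩
      x q + 13 * w ∎)
      where
      lemma : ∀ w → 15 * w ≡ 2 * w + 13 * w
      lemma = solve-∀

interval-bound : ∀ χ a b N m J → (∀ {p} → p < N → 64 * (b * progression χ 1 J p) ≤ 65 * (a * J)) → 0 < J →
  ∀ s → s + m * J ≤ N → 64 * (b * ∑[ i ∈ upTo (m * J) ] χ (s + i)) ≤ 65 * (a * (m * J))
interval-bound χ a b N m J noinc J>0 s fits = begin
  64 * (b * ∑[ i ∈ upTo (m * J) ] χ (s + i)) ≡⟨ cong (λ e → 64 * (b * e)) (∑-blocks m J (λ i → χ (s + i))) ⟩
  64 * (b * ∑[ q ∈ upTo m ] ∑[ j ∈ upTo J ] χ (s + (q * J + j))) ≡⟨ sym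
      (trans (∑-*ˡ (upTo m) 64 _) (cong (64 *_) (∑-*ˡ (upTo m) b _))) ⟩
  ∑[ q ∈ upTo m ] (64 * (b * ∑[ j ∈ upTo J ] χ (s + (q * J + j)))) ≤⟨ ∑-≤ (upTo m)
      (λ q q∈ → ≤-trans (≤-reflexive (cong (λ e → 64 * (b * e)) (∑-cong (upTo J) λ j _ → cong χ (re s (q * J) j))))
                                                                                    (noinc (inside q (∈-upTo⁻ q∈)))) ⟩
  length (upTo m) * (65 * (a * J)) ≡⟨ cong (_* (65 * (a * J))) (length-upTo m) ⟩
  m * (65 * (a * J)) ≡⟨ re₂ m a J ⟩
  65 * (a * (m * J)) ∎
  where
  open ≤-Reasoning
  re : ∀ s q j → s + (q + j) ≡ s + q + j * 1
  re = solve-∀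
  re₂ : ∀ m a J → m * (65 * (a * J)) ≡ 65 * (a * (m * J))
  re₂ = solve-∀
  inside : ∀ q → q < m → s + q * J < N
  inside q q< = <-≤-trans (+-monoʳ-< s (*-monoˡ-< J {{>-nonZero J>0}} q<)) fits

-- The other 31 pieces of length w have density at most 65/64 of a / b, which leaves 64 · 32 - 65 ·
-- 31 = 33 sixty-fourths for the middle one.
middle-dense : ∀ χ a b M J → (∀ {p} → p < 32 * (M * J) → 64 * (b * progression χ 1 J p) ≤ 65 * (a * J)) → 0 < J →
  a * (32 * (M * J)) ≤ b * ∑ (upTo (32 * (M * J))) χ →
  33 * (a * (M * J)) ≤ 64 * (b * ∑[ i ∈ upTo (M * J) ] χ (16 * (M * J) + i))
middle-dense χ a b M J noinc J>0 dense = +-cancelʳ-≤ (2015 * (a * w)) _ _ (begin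
  33 * (a * w) + 2015 * (a * w) ≡⟨ e₁ a w ⟩
  64 * (a * (32 * w)) ≤⟨ *-monoʳ-≤ 64 dense ⟩
  64 * (b * ∑ (upTo (32 * w)) χ) ≡⟨ cong (λ e → 64 * (b * e)) split ⟩
  64 * (b * (A + (B + C))) ≡⟨ e₂ b A B C ⟩
  64 * (b * B) + (64 * (b * A) + 64 * (b * C)) ≤⟨ +-monoʳ-≤ (64 * (b * B)) (+-mono-≤ boundA boundC) ⟩
  64 * (b * B) + (65 * (a * (16 * w)) + 65 * (a * (15 * w))) ≡⟨ cong (_+_ (64 * (b * B))) (e₃ a w) ⟩
  64 * (b * B) + 2015 * (a * w) ∎)
  where
  open ≤-Reasoning
  w = M * J
  A = ∑ (upTo (16 * w)) χ
  B = ∑[ i ∈ upTo w ] χ (16 * w + i)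
  C = ∑[ i ∈ upTo (15 * w) ] χ (17 * w + i)
  e₁ : ∀ a w → 33 * (a * w) + 2015 * (a * w) ≡ 64 * (a * (32 * w))
  e₁ = solve-∀
  e₂ : ∀ b A B C → 64 * (b * (A + (B + C))) ≡ 64 * (b * B) + (64 * (b * A) + 64 * (b * C))
  e₂ = solve-∀
  e₃ : ∀ a w → 65 * (a * (16 * w)) + 65 * (a * (15 * w)) ≡ 2015 * (a * w)
  e₃ = solve-∀
  n₁ : ∀ w → 32 * w ≡ 16 * w + (w + 15 * w)
  n₁ = solve-∀
  n₂ : ∀ w i → 16 * w + (w + i) ≡ 17 * w + i
  n₂ = solve-∀
  split : ∑ (upTo (32 * w)) χ ≡ A + (B + C)
  split = trans (cong (λ n → ∑ (upTo n) χ) (n₁ w)) (trans (∑-upTo-+ (16 * w) (w + 15 * w) χ) (cong (_+_ A)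
    (trans (∑-upTo-+ w (15 * w) _) (cong (_+_ B) (∑-cong (upTo (15 * w)) λ i _ → cong χ (n₂ w i))))))
  block : ∀ c s → s + c * w ≤ 32 * w → 64 * (b * ∑[ i ∈ upTo (c * w) ] χ (s + i)) ≤ 65 * (a * (c * w))
  block c s fits = subst (λ n → 64 * (b * ∑[ i ∈ upTo n ] χ (s + i)) ≤ 65 * (a * n)) {x = c * M * J} {y = c * w}
      (*-assoc c M J)
    (interval-bound χ a b (32 * w) (c * M) J noinc J>0 s (≤-trans (≤-reflexive (cong (_+_ s) (*-assoc c M J))) fits))
  boundA : 64 * (b * A) ≤ 65 * (a * (16 * w))
  boundA = block 16 0 (*-monoˡ-≤ w {16} {32} (≤ᵇ⇒≤ 16 32 _))
  boundC : 64 * (b * C) ≤ 65 * (a * (15 * w))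
  boundC = block 15 (17 * w) (≤-reflexive (n₃ w))
    where
    n₃ : ∀ w → 17 * w + 15 * w ≡ 32 * w
    n₃ = solve-∀

-- AM-GM with weight e in place of Cauchy-Schwarz: an L² estimate becomes an L¹ estimate without
-- square roots.
deviation : ∀ e n m m′ → 2 * (e * n * m) ≤ 2 * (e * n * m′) + (e * e * dist² m m′ + n * n)
deviation e n m m′ = begin
  2 * (e * n * m) ≤⟨ *-monoʳ-≤ 2 (*-monoʳ-≤ (e * n) (m≤n+∣m-n∣ m m′)) ⟩
  2 * (e * n * (m′ + δ)) ≡⟨ lemma₁ e n m′ δ ⟩
  2 * (e * n * m′) + 2 * ((e * δ) * n) ≤⟨ +-monoʳ-≤ (2 * (e * n * m′)) (amgm (e * δ) n) ⟩
  2 * (e * n * m′) + (e * δ * (e * δ) + n * n) ≡⟨ cong (λ x → 2 * (e * n * m′) + (x + n * n)) (lemma₂ e δ) ⟩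
  2 * (e * n * m′) + (e * e * dist² m m′ + n * n) ∎
  where
  open ≤-Reasoning
  δ = ∣ m - m′ ∣
  lemma₁ : ∀ e n m δ → 2 * (e * n * (m + δ)) ≡ 2 * (e * n * m) + 2 * (e * δ * n)
  lemma₁ = solve-∀
  lemma₂ : ∀ e δ → e * δ * (e * δ) ≡ e * e * (δ * δ)
  lemma₂ = solve-∀

-- The value e = 8 K² with K = 2^κ makes the error in `roth-count` 21 units against a main term of
-- 40.
precision : ℕ → ℕ
precision κ = 8 * (2 ^ κ * 2 ^ κ)

-- Chosen so that the loss (2 + λ′)² of `almost-periods` cancels and e² times the remaining squared
-- distance is at most 8 w n².
sample-size : ℕ → ℕ → ℕ
sample-size κ λ′ = (2 + λ′) ² * (32 * precision κ ²)

-- Each of the λ′ + 1 dyadic scales costs a factor 2 v^k with v = 4 · 2^κ, and two shifts must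
-- survive.
shift-count : ℕ → ℕ → ℕ
shift-count κ λ′ = (2 * (4 * 2 ^ κ) ^ sample-size κ λ′) ^ suc λ′ * 2

-- `Λ` counts three-term progressions with middle term 16 w + i and left term 15 w - v, whose
-- difference w + i + v is at least w and below 16 w. One difference therefore carries at least Λ /
-- 16 w of them, and n₀ ≥ a w / 2 b turns this into density 1 / (32 K³).
popular-difference : ∀ χ w a b κ n₀ Λ (I₀ : List ℕ) → (∀ x → χ x ≤ 1) → 0 < a → 0 < w → b ≤ 2 ^ κ * a → n₀ ≡ length I₀ →
  Unique I₀ → (∀ {i} → i ∈ I₀ → i < w × 0 < χ (16 * w + i)) → a * w ≤ 2 * (b * n₀) →
  Λ ≡ ∑[ v ∈ upTo (13 * w) ] (χ (15 * w ∸ v) * ∑[ i ∈ I₀ ] χ (v + 2 * (16 * w + i) ∸ 15 * w)) →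
  n₀ * w * (a * a) ≤ b * b * Λ →
  ∃ λ e → ∃ λ d → w ≤ d × w ≤ 32 * (2 ^ κ * 2 ^ κ * 2 ^ κ) * ∑ (upTo w) (centred χ w e d)
popular-difference χ w a b κ n₀ Λ I₀ χ≤1 a>0 w>0 b≤ n₀≡ uI I₀⊆ n₀≥ Λ≡ Λ≥ =
  let (d , _ , le) = averaging (upTo (16 * w)) (λ _ → Λ) (λ d → 16 * w * H d)
          (subst (0 <_) (sym (length-upTo (16 * w))) 16w>0) total≤
  in 16 * w ∸ d , d , far d (≤-trans Λ>0 le) , popular d (≤-trans le
      (*-monoʳ-≤ (16 * w) (≤-trans (*-monoˡ-≤ (C d) (𝟙≤1 (w ≤? d))) (≤-reflexive (+-identityʳ (C d))))))
  where
  open ≤-Reasoning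
  K = 2 ^ κ
  C H : ℕ → ℕ
  C d = ∑ (upTo w) (centred χ w (16 * w ∸ d) d)
  -- The factor 𝟙 forces the difference found by averaging to be at least w, because Λ > 0.
  H d = 𝟙 (w ≤? d) * C d
  16w>0 : 0 < 16 * w
  16w>0 = *-mono-< (z<s {15}) w>0
  term : ℕ → ℕ → ℕ
  term i d = 𝟙 (w ≤? d) * centred χ w (16 * w ∸ d) d i
  pointwise : ∀ i v → i < w → 0 < χ (16 * w + i) → v < 13 * w → χ (15 * w ∸ v) * χ (v + 2 * (16 * w + i) ∸ 15 * w) ≤
      term i (w + i + v)
  pointwise i v i< pos v< = begin
    χ (15 * w ∸ v) * χ (v + 2 * (16 * w + i) ∸ 15 * w) ≡⟨ cong₂ (λ p q → χ p * χ q) x≡ z≡ ⟩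
    χ (e + i) * χ (e + d + d + i) ≡⟨ cong (χ (e + i) *_) (sym (+-identityʳ _)) ⟩
    χ (e + i) * (1 * χ (e + d + d + i)) ≤⟨ *-monoʳ-≤ (χ (e + i))
        (*-monoˡ-≤ (χ (e + d + d + i)) (subst (λ y → 1 ≤ χ y) (sym y≡) pos)) ⟩
    χ (e + i) * (χ (e + d + i) * χ (e + d + d + i)) ≡⟨ sym (trans (+-identityʳ _) (+-identityʳ _)) ⟩
    1 * (1 * (χ (e + i) * (χ (e + d + i) * χ (e + d + d + i)))) ≡⟨ cong₂ _*_
        (sym (𝟙-yes (w ≤? d) (≤-trans (m≤m+n w i) (m≤m+n (w + i) v))))
        (cong (_* (χ (e + i) * (χ (e + d + i) * χ (e + d + d + i)))) (sym (𝟙-yes (i <? w) i<))) ⟩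
    term i d ∎
    where
    d = w + i + v
    e = 16 * w ∸ d
    d≤ : d ≤ 16 * w
    d≤ = ≤-trans (+-mono-≤ (+-monoʳ-≤ w (<⇒≤ i<)) (<⇒≤ v<)) (≤-trans (≤-reflexive (l w))
        (*-monoˡ-≤ w {15} {16} (n≤1+n 15)))
      where
      l : ∀ w → w + w + 13 * w ≡ 15 * w
      l = solve-∀
    e≡ : e + d ≡ 16 * w
    e≡ = m∸n+n≡m d≤
    v≤ : v ≤ 15 * w
    v≤ = ≤-trans (<⇒≤ v<) (*-monoˡ-≤ w {13} {15} (≤ᵇ⇒≤ 13 15 _))
    r : ℕ
    r = 15 * w ∸ v
    r≡ : r + v ≡ 15 * w
    r≡ = m∸n+n≡m v≤
    l₁ : ∀ e i w v → e + i + (w + v) ≡ e + (w + i + v)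
    l₁ = solve-∀
    l₂ : ∀ w → 16 * w ≡ 15 * w + w
    l₂ = solve-∀
    l₃ : ∀ r v w → r + v + w ≡ r + (w + v)
    l₃ = solve-∀
    x≡ : r ≡ e + i
    x≡ = +-cancelʳ-≡ (w + v) _ _ (sym (trans (l₁ e i w v) (trans e≡
        (trans (l₂ w) (trans (cong (_+ w) (sym r≡)) (l₃ r v w))))))
    y≡ : e + d + i ≡ 16 * w + i
    y≡ = cong (_+ i) e≡
    l₄ : ∀ v w i → v + 2 * (16 * w + i) ≡ 16 * w + (w + i + v) + i + 15 * w
    l₄ = solve-∀
    z≡ : v + 2 * (16 * w + i) ∸ 15 * w ≡ e + d + d + i
    z≡ = trans (cong (_∸ 15 * w) (l₄ v w i)) (trans (m+n∸n≡m _ (15 * w)) (cong (λ s → s + d + i) (sym e≡)))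
  inner : ∀ i → i < w → 0 < χ (16 * w + i) → ∑[ v ∈ upTo (13 * w) ]
      (χ (15 * w ∸ v) * χ (v + 2 * (16 * w + i) ∸ 15 * w)) ≤ ∑ (upTo (16 * w)) (term i)
  inner i i< pos = ≤-trans (∑-mono (upTo (13 * w)) λ v v∈ → pointwise i v i< pos (∈-upTo⁻ v∈))
    (∑-inj (λ v → w + i + v) (term i) (upTo⁺ (13 * w)) (λ _ _ → +-cancelˡ-≡ (w + i) _ _) λ v∈ → ∈-upTo⁺ (begin-strict
      w + i + _ <⟨ +-mono-≤-< (+-monoʳ-≤ w (<⇒≤ i<)) (∈-upTo⁻ v∈) ⟩
      w + w + 13 * w ≡⟨ l w ⟩
      15 * w ≤⟨ *-monoˡ-≤ w {15} {16} (n≤1+n 15) ⟩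
      16 * w ∎))
    where
    l : ∀ w → w + w + 13 * w ≡ 15 * w
    l = solve-∀
  total≤ : ∑[ _ ∈ upTo (16 * w) ] Λ ≤ ∑[ d ∈ upTo (16 * w) ] (16 * w * H d)
  total≤ = begin
    ∑[ _ ∈ upTo (16 * w) ] Λ ≡⟨ trans (∑-const (upTo (16 * w)) Λ) (cong (_* Λ) (length-upTo (16 * w))) ⟩
    16 * w * Λ ≡⟨ cong (16 * w *_) (trans Λ≡ (trans (∑-cong (upTo (13 * w)) λ v _ → sym (∑-*ˡ I₀ (χ (15 * w ∸ v)) _))
        (∑-swap (upTo (13 * w)) I₀ _))) ⟩
    16 * w * ∑[ i ∈ I₀ ] ∑[ v ∈ upTo (13 * w) ] (χ (15 * w ∸ v) * χ (v + 2 * (16 * w + i) ∸ 15 * w))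
      ≤⟨ *-monoʳ-≤ (16 * w) (∑-mono I₀ λ i i∈ → inner i (proj₁ (I₀⊆ i∈)) (proj₂ (I₀⊆ i∈))) ⟩
    16 * w * ∑[ i ∈ I₀ ] ∑ (upTo (16 * w)) (term i)
      ≤⟨ *-monoʳ-≤ (16 * w) (∑-⊆ (λ i → ∑ (upTo (16 * w)) (term i)) uI (λ i∈ → ∈-upTo⁺ (proj₁ (I₀⊆ i∈)))) ⟩
    16 * w * ∑[ i ∈ upTo w ] ∑ (upTo (16 * w)) (term i) ≡⟨ cong (16 * w *_)
        (trans (∑-swap (upTo w) (upTo (16 * w)) term) (∑-cong (upTo (16 * w)) λ d _ → ∑-*ˡ (upTo w) (𝟙 (w ≤? d)) _)) ⟩
    16 * w * ∑ (upTo (16 * w)) H ≡⟨ sym (∑-*ˡ (upTo (16 * w)) (16 * w) H) ⟩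
    ∑[ d ∈ upTo (16 * w) ] (16 * w * H d) ∎
  n₀>0 : 0 < n₀
  n₀>0 = >0-*ʳ b n₀ (>0-*ʳ 2 (b * n₀) (<-≤-trans (*-mono-< a>0 w>0) n₀≥))
  Λ>0 : 0 < Λ
  Λ>0 = >0-*ʳ (b * b) Λ (<-≤-trans (*-mono-< (*-mono-< n₀>0 w>0) (*-mono-< a>0 a>0)) Λ≥)
  far : ∀ d → 0 < 16 * w * H d → w ≤ d
  far d p = 𝟙>0 (w ≤? d) (>0-*ˡ (𝟙 (w ≤? d)) (C d) (>0-*ʳ (16 * w) (H d) p))
  popular : ∀ d → Λ ≤ 16 * w * C d → w ≤ 32 * (K * K * K) * C d
  popular d le = *-cancelˡ-≤ (w * (a * a * a)) {{>-nonZero (*-mono-< w>0 (*-mono-< (*-mono-< a>0 a>0) a>0))}} (begin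
    w * (a * a * a) * w ≡⟨ l₁ w a ⟩
    a * w * (w * (a * a)) ≤⟨ *-monoˡ-≤ (w * (a * a)) n₀≥ ⟩
    2 * (b * n₀) * (w * (a * a)) ≡⟨ l₂ b n₀ w a ⟩
    2 * b * (n₀ * w * (a * a)) ≤⟨ *-monoʳ-≤ (2 * b) (≤-trans Λ≥ (*-monoʳ-≤ (b * b) le)) ⟩
    2 * b * (b * b * (16 * w * C d)) ≡⟨ l₃ b w (C d) ⟩
    b * b * b * (32 * w * C d) ≤⟨ *-monoˡ-≤ (32 * w * C d) (*-mono-≤ (*-mono-≤ b≤ b≤) b≤) ⟩
    K * a * (K * a) * (K * a) * (32 * w * C d) ≡⟨ l₄ K a w (C d) ⟩
    w * (a * a * a) * (32 * (K * K * K) * C d) ∎)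
    where
    l₁ : ∀ w a → w * (a * a * a) * w ≡ a * w * (w * (a * a))
    l₁ = solve-∀
    l₂ : ∀ b n w a → 2 * (b * n) * (w * (a * a)) ≡ 2 * b * (n * w * (a * a))
    l₂ = solve-∀
    l₃ : ∀ b w c → 2 * b * (b * b * (16 * w * c)) ≡ b * b * b * (32 * w * c)
    l₃ = solve-∀
    l₄ : ∀ K a w c → K * a * (K * a) * (K * a) * (32 * w * c) ≡ w * (a * a * a) * (32 * (K * K * K) * c)
    l₄ = solve-∀

shift-count>0 : ∀ κ λ′ → 0 < shift-count κ λ′
shift-count>0 κ λ′ = *-mono-< (m^n>0 (2 * (4 * 2 ^ κ) ^ k) {{>-nonZero q>0}} (suc λ′)) (z<s {1})
  where
  k = sample-size κ λ′
  q>0 : 0 < 2 * (4 * 2 ^ κ) ^ k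
  q>0 = *-mono-< (z<s {1}) (m^n>0 (4 * 2 ^ κ) {{>-nonZero (*-mono-< (z<s {3}) (m^n>0 2 κ))}} k)

-- Replaces the shifted correlation F by the unshifted G: `deviation` costs n² at each of 13 w
-- points, and the L² bound adds 8 w n².
shifted-sum : ∀ e n w W (X F G : ℕ → ℕ) Λ → (∀ v → X v ≤ 1) → ∑[ v ∈ upTo W ] (X v * G v) ≡ Λ →
  e * e * ∑[ v ∈ upTo W ] dist² (F v) (G v) ≤ 8 * w * (n * n) → W ≡ 13 * w →
  2 * (e * n * ∑[ v ∈ upTo W ] (X v * F v)) ≤ 2 * (e * n * Λ) + 21 * w * (n * n)
shifted-sum e n w W X F G Λ X≤1 refl q≤ W≡ = begin
  2 * (e * n * ∑[ v ∈ upTo W ] (X v * F v)) ≡⟨ pull F ⟩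
  ∑[ v ∈ upTo W ] (X v * (2 * (e * n * F v))) ≤⟨ ∑-mono (upTo W) (λ v _ → *-monoʳ-≤ (X v) (deviation e n (F v) (G v))) ⟩
  ∑[ v ∈ upTo W ] (X v * (2 * (e * n * G v) + (e * e * dist² (F v) (G v) + n * n)))
    ≤⟨ ∑-mono (upTo W) (λ v _ → ≤-trans (≤-reflexive (*-distribˡ-+ (X v) _ _))
        (+-monoʳ-≤ (X v * (2 * (e * n * G v))) (≤-trans (*-monoˡ-≤ _ (X≤1 v)) (≤-reflexive (+-identityʳ _))))) ⟩
  ∑[ v ∈ upTo W ] (X v * (2 * (e * n * G v)) + (e * e * dist² (F v) (G v) + n * n))
    ≡⟨ trans (∑-+ (upTo W) _ _) (cong₂ _+_ (sym (pull G)) (trans (∑-+ (upTo W) _ _)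
        (cong₂ _+_ (∑-*ˡ (upTo W) (e * e) _) (trans (∑-const (upTo W) (n * n))
        (cong (_* (n * n)) (trans (length-upTo W) W≡)))))) ⟩
  2 * (e * n * Λ) + (e * e * ∑[ v ∈ upTo W ] dist² (F v) (G v) + 13 * w * (n * n)) ≤⟨ +-monoʳ-≤ (2 * (e * n * Λ))
      (+-monoˡ-≤ _ q≤) ⟩
  2 * (e * n * Λ) + (8 * w * (n * n) + 13 * w * (n * n)) ≡⟨ cong (_+_ (2 * (e * n * Λ))) (lemma w (n * n)) ⟩
  2 * (e * n * Λ) + 21 * w * (n * n) ∎
  where
  open ≤-Reasoning
  lemma : ∀ w m → 8 * w * m + 13 * w * m ≡ 21 * w * m
  lemma = solve-∀
  re : ∀ x e n f → x * (2 * (e * n * f)) ≡ 2 * (e * n) * (x * f)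
  re = solve-∀
  pull : ∀ (F : ℕ → ℕ) → 2 * (e * n * ∑[ v ∈ upTo W ] (X v * F v)) ≡ ∑[ v ∈ upTo W ] (X v * (2 * (e * n * F v)))
  pull F = sym (trans (∑-cong (upTo W) λ v _ → re (X v) e n (F v))
      (trans (∑-*ˡ (upTo W) (2 * (e * n)) _) (*-assoc 2 (e * n) _)))

-- After cancelling J² n the main term is 40 units of e n w a², and by b ≤ K a and e = 8 K² the
-- error is 21 of them. What remains is a lower bound for Λ.
roth-count : ∀ K a b J n w Λ TT → 0 < J → 0 < n → b ≤ K * a → 0 < K →
  10 * n * w * (a * J) ² ≤ 4 * (b * b * TT) →
  2 * (8 * (K * K) * n * TT) ≤ J * J * (2 * (8 * (K * K) * n * Λ) + 21 * w * (n * n)) →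
  n * w * (a * a) ≤ b * b * Λ
roth-count K a b J n w Λ TT J>0 n>0 b≤ K>0 lower upper =
  *-cancelˡ-≤ (16 * e) {{>-nonZero (*-mono-< (z<s {15}) (*-mono-< (z<s {7}) (*-mono-< K>0 K>0)))}}
    (+-cancelʳ-≤ (24 * (e * n * w * (a * a))) _ _ (begin
      16 * e * (n * w * (a * a)) + 24 * (e * n * w * (a * a)) ≡⟨ f₁ e n w a ⟩
      40 * (e * n * w * (a * a)) ≤⟨ main ⟩
      16 * (b * b * (e * Λ)) + 21 * (e * n * w * (a * a)) ≤⟨ +-mono-≤ (≤-reflexive (f₂ b e Λ))
          (*-monoˡ-≤ (e * n * w * (a * a)) (≤ᵇ⇒≤ 21 24 _)) ⟩
      16 * e * (b * b * Λ) + 24 * (e * n * w * (a * a)) ∎))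
  where
  open ≤-Reasoning
  e = 8 * (K * K)
  f₁ : ∀ e n w a → 16 * e * (n * w * (a * a)) + 24 * (e * n * w * (a * a)) ≡ 40 * (e * n * w * (a * a))
  f₁ = solve-∀
  f₂ : ∀ b e Λ → 16 * (b * b * (e * Λ)) ≡ 16 * e * (b * b * Λ)
  f₂ = solve-∀
  g₁ : ∀ J n e w a → J * J * n * (40 * (e * n * w * (a * a))) ≡ 4 * (e * n) * (10 * n * w * (a * J * (a * J)))
  g₁ = solve-∀
  g₂ : ∀ e n b T → 4 * (e * n) * (4 * (b * b * T)) ≡ 8 * (b * b) * (2 * (e * n * T))
  g₂ = solve-∀
  g₃ : ∀ b J e n w Λ → 8 * (b * b) * (J * J * (2 * (e * n * Λ) + 21 * w * (n * n))) ≡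
      J * J * n * (16 * (b * b * (e * Λ)) + 168 * (n * w) * (b * b))
  g₃ = solve-∀
  g₄ : ∀ J n K a w b Λ → J * J * n * (16 * (b * b * (8 * (K * K) * Λ)) + 168 * (n * w) * (K * a * (K * a))) ≡
      J * J * n * (16 * (b * b * (8 * (K * K) * Λ)) + 21 * (8 * (K * K) * n * w * (a * a)))
  g₄ = solve-∀
  main : 40 * (e * n * w * (a * a)) ≤ 16 * (b * b * (e * Λ)) + 21 * (e * n * w * (a * a))
  main = *-cancelˡ-≤ (J * J * n) {{>-nonZero (*-mono-< (*-mono-< J>0 J>0) n>0)}} (begin
    J * J * n * (40 * (e * n * w * (a * a))) ≡⟨ g₁ J n e w a ⟩
    4 * (e * n) * (10 * n * w * (a * J) ²) ≤⟨ *-monoʳ-≤ (4 * (e * n)) lower ⟩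
    4 * (e * n) * (4 * (b * b * TT)) ≡⟨ g₂ e n b TT ⟩
    8 * (b * b) * (2 * (e * n * TT)) ≤⟨ *-monoʳ-≤ (8 * (b * b)) upper ⟩
    8 * (b * b) * (J * J * (2 * (e * n * Λ) + 21 * w * (n * n))) ≡⟨ g₃ b J e n w Λ ⟩
    J * J * n * (16 * (b * b * (e * Λ)) + 168 * (n * w) * (b * b)) ≤⟨ *-monoʳ-≤ (J * J * n)
        (+-monoʳ-≤ (16 * (b * b * (e * Λ))) (*-monoʳ-≤ (168 * (n * w)) (*-mono-≤ b≤ b≤))) ⟩
    J * J * n * (16 * (b * b * (e * Λ)) + 168 * (n * w) * (K * a * (K * a))) ≡⟨ g₄ J n K a w b Λ ⟩
    J * J * n * (16 * (b * b * (e * Λ)) + 21 * (e * n * w * (a * a))) ∎)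

roth-core : ∀ χ κ λ′ M a b w N′ e k → w ≡ M * 2 ^ λ′ → e ≡ 8 * (2 ^ κ * 2 ^ κ) → k ≡ (2 + λ′) ² * (32 * (e * e)) →
  N′ ≡ (2 * (4 * 2 ^ κ) ^ k) ^ suc λ′ * 2 → 0 < N′ → (∀ x → χ x ≤ 1) → 0 < a → b ≤ 2 ^ κ * a →
  a * (32 * w) ≤ b * ∑ (upTo (32 * w)) χ →
  (∀ {p D} → p < 32 * w → 0 < D → D < 32 * w → 64 * (b * progression χ D (2 ^ λ′) p) ≤ 65 * (a * 2 ^ λ′)) →
  128 * (2 ^ κ * (2 ^ λ′ * N′)) ≤ w →
  ∃ λ e → ∃ λ d → w ≤ d × w ≤ 32 * (2 ^ κ * 2 ^ κ * 2 ^ κ) * ∑ (upTo w) (centred χ w e d)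
roth-core χ κ λ′ M a b w N′ e k w≡ e≡ k≡ N≡ N>0 χ≤1 a>0 b≤ dense noinc size =
  let (t′ , D , D>0 , _ , t∈ , near) = periods in finish t′ D D>0 t∈ near
  where
  open ≤-Reasoning
  K = 2 ^ κ
  J = 2 ^ λ′
  K>0 : 0 < K
  K>0 = m^n>0 2 κ
  J>0 : 0 < J
  J>0 = m^n>0 2 λ′
  JN≤ : 128 * (J * N′) ≤ w
  JN≤ = ≤-trans (*-monoʳ-≤ 128 (≤-trans (≤-reflexive (sym (*-identityˡ _))) (*-monoˡ-≤ (J * N′) K>0))) size
  JN≤w : J * N′ ≤ w
  JN≤w = ≤-trans (m≤n*m (J * N′) 128) JN≤
  w>0 : 0 < w
  w>0 = <-≤-trans (*-mono-< J>0 N>0) JN≤w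
  1<32w : 1 < 32 * w
  1<32w = *-mono-≤ {2} {32} (≤ᵇ⇒≤ 2 32 _) w>0
  I? : Decidable (λ i → 0 < χ (16 * w + i))
  I? i = 0 <? χ (16 * w + i)
  I₀ Y T : List ℕ
  I₀ = filter I? (upTo w)
  point : ℕ → ℕ
  point i = 2 * (16 * w + i)
  Y = map point I₀
  -- Even shifts keep `Y` inside the doubled integers, so the dilated sumsets have at most w + J N′
  -- ≤ 2 w ≤ 4 K n elements.
  T = map (2 *_) (upTo N′)
  n = length Y
  n≡ : n ≡ length I₀
  n≡ = length-map point I₀
  I₀⊆ : ∀ {i} → i ∈ I₀ → i < w × 0 < χ (16 * w + i)
  I₀⊆ i∈ = let (p , q) = ∈-filter⁻ I? {xs = upTo w} i∈ in ∈-upTo⁻ p , q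
  uI : Unique I₀
  uI = Uniqueₚ.filter⁺ I? (upTo⁺ w)
  point-inj : ∀ {i j} → point i ≡ point j → i ≡ j
  point-inj eq = +-cancelˡ-≡ (16 * w) _ _ (*-cancelˡ-≡ _ _ 2 eq)
  n≥ : a * w ≤ 2 * (b * n)
  n≥ = *-cancelˡ-≤ 32 (begin
    32 * (a * w) ≤⟨ *-monoˡ-≤ (a * w) (n≤1+n 32) ⟩
    33 * (a * w) ≤⟨ subst (λ w → a * (32 * w) ≤ b * ∑ (upTo (32 * w)) χ →
        (∀ {p} → p < 32 * w → 64 * (b * progression χ 1 J p) ≤ 65 * (a * J)) → 33 * (a * w) ≤ 64 *
        (b * ∑[ i ∈ upTo w ] χ (16 * w + i))) (sym w≡) (λ dn ni → middle-dense χ a b M J ni J>0 dn) dense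
        (λ p< → noinc p< z<s 1<32w) ⟩
    64 * (b * ∑[ i ∈ upTo w ] χ (16 * w + i)) ≤⟨ *-monoʳ-≤ 64
        (*-monoʳ-≤ b (≤-trans (∑-mono (upTo w) λ i _ → ≤𝟙 (16 * w + i))
        (≤-reflexive (sym (trans n≡ (length-filter I? (upTo w))))))) ⟩
    64 * (b * n) ≡⟨ *-assoc 32 2 (b * n) ⟩
    32 * (2 * (b * n)) ∎)
    where
    ≤𝟙 : ∀ x → χ x ≤ 𝟙 (0 <? χ x)
    ≤𝟙 x with 0 <? χ x
    ... | yes _ = χ≤1 x
    ... | no ¬p = ≮⇒≥ ¬p
  n>0 : 0 < n
  n>0 = >0-*ʳ b n (>0-*ʳ 2 (b * n) (<-≤-trans (*-mono-< a>0 w>0) n≥))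
  w≤ : w ≤ 2 * K * n
  w≤ = *-cancelˡ-≤ a {{>-nonZero a>0}} (≤-trans n≥ (≤-trans (*-monoʳ-≤ 2 (*-monoˡ-≤ n b≤)) (≤-reflexive (l K a n))))
    where
    l : ∀ K a n → 2 * (K * a * n) ≡ a * (2 * K * n)
    l = solve-∀
  Q = J * (2 * N′)
  Q≡ : Q ≡ 2 * (J * N′)
  Q≡ = l J N′
    where
    l : ∀ J N → J * (2 * N) ≡ 2 * (J * N)
    l = solve-∀
  -- Moved by Q + 15 w so that the correlation at Q + v sums χ (v + y - 15 w).
  α : ℕ → ℕ
  α u = χ (u ∸ (Q + 15 * w))
  V : ℕ → List ℕ
  V _ = map point (upTo (w + J * N′))
  H≤ : 13 * w + 4 * Q ≤ 32 * w
  H≤ = begin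
    13 * w + 4 * Q ≡⟨ cong (λ q → 13 * w + 4 * q) Q≡ ⟩
    13 * w + 4 * (2 * (J * N′)) ≤⟨ +-monoʳ-≤ (13 * w) (*-monoʳ-≤ 4 (*-monoʳ-≤ 2 JN≤w)) ⟩
    13 * w + 4 * (2 * w) ≡⟨ l w ⟩
    21 * w ≤⟨ *-monoˡ-≤ w {21} {32} (≤ᵇ⇒≤ 21 32 _) ⟩
    32 * w ∎
    where
    l : ∀ w → 13 * w + 4 * (2 * w) ≡ 21 * w
    l = solve-∀
  Near : ℕ → Set
  Near D = ∀ j → j < 2 ^ suc λ′ → k * ∑[ x ∈ upTo (13 * w) ] dist² (convolve Y α (Q + x + j * D)) (convolve Y α (Q + x))
             ≤ (2 + λ′) ² * (8 * (n ² * (32 * w)))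
  periods : ∃ λ t′ → ∃ λ D → 0 < D × t′ ∈ T × t′ + D ∈ T × Near D
  periods = almost-periods Y α (13 * w) (32 * w) k (4 * K) V λ′ T (2 * N′)
    (Unique-map point (λ _ _ → point-inj) uI) (λ x → χ≤1 (x ∸ (Q + 15 * w)))
    (λ {y} _ → ≤-trans (∑-≤ (upTo (13 * w + 4 * Q)) (λ x _ → χ≤1 (x + y ∸ (Q + 15 * w))))
        (≤-trans (≤-reflexive (trans (*-identityʳ _) (length-upTo (13 * w + 4 * Q)))) H≤))
    n>0 (<-trans z<s 1<32w)
    (subst (0 <_) (sym k≡) (*-mono-< (*-mono-< (z<s {1 + λ′}) (z<s {1 + λ′})) (*-mono-< (z<s {31}) (*-mono-< e>0 e>0))))
    (*-mono-< (z<s {3}) K>0)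
    (Unique-map (2 *_) (λ {x} {y} _ _ eq → *-cancelˡ-≡ x y 2 eq) (upTo⁺ N′))
    (λ t∈ → let (u , u∈ , t≡) = ∈-map⁻ (2 *_) t∈ in ≤-trans (≤-reflexive t≡) (*-monoʳ-≤ 2 (<⇒≤ (∈-upTo⁻ u∈))))
    (λ {l} l≤ y∈ t∈ →
      let (i , i∈ , y≡) = ∈-map⁻ point y∈
          (u , u∈ , t≡) = ∈-map⁻ (2 *_) t∈
      in subst (_∈ V 0) (sym (trans (cong₂ (λ y t → y + 2 ^ l * t) y≡ t≡) (re w i (2 ^ l) u)))
           (∈-map⁺ point (∈-upTo⁺ (+-mono-<-≤ (proj₁ (I₀⊆ i∈)) (*-mono-≤ (^-monoʳ-≤ 2 l≤) (<⇒≤ (∈-upTo⁻ u∈)))))))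
    (λ _ → ≤-trans (≤-reflexive (trans (length-map point (upTo (w + J * N′))) (length-upTo (w + J * N′))))
        (≤-trans (+-mono-≤ w≤ (≤-trans JN≤w w≤)) (≤-reflexive (re₂ K n))))
    (≤-reflexive (trans (sym N≡) (sym (trans (length-map (2 *_) (upTo N′)) (length-upTo N′)))))
    where
    e>0 : 0 < e
    e>0 = subst (0 <_) (sym e≡) (*-mono-< (z<s {7}) (*-mono-< K>0 K>0))
    re : ∀ w i q u → 2 * (16 * w + i) + q * (2 * u) ≡ 2 * (16 * w + (i + q * u))
    re = solve-∀
    re₂ : ∀ K n → 2 * K * n + 2 * K * n ≡ 4 * K * n
    re₂ = solve-∀
  finish : ∀ t′ D → 0 < D → t′ + D ∈ T → Near D →
    ∃ λ e → ∃ λ d → w ≤ d × w ≤ 32 * (K * K * K) * ∑ (upTo w) (centred χ w e d)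
  finish t′ D D>0 t∈ near = popular-difference χ w a b κ n Λ I₀ χ≤1 a>0 w>0 b≤ n≡ uI I₀⊆ n≥ refl
    (roth-count K a b J n w Λ TT J>0 n>0 b≤ K>0 lower (subst (λ e → 2 * (e * n * TT) ≤
        J * J * (2 * (e * n * Λ) + 21 * w * (n * n))) e≡ upper))
    where
    D≤ : D ≤ 2 * N′
    D≤ = let (u , u∈ , t≡) = ∈-map⁻ (2 *_) t∈ in ≤-trans (m≤n+m D t′)
        (≤-trans (≤-reflexive t≡) (*-monoʳ-≤ 2 (<⇒≤ (∈-upTo⁻ u∈))))
    JD≤ : J * D ≤ 2 * (J * N′)
    JD≤ = ≤-trans (*-monoʳ-≤ J D≤) (≤-reflexive Q≡)
    JD≤w : J * D ≤ w
    JD≤w = ≤-trans JD≤ (≤-trans (*-monoˡ-≤ (J * N′) {2} {128} (≤ᵇ⇒≤ 2 128 _)) JN≤)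
    D<32w : D < 32 * w
    D<32w = ≤-<-trans (≤-trans (≤-reflexive (sym (*-identityˡ D))) (≤-trans (*-monoˡ-≤ D J>0) JD≤w))
        (≤-<-trans (≤-reflexive (sym (*-identityˡ w))) (*-monoˡ-< w {{>-nonZero w>0}} {1} {32} (≤ᵇ⇒≤ 2 32 _)))
    X : ℕ → ℕ
    X v = χ (15 * w ∸ v)
    F : ℕ → ℕ → ℕ
    F s v = ∑[ y ∈ Y ] χ (v + s * D + y ∸ 15 * w)
    Λ = ∑[ v ∈ upTo (13 * w) ] (X v * ∑[ i ∈ I₀ ] χ (v + 2 * (16 * w + i) ∸ 15 * w))
    TT = ∑[ i ∈ upTo J ] ∑[ j ∈ upTo J ] ∑[ v ∈ upTo (13 * w) ] (X v * F (i + j) v)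
    Y≥ : ∀ {y} → y ∈ Y → 32 * w ≤ y
    Y≥ y∈ = let (i , i∈ , y≡) = ∈-map⁻ point y∈ in ≤-trans (≤-trans (≤-reflexive (*-assoc 2 16 w))
        (*-monoʳ-≤ 2 (m≤m+n (16 * w) i))) (≤-reflexive (sym y≡))
    Y< : ∀ {y} → y ∈ Y → y < 34 * w
    Y< y∈ = let (i , i∈ , y≡) = ∈-map⁻ point y∈ in ≤-<-trans (≤-reflexive y≡)
        (<-≤-trans (*-monoʳ-< 2 (+-monoʳ-< (16 * w) (proj₁ (I₀⊆ i∈)))) (≤-reflexive (l w)))
      where
      l : ∀ w → 2 * (16 * w + w) ≡ 34 * w
      l = solve-∀
    bad≤ : ∑[ z ∈ upTo (32 * w) ] bad χ a b D J z ≤ w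
    bad≤ = bad-count χ a b w D J χ≤1 a>0 J>0 dense (λ p< → noinc p< D>0 D<32w) (begin
      64 * (b * (J * D)) ≤⟨ *-monoʳ-≤ 64 (*-mono-≤ b≤ JD≤) ⟩
      64 * (K * a * (2 * (J * N′))) ≡⟨ l K a (J * N′) ⟩
      a * (128 * (K * (J * N′))) ≤⟨ *-monoʳ-≤ a size ⟩
      a * w ∎)
      where
      l : ∀ K a m → 64 * (K * a * (2 * m)) ≡ a * (128 * (K * m))
      l = solve-∀
    lower : 10 * n * w * (a * J) ² ≤ 4 * (b * b * TT)
    lower = begin
      10 * n * w * (a * J) ² ≡⟨ l n w ((a * J) ²) ⟩
      n * (10 * w * (a * J) ²) ≤⟨ ∑-≥ Y (λ y y∈ → reflected-product χ a b w D J y bad≤ (Y≥ y∈) (Y< y∈)) ⟩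
      ∑[ y ∈ Y ] (4 * (b * b * P y)) ≡⟨ trans (∑-*ˡ Y 4 _) (cong (4 *_) (∑-*ˡ Y (b * b) P)) ⟩
      4 * (b * b * ∑ Y P) ≤⟨ *-monoʳ-≤ 4 (*-monoʳ-≤ (b * b) (smoothed-count χ w D J Y Y≥ JD≤w)) ⟩
      4 * (b * b * TT) ∎
      where
      P : ℕ → ℕ
      P y = ∑[ q ∈ upTo (12 * w) ] (progression χ D J (2 * w + suc q) * progression χ D J (y ∸ (2 * w + suc q)))
      l : ∀ n w s → 10 * n * w * s ≡ n * (10 * w * s)
      l = solve-∀
    convolve≡ : ∀ s v → convolve Y α (Q + v + s * D) ≡ F s v
    convolve≡ s v = ∑-cong Y λ y _ → cong χ (trans (cong (_∸ (Q + 15 * w)) (l Q v (s * D) y))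
        ([m+n]∸[m+o]≡n∸o Q _ (15 * w)))
      where
      l : ∀ Q v d y → Q + v + d + y ≡ Q + (v + d + y)
      l = solve-∀
    convolve≡₀ : ∀ v → convolve Y α (Q + v) ≡ F 0 v
    convolve≡₀ v = trans (cong (convolve Y α) (sym (+-identityʳ (Q + v)))) (convolve≡ 0 v)
    Λ≡ : ∑[ v ∈ upTo (13 * w) ] (X v * F 0 v) ≡ Λ
    Λ≡ = ∑-cong (upTo (13 * w)) λ v _ → cong (X v *_) (trans (∑-map point I₀ _)
        (∑-cong I₀ λ i _ → cong (λ u → χ (u + 2 * (16 * w + i) ∸ 15 * w)) (+-identityʳ v)))
    close : ∀ s → s < 2 ^ suc λ′ → e * e * ∑[ v ∈ upTo (13 * w) ] dist² (F s v) (F 0 v) ≤ 8 * w * (n * n)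
    close s s< = *-cancelˡ-≤ (32 * (2 + λ′) ²) (begin
      32 * (2 + λ′) ² * (e * e * ∑[ v ∈ upTo (13 * w) ] dist² (F s v) (F 0 v)) ≡⟨ trans
          (l₁ ((2 + λ′) ²) (e * e) (∑[ v ∈ upTo (13 * w) ] dist² (F s v) (F 0 v)))
          (cong (_* ∑[ v ∈ upTo (13 * w) ] dist² (F s v) (F 0 v)) (sym k≡)) ⟩
      k * ∑[ v ∈ upTo (13 * w) ] dist² (F s v) (F 0 v) ≡⟨ cong (k *_)
          (∑-cong (upTo (13 * w)) λ v _ → sym (cong₂ dist² (convolve≡ s v) (convolve≡₀ v))) ⟩
      k * ∑[ v ∈ upTo (13 * w) ] dist² (convolve Y α (Q + v + s * D)) (convolve Y α (Q + v)) ≤⟨ near s s< ⟩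
      (2 + λ′) ² * (8 * (n ² * (32 * w))) ≡⟨ l₂ ((2 + λ′) ²) n w ⟩
      32 * (2 + λ′) ² * (8 * w * (n * n)) ∎)
      where
      l₁ : ∀ c e s → 32 * c * (e * s) ≡ c * (32 * e) * s
      l₁ = solve-∀
      l₂ : ∀ c n w → c * (8 * (n * n * (32 * w))) ≡ 32 * c * (8 * w * (n * n))
      l₂ = solve-∀
    upper : 2 * (e * n * TT) ≤ J * J * (2 * (e * n * Λ) + 21 * w * (n * n))
    upper = begin
      2 * (e * n * TT) ≡⟨ sym (trans (∑-cong (upTo J) λ i _ →
          trans (∑-*ˡ (upTo J) (2 * (e * n)) (λ j → S (i + j))) refl)
          (trans (∑-*ˡ (upTo J) (2 * (e * n)) _) (*-assoc 2 (e * n) TT))) ⟩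
      ∑[ i ∈ upTo J ] ∑[ j ∈ upTo J ] (2 * (e * n) * S (i + j)) ≤⟨ ∑-≤ (upTo J)
          (λ i i∈ → ∑-≤ (upTo J) λ j j∈ → ≤-trans (≤-reflexive (*-assoc 2 (e * n) _))
             (shifted-sum e n w (13 * w) X (F (i + j)) (F 0) Λ (λ v → χ≤1 (15 * w ∸ v)) Λ≡
                 (close (i + j) (+-mono-<-≤ (∈-upTo⁻ i∈) (≤-trans (<⇒≤ (∈-upTo⁻ j∈)) (m≤m+n J 0)))) refl)) ⟩
      length (upTo J) * (length (upTo J) * B) ≡⟨ trans (cong₂ (λ x y → x * (y * B)) (length-upTo J) (length-upTo J))
          (sym (*-assoc J J B)) ⟩
      J * J * B ∎
      where
      S : ℕ → ℕ
      S s = ∑[ v ∈ upTo (13 * w) ] (X v * F s v)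
      B = 2 * (e * n * Λ) + 21 * w * (n * n)

roth-step : ∀ χ κ λ′ M a b w → w ≡ M * 2 ^ λ′ → (∀ x → χ x ≤ 1) → 0 < a → b ≤ 2 ^ κ * a →
  a * (32 * w) ≤ b * ∑ (upTo (32 * w)) χ →
  (∀ {p D} → p < 32 * w → 0 < D → D < 32 * w → 64 * (b * progression χ D (2 ^ λ′) p) ≤ 65 * (a * 2 ^ λ′)) →
  128 * (2 ^ κ * (2 ^ λ′ * shift-count κ λ′)) ≤ w →
  ∃ λ e → ∃ λ d → w ≤ d × w ≤ 32 * (2 ^ κ * 2 ^ κ * 2 ^ κ) * ∑ (upTo w) (centred χ w e d)
roth-step χ κ λ′ M a b w w≡ = roth-core χ κ λ′ M a b w (shift-count κ λ′) (precision κ)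
    (sample-size κ λ′) w≡ refl refl refl (shift-count>0 κ λ′)

-- Iteration: density increments within a round, and rounds

-- Base-2 logarithm of the window bound in `roth-step` for progressions of length 2^λ′.
window-exponent : ℕ → ℕ → ℕ
window-exponent κ λ′ = 8 + κ + λ′ + (1 + (2 + κ) * sample-size κ λ′) * suc λ′

2^window-exponent : ∀ κ λ′ → 128 * (2 ^ κ * (2 ^ λ′ * shift-count κ λ′)) ≡ 2 ^ window-exponent κ λ′
2^window-exponent κ λ′ = begin-equality
  128 * (K * (J * ((2 * (4 * K) ^ k) ^ suc λ′ * 2))) ≡⟨ cong (λ x → 128 * (K * (J * ((2 * x) ^ suc λ′ * 2)))) base ⟩
  128 * (K * (J * ((2 ^ (1 + (2 + κ) * k)) ^ suc λ′ * 2))) ≡⟨ cong (λ x → 128 * (K * (J * (x * 2))))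
      (^-*-assoc 2 (1 + (2 + κ) * k) (suc λ′)) ⟩
  128 * (K * (J * (2 ^ ((1 + (2 + κ) * k) * suc λ′) * 2))) ≡⟨ lemma K J (2 ^ ((1 + (2 + κ) * k) * suc λ′)) ⟩
  256 * K * J * 2 ^ ((1 + (2 + κ) * k) * suc λ′) ≡⟨ cong (_* 2 ^ ((1 + (2 + κ) * k) * suc λ′))
      (sym (trans (^-distribˡ-+-* 2 (8 + κ) λ′) (cong (_* J) (^-distribˡ-+-* 2 8 κ)))) ⟩
  2 ^ (8 + κ + λ′) * 2 ^ ((1 + (2 + κ) * k) * suc λ′) ≡⟨ sym (^-distribˡ-+-* 2 (8 + κ + λ′) _) ⟩
  2 ^ window-exponent κ λ′ ∎
  where
  open ≤-Reasoning
  K = 2 ^ κ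
  J = 2 ^ λ′
  k = sample-size κ λ′
  base : (4 * K) ^ k ≡ 2 ^ ((2 + κ) * k)
  base = trans (cong (_^ k) (sym (^-distribˡ-+-* 2 2 κ))) (^-*-assoc 2 (2 + κ) k)
  lemma : ∀ K J x → 128 * (K * (J * (x * 2))) ≡ 256 * K * J * x
  lemma = solve-∀

-- Logarithm of the length needed while f increments remain. It runs backwards: the progressions on
-- which an increment may occur must be long enough for all later ones. The 5 is log₂ 32.
increment-length : ℕ → ℕ → ℕ → ℕ
increment-length κ ℓ₀ zero    = ℓ₀
increment-length κ ℓ₀ (suc f) = 5 + window-exponent κ (increment-length κ ℓ₀ f)

-- A round leaves density 1 / (32 K³), whence 5 + 3κ; more than 64 (κ + 1) increments by 65/64 are
-- impossible, as the density would exceed 1.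
interval-exponent : ℕ → ℕ → ℕ
interval-exponent zero    κ = 0
interval-exponent (suc r) κ = increment-length κ (interval-exponent r (5 + 3 * κ)) (64 * suc κ)

λ≤window-exponent : ∀ κ λ′ → λ′ ≤ window-exponent κ λ′
λ≤window-exponent κ λ′ = ≤-trans (m≤n+m λ′ (8 + κ)) (m≤m+n (8 + κ + λ′) _)

increment-length-≥ : ∀ κ ℓ₀ f → ℓ₀ ≤ increment-length κ ℓ₀ f
increment-length-≥ κ ℓ₀ zero    = ≤-refl
increment-length-≥ κ ℓ₀ (suc f) = ≤-trans (increment-length-≥ κ ℓ₀ f)
  (≤-trans (λ≤window-exponent κ (increment-length κ ℓ₀ f)) (m≤n+m _ 5))

centred≤1 : ∀ χ w e d → (∀ x → χ x ≤ 1) → ∀ i → centred χ w e d i ≤ 1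
centred≤1 χ w e d χ≤1 i = *-mono-≤ (𝟙≤1 (i <? w)) (*-mono-≤ (χ≤1 (e + i))
    (*-mono-≤ (χ≤1 (e + d + i)) (χ≤1 (e + d + d + i))))

midpointed-1 : ∀ n χ → 0 < n → 0 < ∑ (upTo n) χ → Midpointed 1 χ
midpointed-1 n χ n>0 pos with averaging (upTo n) (λ _ → ∑ (upTo n) χ) (λ x → n * χ x)
    (subst (0 <_) (sym (length-upTo n)) n>0)
  (≤-reflexive (trans (∑-const (upTo n) (∑ (upTo n) χ)) (trans (cong (_* ∑ (upTo n) χ) (length-upTo n))
      (sym (∑-*ˡ (upTo n) n χ)))))
... | x , _ , le = x ∷ [] , refl , [] ∷ [] , (λ { (here refl) → x∈ }) , λ { (here refl) (here refl) → x , refl , x∈ }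
  where
  x∈ : 0 < χ x
  x∈ = >0-*ʳ n (χ x) (<-≤-trans pos le)

Dense⇒Midpointed : ℕ → ℕ → ℕ → Set
Dense⇒Midpointed r κ ℓ = ∀ χ → (∀ x → χ x ≤ 1) → 2 ^ ℓ ≤ 2 ^ κ * ∑ (upTo (2 ^ ℓ)) χ → Midpointed (2 ^ r) χ

-- Either the density grows by the factor 65/64 on a progression, or Roth's count finds a popular difference;
-- the fuel f bounds how often the former can happen.
density-increment : ∀ r κ ℓ₀ → (∀ ℓ → ℓ₀ ≤ ℓ → Dense⇒Midpointed r (5 + 3 * κ) ℓ) → ∀ f χ a b → (∀ x → χ x ≤ 1) →
  0 < a → b ≤ 2 ^ κ * a → b * 64 ^ f < a * 65 ^ f →
  a * 2 ^ increment-length κ ℓ₀ f ≤ b * ∑ (upTo (2 ^ increment-length κ ℓ₀ f)) χ → Midpointed (2 ^ suc r) χ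
density-increment r κ ℓ₀ IH zero χ a b χ≤1 a>0 b≤ b<a dense =
  -- No increments are left: b < a, so the asserted density a / b exceeds 1.
  ⊥-elim (<⇒≱ (subst₂ _<_ (*-identityʳ b) (*-identityʳ a) b<a)
      (*-cancelʳ-≤ a b (2 ^ ℓ₀) {{>-nonZero (m^n>0 2 ℓ₀)}} (≤-trans dense
    (*-monoʳ-≤ b (≤-trans (∑-≤ (upTo (2 ^ ℓ₀)) λ x _ → χ≤1 x)
        (≤-reflexive (trans (*-identityʳ _) (length-upTo (2 ^ ℓ₀)))))))))
density-increment r κ ℓ₀ IH (suc f) χ a b χ≤1 a>0 b≤ b<a dense = go
    (any? (λ p → any? (increasing? p) (upTo N)) (upTo N))
  where
  open ≤-Reasoning
  λ′ = increment-length κ ℓ₀ f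
  J = 2 ^ λ′
  ω = window-exponent κ λ′
  w = 2 ^ ω
  N = 32 * w
  M = 2 ^ (ω ∸ λ′)
  w≡ : M * J ≡ w
  w≡ = trans (sym (^-distribˡ-+-* 2 (ω ∸ λ′) λ′)) (cong (2 ^_) (m∸n+n≡m (λ≤window-exponent κ λ′)))
  N≡ : 2 ^ increment-length κ ℓ₀ (suc f) ≡ N
  N≡ = ^-distribˡ-+-* 2 5 ω
  Increasing : ℕ → ℕ → Set
  Increasing p D = 0 < D × 65 * (a * J) < 64 * (b * progression χ D J p)
  increasing? : ∀ p D → Dec (Increasing p D)
  increasing? p D = (0 <? D) ×-dec (65 * (a * J) <? 64 * (b * progression χ D J p))
  dense′ : a * N ≤ b * ∑ (upTo N) χ
  dense′ = subst (λ N → a * N ≤ b * ∑ (upTo N) χ) N≡ dense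
  go : Dec (Any (λ p → Any (Increasing p) (upTo N)) (upTo N)) → Midpointed (2 ^ suc r) χ
  go (yes inc) =
    let (p , _ , inc′) = find inc
        (D , _ , D>0 , gain) = find inc′
    in midpointed-affine χ p D D>0 (density-increment r κ ℓ₀ IH f (λ j → χ (p + j * D)) (65 * a) (64 * b)
        (λ j → χ≤1 (p + j * D))
         (*-mono-< (z<s {64}) a>0)
         (begin
            64 * b ≤⟨ *-mono-≤ (n≤1+n 64) b≤ ⟩
            65 * (2 ^ κ * a) ≡⟨ l₁ (2 ^ κ) a ⟩
            2 ^ κ * (65 * a) ∎)
         (subst₂ _<_ (l₂ b (64 ^ f)) (l₃ a (65 ^ f)) b<a)
         (begin
            65 * a * J ≡⟨ *-assoc 65 a J ⟩
            65 * (a * J) ≤⟨ <⇒≤ gain ⟩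
            64 * (b * progression χ D J p) ≡⟨ sym (*-assoc 64 b _) ⟩
            64 * b * progression χ D J p ∎))
    where
    l₁ : ∀ K a → 65 * (K * a) ≡ K * (65 * a)
    l₁ = solve-∀
    l₂ : ∀ b x → b * (64 * x) ≡ 64 * b * x
    l₂ = solve-∀
    l₃ : ∀ b x → b * (65 * x) ≡ 65 * b * x
    l₃ = solve-∀
  go (no ¬inc) =
    let (e , d , w≤d , popular) = step
    in midpointed-double χ w e d w≤d (IH ω (≤-trans (increment-length-≥ κ ℓ₀ f) (λ≤window-exponent κ λ′))
        (centred χ w e d) (centred≤1 χ w e d χ≤1)
         (≤-trans popular (≤-reflexive (cong (_* ∑ (upTo w) (centred χ w e d)) (sym K³)))))
    where
    K³ : 2 ^ (5 + 3 * κ) ≡ 32 * (2 ^ κ * 2 ^ κ * 2 ^ κ)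
    K³ = trans (^-distribˡ-+-* 2 5 (3 * κ)) (cong (32 *_) (trans (cong (2 ^_) (l κ))
        (trans (^-distribˡ-+-* 2 (κ + κ) κ) (cong (_* 2 ^ κ) (^-distribˡ-+-* 2 κ κ)))))
      where
      l : ∀ κ → 3 * κ ≡ κ + κ + κ
      l = solve-∀
    step : ∃ λ e → ∃ λ d → w ≤ d × w ≤ 32 * (2 ^ κ * 2 ^ κ * 2 ^ κ) * ∑ (upTo w) (centred χ w e d)
    step = roth-step χ κ λ′ M a b w (sym w≡) χ≤1 a>0 b≤ dense′
      (λ p< D>0 D< → ≮⇒≥ λ gain → ¬inc (lose (∈-upTo⁺ p<) (lose (∈-upTo⁺ D<) (D>0 , gain))))
      (≤-reflexive (2^window-exponent κ λ′))

-- Evaluation shows (65/64)^64 ≥ 2, so 64 increments at least double the density.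
doubling-exponent : ∀ κ → 2 ^ κ * 64 ^ (64 * suc κ) < 1 * 65 ^ (64 * suc κ)
doubling-exponent κ = begin-strict
  2 ^ κ * 64 ^ (64 * suc κ) <⟨ *-monoˡ-< (64 ^ (64 * suc κ)) {{m^n≢0 64 (64 * suc κ)}}
      (^-monoʳ-< 2 (s≤s z<s) (n<1+n κ)) ⟩
  2 ^ suc κ * 64 ^ (64 * suc κ) ≡⟨ cong (2 ^ suc κ *_) (sym (^-*-assoc 64 64 (suc κ))) ⟩
  2 ^ suc κ * (64 ^ 64) ^ suc κ ≡⟨ sym (^-distribʳ-* (suc κ) 2 (64 ^ 64)) ⟩
  (2 * 64 ^ 64) ^ suc κ ≤⟨ ^-monoˡ-≤ (suc κ) (≤ᵇ⇒≤ (2 * 64 ^ 64) (65 ^ 64) _) ⟩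
  (65 ^ 64) ^ suc κ ≡⟨ trans (^-*-assoc 65 64 (suc κ)) (sym (*-identityˡ _)) ⟩
  1 * 65 ^ (64 * suc κ) ∎
  where open ≤-Reasoning

dense⇒midpointed : ∀ r κ ℓ → interval-exponent r κ ≤ ℓ → Dense⇒Midpointed r κ ℓ
dense⇒midpointed zero    κ ℓ ℓ≥ χ χ≤1 dense = midpointed-1 (2 ^ ℓ) χ (m^n>0 2 ℓ)
    (>0-*ʳ (2 ^ κ) _ (<-≤-trans (m^n>0 2 ℓ) dense))
dense⇒midpointed (suc r) κ ℓ ℓ≥ χ χ≤1 dense =
  let (p , dense′) = dense-block (2 ^ (ℓ ∸ L)) (2 ^ L) χ 1 (2 ^ κ) (m^n>0 2 (ℓ ∸ L))
                       (≤-trans (≤-reflexive (trans (+-identityʳ _) split))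
                           (subst (λ n → 2 ^ ℓ ≤ 2 ^ κ * ∑ (upTo n) χ) (sym split) dense))
  in midpointed-affine χ p 1 z<s (density-increment r κ _ (λ ℓ ℓ≥ → dense⇒midpointed r (5 + 3 * κ) ℓ ℓ≥) (64 * suc κ)
      (λ j → χ (p + j * 1)) 1 (2 ^ κ)
       (λ j → χ≤1 (p + j * 1)) z<s (≤-reflexive (sym (*-identityʳ _))) (doubling-exponent κ)
       (≤-trans dense′ (≤-reflexive (cong (2 ^ κ *_) (∑-cong (upTo (2 ^ L)) λ j _ → cong (λ i → χ (p + i))
           (sym (*-identityʳ j)))))))
  where
  L = interval-exponent (suc r) κ
  split : 2 ^ (ℓ ∸ L) * 2 ^ L ≡ 2 ^ ℓ
  split = trans (sym (^-distribˡ-+-* 2 (ℓ ∸ L) L)) (cong (2 ^_) (m∸n+n≡m ℓ≥))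

-- Balog–Szemerédi–Gowers

-- Reindexing along an injection on the support of a 0/1 weight: a sum over neighbours in a graph
-- becomes a sum over the values x + y that its edges produce.
∑-push : {I : Set} (xs : List I) (ys : List ℕ) (g φ : I → ℕ) (ψ : ℕ → ℕ) (τ : I → ℕ) → Unique xs → (∀ x → g x ≤ 1) →
  (∀ {x y} → τ x ≡ τ y → x ≡ y) → (∀ {x} → x ∈ xs → 0 < g x → τ x ∈ ys × φ x ≤ ψ (τ x)) →
  ∑[ x ∈ xs ] (g x * φ x) ≤ ∑ ys ψ
∑-push xs ys g φ ψ τ uxs g≤1 inj h = begin
  ∑[ x ∈ xs ] (g x * φ x) ≤⟨ ∑-mono xs (λ x _ → *-monoˡ-≤ (φ x) (≤𝟙 x)) ⟩
  ∑[ x ∈ xs ] (𝟙 (g? x) * φ x) ≡⟨ sym (∑-filter g? xs φ) ⟩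
  ∑ (filter g? xs) φ ≤⟨ ∑-mono (filter g? xs) (λ x x∈ → let (p , q) = ∈-filter⁻ g? {xs = xs} x∈ in proj₂ (h p q)) ⟩
  ∑[ x ∈ filter g? xs ] ψ (τ x) ≤⟨ ∑-inj τ ψ (Uniqueₚ.filter⁺ g? uxs) (λ _ _ → inj)
      (λ x∈ → let (p , q) = ∈-filter⁻ g? {xs = xs} x∈ in proj₁ (h p q)) ⟩
  ∑ ys ψ ∎
  where
  open ≤-Reasoning
  g? : Decidable (λ x → 0 < g x)
  g? x = 0 <? g x
  ≤𝟙 : ∀ x → g x ≤ 𝟙 (g? x)
  ≤𝟙 x with 0 <? g x
  ... | yes _ = g≤1 x
  ... | no ¬p = ≮⇒≥ ¬p

codegree : List ℕ → (ℕ → ℕ → ℕ) → ℕ → ℕ → ℕ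
codegree B g x y = ∑[ b ∈ B ] (g x b * g b y)

rare : List ℕ → (ℕ → ℕ → ℕ) → ℕ → ℕ → ℕ → ℕ
rare B g M x y = 𝟙 (M * codegree B g x y <? length B)

-- Dependent random choice of b.
good-neighbourhood : ∀ B g c M → M ≡ 64 * (c * c) → 0 < length B → (∀ x y → g x y ≡ g y x) →
  length B ² ≤ c * ∑[ x ∈ B ] ∑[ y ∈ B ] g x y →
  ∃ λ b → b ∈ B × M * ∑[ x ∈ B ] ∑[ y ∈ B ] (g b x * g b y * rare B g M x y) + length B ²
    ≤ 2 * (c * c) * ∑ B (g b) ²
good-neighbourhood B g c M M≡ n>0 g-sym E≥ = averaging B f h n>0 (begin
  ∑[ b ∈ B ] f b ≡⟨ trans (∑-+ B _ _) (cong₂ _+_ (∑-*ˡ B M R) (∑-const B (n ²))) ⟩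
  M * ∑ B R + n * n ² ≤⟨ +-monoˡ-≤ (n * n ²) rares ⟩
  n * n ² + n * n ² ≡⟨ l₀ (n * n ²) ⟩
  2 * (n * n ²) ≤⟨ *-monoʳ-≤ 2 (*-cancelˡ-≤ n {{>-nonZero n>0}} degrees) ⟩
  2 * (c * c * ∑[ b ∈ B ] N b ²) ≡⟨ sym (trans (∑-*ˡ B (2 * (c * c)) _) (*-assoc 2 (c * c) _)) ⟩
  ∑[ b ∈ B ] h b ∎)
  where
  open ≤-Reasoning
  n = length B
  N R f h : ℕ → ℕ
  N b = ∑ B (g b)
  R b = ∑[ x ∈ B ] ∑[ y ∈ B ] (g b x * g b y * rare B g M x y)
  f b = M * R b + n ²
  h b = 2 * (c * c) * N b ²
  l₀ : ∀ x → x + x ≡ 2 * x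
  l₀ = solve-∀
  degrees : n * (n * n ²) ≤ n * (c * c * ∑[ b ∈ B ] N b ²)
  degrees = begin
    n * (n * n ²) ≡⟨ l₁ n ⟩
    n ² * n ² ≤⟨ *-mono-≤ E≥ E≥ ⟩
    c * ∑ B N * (c * ∑ B N) ≡⟨ l₂ c (∑ B N) ⟩
    c * c * (∑ B N * ∑ B N) ≤⟨ *-monoʳ-≤ (c * c) (cauchy B N) ⟩
    c * c * (n * ∑[ b ∈ B ] N b ²) ≡⟨ l₃ c n (∑[ b ∈ B ] N b ²) ⟩
    n * (c * c * ∑[ b ∈ B ] N b ²) ∎
    where
    l₁ : ∀ n → n * (n * (n * n)) ≡ n * n * (n * n)
    l₁ = solve-∀
    l₂ : ∀ c s → c * s * (c * s) ≡ c * c * (s * s)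
    l₂ = solve-∀
    l₃ : ∀ c n s → c * c * (n * s) ≡ n * (c * c * s)
    l₃ = solve-∀
  rares : M * ∑ B R ≤ n * n ²
  rares = begin
    M * ∑ B R
      ≡⟨ cong (M *_) (trans (∑-swap B B _) (∑-cong B λ x _ → trans (∑-swap B B _)
          (∑-cong B λ y _ → trans (∑-*ʳ B _ (rare B g M x y))
          (cong (_* rare B g M x y) (∑-cong B λ b _ → cong (_* g b y) (g-sym b x)))))) ⟩
    M * ∑[ x ∈ B ] ∑[ y ∈ B ] (codegree B g x y * rare B g M x y)
      ≡⟨ sym (trans (∑-cong B λ x _ → ∑-*ˡ B M _) (∑-*ˡ B M _)) ⟩
    ∑[ x ∈ B ] ∑[ y ∈ B ] (M * (codegree B g x y * rare B g M x y))
      ≤⟨ ∑-≤ B (λ x _ → ∑-≤ B λ y _ → pointwise x y) ⟩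
    n * (n * n) ∎
    where
    pointwise : ∀ x y → M * (codegree B g x y * rare B g M x y) ≤ n
    pointwise x y with M * codegree B g x y <? n
    ... | yes p = ≤-trans (≤-reflexive (cong (M *_) (*-identityʳ _))) (<⇒≤ p)
    ... | no _  = ≤-trans (≤-reflexive (trans (cong (M *_) (*-zeroʳ (codegree B g x y))) (*-zeroʳ M))) z≤n

-- In `paths`, any two members of `A` are joined by at least n³ / (4 c M²) paths a - b - y - b′ -
-- a′, counted by the middle vertex y.
record WellConnected (B : List ℕ) (g : ℕ → ℕ → ℕ) (c M : ℕ) : Set where
  field
    A      : List ℕ
    distinct : Unique A
    sub    : A ⊆ B
    large  : length B ≤ 4 * c * length A
    paths  : ∀ {a a′} → a ∈ A → a′ ∈ A →
             length B ^ 3 ≤ 4 * c * M ² * ∑[ y ∈ B ] (codegree B g a y * codegree B g a′ y)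

-- In the neighbourhood of the chosen b at most 1/32 of the pairs have a rare codegree; this is the
-- purpose of M = 64 c². So at least half of its vertices are rare with at most a quarter of it, and
-- these form `A`. For any two of them, half of the neighbourhood consists of y at which both
-- codegrees reach n / M.
well-connected : ∀ B g c M → M ≡ 64 * (c * c) → Unique B → 0 < length B → (∀ x y → g x y ≤ 1) →
    (∀ x y → g x y ≡ g y x) → 0 < c →
  length B ² ≤ c * ∑[ x ∈ B ] ∑[ y ∈ B ] g x y → WellConnected B g c M
well-connected B g c M M≡ uB n>0 g≤1 g-sym c>0 E≥ =
  let (b , _ , le) = good-neighbourhood B g c M M≡ n>0 g-sym E≥ in build b le
  where
  open ≤-Reasoning
  n = length B
  build : ∀ b → M * ∑[ x ∈ B ] ∑[ y ∈ B ] (g b x * g b y * rare B g M x y) + n ² ≤ 2 * (c * c) * ∑ B (g b) ² →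
      WellConnected B g c M
  build b le = record
    { A = A ; distinct = Uniqueₚ.filter⁺ A? (Uniqueₚ.filter⁺ g? uB) ; sub = λ a∈ →
        proj₁ (∈-filter⁻ g? {xs = B} (proj₁ (∈-filter⁻ A? {xs = NL} a∈)))
    ; large = ≤-trans n≤ (≤-trans (*-monoʳ-≤ (2 * c) half) (≤-reflexive (l₀ c (length A)))) ; paths = paths }
    where
    R = ∑[ x ∈ B ] ∑[ y ∈ B ] (g b x * g b y * rare B g M x y)
    g? : Decidable (λ x → 0 < g b x)
    g? x = 0 <? g b x
    NL = filter g? B
    N = length NL
    l₀ : ∀ c a → 2 * c * (2 * a) ≡ 4 * c * a
    l₀ = solve-∀
    𝟙≡ : ∀ x → 𝟙 (g? x) ≡ g b x
    𝟙≡ x = helper (g b x) (g≤1 b x) (0 <? g b x)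
      where
      helper : ∀ m → m ≤ 1 → (d : Dec (0 < m)) → 𝟙 d ≡ m
      helper zero          _ (no _)  = refl
      helper (suc zero)    _ (yes _) = refl
      helper (suc zero)    _ (no ¬p) = ⊥-elim (¬p z<s)
      helper (suc (suc m)) (s≤s ()) _
    N≡ : ∑ B (g b) ≡ N
    N≡ = sym (trans (length-filter g? B) (∑-cong B λ x _ → 𝟙≡ x))
    r : ℕ → ℕ
    r x = ∑[ y ∈ NL ] rare B g M x y
    restrict : ∀ (f : ℕ → ℕ) → ∑ NL f ≡ ∑[ x ∈ B ] (g b x * f x)
    restrict f = trans (∑-filter g? B f) (∑-cong B λ x _ → cong (_* f x) (𝟙≡ x))
    R≡ : ∑ NL r ≡ R
    R≡ = trans (restrict r) (∑-cong B λ x _ → trans (cong (g b x *_) (restrict (rare B g M x)))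
           (trans (sym (∑-*ˡ B (g b x) _)) (∑-cong B λ y _ → sym (*-assoc (g b x) (g b y) _))))
    le′ : M * ∑ NL r + n ² ≤ 2 * (c * c) * N ²
    le′ = subst₂ (λ x y → M * x + n ² ≤ 2 * (c * c) * y ²) (sym R≡) N≡ le
    n≤ : n ≤ 2 * c * N
    n≤ = ≮⇒≥ λ lt → <⇒≱ (*-mono-< lt lt) (begin
      n ² ≤⟨ m≤n+m (n ²) (M * ∑ NL r) ⟩
      M * ∑ NL r + n ² ≤⟨ le′ ⟩
      2 * (c * c) * N ² ≤⟨ *-monoˡ-≤ (N ²) (*-monoˡ-≤ (c * c) {2} {4} (≤ᵇ⇒≤ 2 4 _)) ⟩
      4 * (c * c) * N ² ≡⟨ l₁ c N ⟩
      (2 * c * N) ² ∎)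
      where
      l₁ : ∀ c N → 4 * (c * c) * (N * N) ≡ 2 * c * N * (2 * c * N)
      l₁ = solve-∀
    N>0 : 0 < N
    N>0 = >0-*ʳ (2 * c) N (<-≤-trans n>0 n≤)
    few : 32 * ∑ NL r ≤ N ²
    few = *-cancelˡ-≤ (2 * (c * c)) {{>-nonZero (*-mono-< (z<s {1}) (*-mono-< c>0 c>0))}}
      (≤-trans (≤-reflexive (trans (l₁ (c * c) (∑ NL r)) (cong (_* ∑ NL r) (sym M≡))))
          (≤-trans (m≤m+n (M * ∑ NL r) (n ²)) le′))
      where
      l₁ : ∀ c s → 2 * c * (32 * s) ≡ 64 * c * s
      l₁ = solve-∀
    A? : Decidable (λ x → 4 * r x ≤ N)
    A? x = 4 * r x ≤? N
    A = filter A? NL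
    half : N ≤ 2 * length A
    half = *-cancelˡ-≤ N {{>-nonZero N>0}} (*-cancelˡ-≤ 8 (+-cancelʳ-≤ (8 * N ²) _ _ (begin
      8 * (N * N) + 8 * N ² ≡⟨ l₁ N ⟩
      16 * (N * N) ≤⟨ *-monoʳ-≤ 16 (∑-≥ NL (λ x _ → pointwise x)) ⟩
      16 * ∑[ x ∈ NL ] (N * 𝟙 (A? x) + 4 * r x) ≡⟨ cong (16 *_)
          (trans (∑-+ NL _ _) (cong₂ _+_ (trans (∑-*ˡ NL N _) (cong (N *_) (sym (length-filter A? NL))))
          (∑-*ˡ NL 4 r))) ⟩
      16 * (N * length A + 4 * ∑ NL r) ≡⟨ l₂ N (length A) (∑ NL r) ⟩
      8 * (N * (2 * length A)) + 2 * (32 * ∑ NL r) ≤⟨ +-monoʳ-≤ (8 * (N * (2 * length A)))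
          (≤-trans (*-monoʳ-≤ 2 few) (*-monoˡ-≤ (N ²) {2} {8} (≤ᵇ⇒≤ 2 8 _))) ⟩
      8 * (N * (2 * length A)) + 8 * N ² ∎)))
      where
      l₁ : ∀ N → 8 * (N * N) + 8 * (N * N) ≡ 16 * (N * N)
      l₁ = solve-∀
      l₂ : ∀ N a s → 16 * (N * a + 4 * s) ≡ 8 * (N * (2 * a)) + 2 * (32 * s)
      l₂ = solve-∀
      pointwise : ∀ x → N ≤ N * 𝟙 (A? x) + 4 * r x
      pointwise x with 4 * r x ≤? N
      ... | yes _ = ≤-trans (≤-reflexive (sym (*-identityʳ N))) (m≤m+n (N * 1) (4 * r x))
      ... | no ¬p = ≤-trans (<⇒≤ (≰⇒> ¬p)) (m≤n+m (4 * r x) (N * 0))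
    paths : ∀ {a a′} → a ∈ A → a′ ∈ A → n ^ 3 ≤ 4 * c * M ² * ∑[ y ∈ B ] (codegree B g a y * codegree B g a′ y)
    paths {a} {a′} a∈ a′∈ = begin
      n ^ 3 ≡⟨ l₁ n ⟩
      n * n ² ≤⟨ *-monoˡ-≤ (n ²) n≤ ⟩
      2 * c * N * n ² ≡⟨ l₂ c N (n ²) ⟩
      2 * c * (N * n ²) ≤⟨ *-monoʳ-≤ (2 * c) common ⟩
      2 * c * (2 * (M ² * ∑ NL P)) ≡⟨ l₃ c (M ²) (∑ NL P) ⟩
      4 * c * M ² * ∑ NL P ≤⟨ *-monoʳ-≤ (4 * c * M ²) (≤-trans (≤-reflexive (restrict P))
          (∑-mono B λ y _ → ≤-trans (*-monoˡ-≤ (P y) (g≤1 b y)) (≤-reflexive (+-identityʳ (P y))))) ⟩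
      4 * c * M ² * ∑ B P ∎
      where
      P : ℕ → ℕ
      P y = codegree B g a y * codegree B g a′ y
      l₁ : ∀ n → n * (n * (n * 1)) ≡ n * (n * n)
      l₁ = solve-∀
      l₂ : ∀ c N m → 2 * c * N * m ≡ 2 * c * (N * m)
      l₂ = solve-∀
      l₃ : ∀ c m s → 2 * c * (2 * (m * s)) ≡ 4 * c * m * s
      l₃ = solve-∀
      l₄ : ∀ n m → 2 * (n * m) ≡ n * m + n * m
      l₄ = solve-∀
      l₅ : ∀ M s m r q → 2 * (M * s + m * (r + q)) ≡ 2 * (M * s) + m * (2 * (r + q))
      l₅ = solve-∀
      r≤ : ∀ {a a′} → a ∈ A → a′ ∈ A → 2 * (r a + r a′) ≤ N
      r≤ {a} {a′} a∈ a′∈ = *-cancelˡ-≤ 2 (begin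
        2 * (2 * (r a + r a′)) ≡⟨ l₆ (r a) (r a′) ⟩
        4 * r a + 4 * r a′ ≤⟨ +-mono-≤ (proj₂ (∈-filter⁻ A? {xs = NL} a∈)) (proj₂ (∈-filter⁻ A? {xs = NL} a′∈)) ⟩
        N + N ≡⟨ cong (_+_ N) (sym (+-identityʳ N)) ⟩
        2 * N ∎)
        where
        l₆ : ∀ x y → 2 * (2 * (x + y)) ≡ 4 * x + 4 * y
        l₆ = solve-∀
      pointwise : ∀ y → n ² ≤ M ² * P y + n ² * (rare B g M a y + rare B g M a′ y)
      pointwise y with M * codegree B g a y <? n | M * codegree B g a′ y <? n
      ... | yes _ | d     = ≤-trans (≤-reflexive (sym (*-identityʳ (n ²))))
          (≤-trans (*-monoʳ-≤ (n ²) (m≤m+n 1 (𝟙 d))) (m≤n+m _ _))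
      ... | no _  | yes _ = ≤-trans (≤-reflexive (sym (*-identityʳ (n ²)))) (m≤n+m _ _)
      ... | no p  | no q  = ≤-trans (*-mono-≤ (≮⇒≥ p) (≮⇒≥ q))
          (≤-trans (≤-reflexive (l₆ M (codegree B g a y) (codegree B g a′ y))) (m≤m+n _ _))
        where
        l₆ : ∀ M x y → M * x * (M * y) ≡ M * M * (x * y)
        l₆ = solve-∀
      common : N * n ² ≤ 2 * (M ² * ∑ NL P)
      common = +-cancelʳ-≤ (n ² * N) _ _ (begin
        N * n ² + n ² * N ≡⟨ trans (cong (_+_ (N * n ²)) (*-comm (n ²) N)) (sym (l₄ N (n ²))) ⟩
        2 * (N * n ²) ≤⟨ *-monoʳ-≤ 2 (∑-≥ NL λ y _ → pointwise y) ⟩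
        2 * ∑[ y ∈ NL ] (M ² * P y + n ² * (rare B g M a y + rare B g M a′ y))
          ≡⟨ cong (2 *_) (trans (∑-+ NL _ _) (cong₂ _+_ (∑-*ˡ NL (M ²) P)
              (trans (∑-*ˡ NL (n ²) _) (cong (n ² *_) (∑-+ NL _ _))))) ⟩
        2 * (M ² * ∑ NL P + n ² * (r a + r a′)) ≡⟨ l₅ (M ²) (∑ NL P) (n ²) (r a) (r a′) ⟩
        2 * (M ² * ∑ NL P) + n ² * (2 * (r a + r a′)) ≤⟨ +-monoʳ-≤ (2 * (M ² * ∑ NL P)) (*-monoʳ-≤ (n ²) (r≤ a∈ a′∈)) ⟩
        2 * (M ² * ∑ NL P) + n ² * N ∎)

∑-pos : {I : Set} (xs : List I) (f : I → ℕ) → 0 < ∑ xs f → ∃ λ x → x ∈ xs × 0 < f x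
∑-pos (x ∷ xs) f pos with f x in eq
... | suc _ = x , here refl , subst (0 <_) (sym eq) z<s
... | zero  = let (y , y∈ , p) = ∑-pos xs f pos in y , there y∈ , p

count≤1 : (xs : List ℤ) (v : ℤ) → Unique xs → ∑[ x ∈ xs ] 𝟙 (x ℤ.≟ v) ≤ 1
count≤1 []       v u = z≤n
count≤1 (x ∷ xs) v (x∉ ∷ u) with x ℤ.≟ v
... | yes refl = ≤-reflexive (cong suc (trans (∑-cong xs λ y y∈ → 𝟙-no (y ℤ.≟ x) λ { refl → All.lookup x∉ y∈ refl })
    (∑-0 xs)))
... | no _     = count≤1 xs v u

differences : List ℕ → List ℤ
differences A = deduplicate ℤ._≟_ (cartesianProductWith (λ x y → + x ℤ.- + y) A A)

∈-differences : ∀ {A x y} → x ∈ A → y ∈ A → + x ℤ.- + y ∈ differences A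
∈-differences x∈ y∈ = ∈-deduplicate⁺ ℤ._≟_ (∈-cartesianProductWith⁺ (λ x y → + x ℤ.- + y) x∈ y∈)

alternating : List ℕ → ℤ → ℕ
alternating U δ = ∑[ u₁ ∈ U ] ∑[ u₂ ∈ U ] ∑[ u₃ ∈ U ] ∑[ u₄ ∈ U ] 𝟙 (δ ℤ.≟ + u₁ ℤ.- + u₂ ℤ.+ + u₃ ℤ.- + u₄)

-- a − a′ = (a + b) − (b + y) + (y + b′) − (b′ + a′)
paths≤alternating : ∀ B g U → Unique B → (∀ x y → g x y ≤ 1) → (∀ x y → g x y ≡ g y x) →
  (∀ {x y} → x ∈ B → y ∈ B → 0 < g x y → x + y ∈ U) → ∀ {a a′} → a ∈ B → a′ ∈ B →
  ∑[ y ∈ B ] (codegree B g a y * codegree B g a′ y) ≤ alternating U (+ a ℤ.- + a′)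
paths≤alternating B g U uB g≤1 g-sym g⇒U {a} {a′} a∈ a′∈ = begin
  ∑[ y ∈ B ] (codegree B g a y * codegree B g a′ y)
    ≡⟨ ∑-cong B (λ y _ → sym (∑-*ʳ B _ (codegree B g a′ y))) ⟩
  ∑[ y ∈ B ] ∑[ b ∈ B ] (g a b * g b y * codegree B g a′ y)
    ≡⟨ trans (∑-swap B B _) (∑-cong B λ b _ → trans (∑-cong B λ y _ → *-assoc (g a b) (g b y) _) (∑-*ˡ B (g a b) _)) ⟩
  ∑[ b ∈ B ] (g a b * ∑[ y ∈ B ] (g b y * codegree B g a′ y))
    ≤⟨ ∑-push B U (g a) _ _ (_+_ a) uB (g≤1 a) (+-cancelˡ-≡ a _ _) (λ {b} b∈ p → g⇒U a∈ b∈ p , step₁ b b∈) ⟩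
  alternating U (+ a ℤ.- + a′) ∎
  where
  open ≤-Reasoning
  δ = + a ℤ.- + a′
  telescope : ∀ a b y b′ a′ → a ℤ.- a′ ≡ (a ℤ.+ b) ℤ.- (b ℤ.+ y) ℤ.+ (y ℤ.+ b′) ℤ.- (b′ ℤ.+ a′)
  telescope = ℤ-Solver.solve-∀
  step₃ : ∀ b y b′ → b′ ∈ B → 0 < g y b′ → g b′ a′ ≤ ∑[ u₄ ∈ U ] 𝟙
      (δ ℤ.≟ + (a + b) ℤ.- + (b + y) ℤ.+ + (y + b′) ℤ.- + u₄)
  step₃ b y b′ b′∈ p with g b′ a′ in eq
  ... | zero  = z≤n
  ... | suc m = ≤-trans (subst (_≤ 1) eq (g≤1 b′ a′)) (≤-trans
          (≤-reflexive (sym (𝟙-yes (δ ℤ.≟ + (a + b) ℤ.- + (b + y) ℤ.+ + (y + b′) ℤ.- + (b′ + a′))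
              (telescope (+ a) (+ b) (+ y) (+ b′) (+ a′)))))
          (∈⇒≤∑ (λ u₄ → 𝟙 (δ ℤ.≟ + (a + b) ℤ.- + (b + y) ℤ.+ + (y + b′) ℤ.- + u₄))
              (g⇒U b′∈ a′∈ (subst (0 <_) (sym eq) z<s))))
  step₂ : ∀ b y → y ∈ B → codegree B g a′ y ≤ ∑[ u₃ ∈ U ] ∑[ u₄ ∈ U ] 𝟙
      (δ ℤ.≟ + (a + b) ℤ.- + (b + y) ℤ.+ + u₃ ℤ.- + u₄)
  step₂ b y y∈ = ≤-trans (≤-reflexive (∑-cong B λ b′ _ → trans (cong₂ _*_ (g-sym a′ b′) (g-sym b′ y))
      (*-comm (g b′ a′) (g y b′))))
    (∑-push B U (g y) _ _ (_+_ y) uB (g≤1 y) (+-cancelˡ-≡ y _ _) (λ {b′} b′∈ p → g⇒U y∈ b′∈ p , step₃ b y b′ b′∈ p))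
  step₁ : ∀ b → b ∈ B → ∑[ y ∈ B ] (g b y * codegree B g a′ y) ≤ ∑[ u₂ ∈ U ] ∑[ u₃ ∈ U ] ∑[ u₄ ∈ U ] 𝟙
      (δ ℤ.≟ + (a + b) ℤ.- + u₂ ℤ.+ + u₃ ℤ.- + u₄)
  step₁ b b∈ = ∑-push B U (g b) _ _ (_+_ b) uB (g≤1 b) (+-cancelˡ-≡ b _ _) (λ {y} y∈ p → g⇒U b∈ y∈ p , step₂ b y y∈)

alternating-total : ∀ (D : List ℤ) (U : List ℕ) → Unique D → ∑ D (alternating U) ≤
    length U * (length U * (length U * (length U * 1)))
alternating-total D U uD = ≤-trans (≤-reflexive
    (trans (∑-swap D U _) (∑-cong U λ u₁ _ → trans (∑-swap D U _)
        (∑-cong U λ u₂ _ → trans (∑-swap D U _) (∑-cong U λ u₃ _ → ∑-swap D U _)))))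
  (∑-≤ U λ u₁ _ → ∑-≤ U λ u₂ _ → ∑-≤ U λ u₃ _ → ∑-≤ U λ u₄ _ → count≤1 D (+ u₁ ℤ.- + u₂ ℤ.+ + u₃ ℤ.- + u₄) uD)

-- Each difference has at least n³ / (4 c M²) representations u₁ - u₂ + u₃ - u₄, and only |U|⁴ ≤ (L
-- n)⁴ quadruples are available.
few-differences : ∀ B g U c M L → Unique B → 0 < length B → (∀ x y → g x y ≤ 1) → (∀ x y → g x y ≡ g y x) →
  (∀ {x y} → x ∈ B → y ∈ B → 0 < g x y → x + y ∈ U) → length U ≤ L * length B →
  (W : WellConnected B g c M) → length (differences (WellConnected.A W)) ≤ 16 * (c * c) * M ² * (L * L * L * L) * length
      (WellConnected.A W)
few-differences B g U c M L uB n>0 g≤1 g-sym g⇒U U≤ W = begin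
  length D ≤⟨ *-cancelʳ-≤ _ _ (n ^ 3) {{m^n≢0 n 3 {{>-nonZero n>0}}}} counted ⟩
  4 * c * M ² * (L * L * L * L) * n ≤⟨ *-monoʳ-≤ (4 * c * M ² * (L * L * L * L)) large ⟩
  4 * c * M ² * (L * L * L * L) * (4 * c * length A) ≡⟨ l₁ c (M ²) (L * L * L * L) (length A) ⟩
  16 * (c * c) * M ² * (L * L * L * L) * length A ∎
  where
  open ≤-Reasoning
  open WellConnected W
  n = length B
  D = differences A
  uD : Unique D
  uD = deduplicate-!ℤ (cartesianProductWith (λ x y → + x ℤ.- + y) A A)
  l₁ : ∀ c m l a → 4 * c * m * l * (4 * c * a) ≡ 16 * (c * c) * m * l * a
  l₁ = solve-∀
  l₂ : ∀ c m L n → 4 * c * m * (L * n * (L * n * (L * n * (L * n * 1)))) ≡ 4 * c * m * (L * L * L * L) * n *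
      (n * (n * (n * 1)))
  l₂ = solve-∀
  rich : ∀ δ → δ ∈ D → n ^ 3 ≤ 4 * c * M ² * alternating U δ
  rich δ δ∈ = let (a , a′ , a∈ , a′∈ , δ≡) = ∈-cartesianProductWith⁻ (λ x y → + x ℤ.- + y) A A (∈-deduplicate⁻ ℤ._≟_ (cartesianProductWith (λ x y → + x ℤ.- + y) A A) δ∈)
    in ≤-trans (paths a∈ a′∈) (*-monoʳ-≤ (4 * c * M ²) (≤-trans
        (paths≤alternating B g U uB g≤1 g-sym g⇒U (sub a∈) (sub a′∈)) (≤-reflexive (cong (alternating U) (sym δ≡)))))
  counted : length D * n ^ 3 ≤ 4 * c * M ² * (L * L * L * L) * n * n ^ 3
  counted = begin
    length D * n ^ 3 ≤⟨ ∑-≥ D rich ⟩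
    ∑[ δ ∈ D ] (4 * c * M ² * alternating U δ) ≡⟨ ∑-*ˡ D (4 * c * M ²) (alternating U) ⟩
    4 * c * M ² * ∑ D (alternating U) ≤⟨ *-monoʳ-≤ (4 * c * M ²) (alternating-total D U uD) ⟩
    4 * c * M ² * (length U * (length U * (length U * (length U * 1)))) ≤⟨ *-monoʳ-≤ (4 * c * M ²)
        (*-mono-≤ U≤ (*-mono-≤ U≤ (*-mono-≤ U≤ (*-monoˡ-≤ 1 U≤)))) ⟩
    4 * c * M ² * (L * n * (L * n * (L * n * (L * n * 1)))) ≡⟨ l₂ c (M ²) L n ⟩
    4 * c * M ² * (L * L * L * L) * n * n ^ 3 ∎

-- Popular differences

rep : List ℤ → ℤ → ℕ
rep A t = ∑[ y ∈ A ] ∑[ x ∈ A ] 𝟙 (x ℤ.≟ y ℤ.+ t)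

-- The threshold n / 2K is half of the mean of `rep` over a difference set of size K n.
Popular : List ℤ → ℕ → ℤ → Set
Popular A K t = length A ≤ 2 * (K * rep A t)

popular? : ∀ A K t → Dec (Popular A K t)
popular? A K t = length A ≤? 2 * (K * rep A t)

popular : List ℤ → List ℤ → ℕ → List ℤ
popular A D K = filter (popular? A K) D

rep-neg : ∀ A t → rep A (ℤ.- t) ≡ rep A t
rep-neg A t = trans (∑-swap A A _) (∑-cong A λ x _ → ∑-cong A λ y _ →
  ≤-antisym (𝟙-mono (x ℤ.≟ y ℤ.+ ℤ.- t) (y ℤ.≟ x ℤ.+ t) λ { refl → there′ y t })
      (𝟙-mono (y ℤ.≟ x ℤ.+ t) (x ℤ.≟ y ℤ.+ ℤ.- t) λ { refl → back x t }))
  where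
  there′ : ∀ y t → y ≡ (y ℤ.+ ℤ.- t) ℤ.+ t
  there′ = ℤ-Solver.solve-∀
  back : ∀ x t → x ≡ (x ℤ.+ t) ℤ.+ ℤ.- t
  back = ℤ-Solver.solve-∀

record SmallDoubling (A D : List ℤ) (K : ℕ) : Set where
  field
    unique-A : Unique A
    unique-D : Unique D
    diff     : ∀ {x y} → x ∈ A → y ∈ A → x ℤ.- y ∈ D
    size-D   : length D ≤ K * length A
    A>0      : 0 < length A
    K>0      : 0 < K

popular⇒∈ : ∀ {A D K} → SmallDoubling A D K → ∀ {t} → Popular A K t → t ∈ popular A D K
popular⇒∈ {A} {D} {K} sd {t} pop =
  let (y , y∈ , p) = ∑-pos A _ (>0-*ʳ K (rep A t) (>0-*ʳ 2 _ (<-≤-trans A>0 pop)))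
      (x , x∈ , q) = ∑-pos A _ p
      x≡ = 𝟙>0 (x ℤ.≟ y ℤ.+ t) q
  in ∈-filter⁺ (popular? A K) (subst (_∈ D) (trans (cong (λ z → z ℤ.- y) x≡) (lemma y t)) (diff x∈ y∈)) pop
  where
  open SmallDoubling sd
  lemma : ∀ y t → (y ℤ.+ t) ℤ.- y ≡ t
  lemma = ℤ-Solver.solve-∀

∈⇒popular : ∀ {A D K t} → t ∈ popular A D K → Popular A K t
∈⇒popular {A} {D} {K} t∈ = proj₂ (∈-filter⁻ (popular? A K) {xs = D} t∈)

popular-neg : ∀ {A D K} → SmallDoubling A D K → ∀ {t} → t ∈ popular A D K → ℤ.- t ∈ popular A D K
popular-neg {A} {D} {K} sd {t} t∈ = popular⇒∈ sd (≤-trans (∈⇒popular {A} {D} {K} t∈)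
    (≤-reflexive (cong (λ r → 2 * (K * r)) (sym (rep-neg A t)))))

popular-0 : ∀ {A D K} → SmallDoubling A D K → + 0 ∈ popular A D K
popular-0 {A} {D} {K} sd = popular⇒∈ sd (begin
  length A ≡⟨ sym (∑-1 A) ⟩
  ∑[ _ ∈ A ] 1 ≤⟨ ∑-mono A (λ y y∈ → ≤-trans (≤-reflexive (sym (𝟙-yes (y ℤ.≟ y ℤ.+ + 0) (sym (ℤₚ.+-identityʳ y)))))
      (∈⇒≤∑ (λ x → 𝟙 (x ℤ.≟ y ℤ.+ + 0)) y∈)) ⟩
  rep A (+ 0) ≤⟨ m≤n*m (rep A (+ 0)) K {{>-nonZero K>0}} ⟩
  K * rep A (+ 0) ≤⟨ m≤n*m _ 2 ⟩
  2 * (K * rep A (+ 0)) ∎)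
  where
  open ≤-Reasoning
  open SmallDoubling sd

rep≤ : ∀ A t → Unique A → rep A t ≤ length A
rep≤ A t uA = ≤-trans (∑-≤ A λ y _ → count≤1 A (y ℤ.+ t) uA) (≤-reflexive (*-identityʳ _))

-- Unpopular differences account for at most |D| · n / 2K ≤ n² / 2 of the n² pairs, and a popular
-- one for at most n.
popular-many : ∀ {A D K} → SmallDoubling A D K → length A ≤ 2 * length (popular A D K)
popular-many {A} {D} {K} sd = *-cancelˡ-≤ (K * n) {{>-nonZero (*-mono-< K>0 A>0)}} (+-cancelʳ-≤ (n * (K * n)) _ _ (begin
  K * n * n + n * (K * n) ≡⟨ l₁ K n ⟩
  2 * K * (n * n) ≤⟨ *-monoʳ-≤ (2 * K) pairs ⟩
  2 * K * ∑ D (rep A) ≡⟨ sym (∑-*ˡ D (2 * K) (rep A)) ⟩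
  ∑[ t ∈ D ] (2 * K * rep A t) ≤⟨ ∑-mono D (λ t _ → pointwise t) ⟩
  ∑[ t ∈ D ] (2 * K * n * 𝟙 (popular? A K t) + n) ≡⟨ trans (∑-+ D _ _)
      (cong₂ _+_ (trans (∑-*ˡ D (2 * K * n) _) (cong (2 * K * n *_) (sym (length-filter (popular? A K) D))))
      (trans (∑-const D n) (*-comm (length D) n))) ⟩
  2 * K * n * length S + n * length D ≤⟨ +-mono-≤ (≤-reflexive (l₂ K n (length S))) (*-monoʳ-≤ n size-D) ⟩
  K * n * (2 * length S) + n * (K * n) ∎))
  where
  open ≤-Reasoning
  open SmallDoubling sd
  n = length A
  S = popular A D K
  l₁ : ∀ K n → K * n * n + n * (K * n) ≡ 2 * K * (n * n)
  l₁ = solve-∀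
  l₂ : ∀ K n s → 2 * K * n * s ≡ K * n * (2 * s)
  l₂ = solve-∀
  cancel : ∀ x y → x ≡ y ℤ.+ (x ℤ.- y)
  cancel = ℤ-Solver.solve-∀
  pairs : n * n ≤ ∑ D (rep A)
  pairs = ≤-trans (∑-≥ A λ y y∈ → ≤-trans (≤-reflexive (sym (∑-1 A))) (∑-mono A λ x x∈ →
      ≤-trans (≤-reflexive (sym (𝟙-yes (x ℤ.≟ y ℤ.+ (x ℤ.- y)) (cancel x y))))
          (∈⇒≤∑ (λ t → 𝟙 (x ℤ.≟ y ℤ.+ t)) (diff x∈ y∈))))
    (≤-reflexive (sym (trans (∑-swap D A _) (∑-cong A λ y _ → ∑-swap D A _))))
  pointwise : ∀ t → 2 * K * rep A t ≤ 2 * K * n * 𝟙 (popular? A K t) + n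
  pointwise t with popular? A K t
  ... | yes _ = ≤-trans (*-monoʳ-≤ (2 * K) (rep≤ A t unique-A))
      (≤-trans (≤-reflexive (sym (*-identityʳ (2 * K * n)))) (m≤m+n (2 * K * n * 1) n))
  ... | no ¬p = ≤-trans (≤-trans (≤-reflexive (*-assoc 2 K (rep A t))) (<⇒≤ (≰⇒> ¬p))) (m≤n+m n (2 * K * n * 0))

-- The number of ways to write q as a + d₁ + ... + d_j with a from `A` and each summand d from `D`.
chains : List ℤ → List ℤ → ℕ → ℤ → ℕ
chains A D zero    q = ∑[ a ∈ A ] 𝟙 (a ℤ.≟ q)
chains A D (suc j) q = ∑[ d ∈ D ] chains A D j (q ℤ.- d)

chains-total : ∀ A D j Q → Unique Q → ∑ Q (chains A D j) ≤ length D ^ j * length A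
chains-total A D zero    Q uQ = ≤-trans (≤-reflexive (∑-swap Q A _))
    (≤-trans (∑-≤ A λ a _ → ≤-trans (∑-mono Q λ q _ → 𝟙-mono (a ℤ.≟ q) (q ℤ.≟ a) sym) (count≤1 Q a uQ))
  (≤-reflexive (*-comm (length A) 1)))
chains-total A D (suc j) Q uQ = ≤-trans (≤-reflexive (∑-swap Q D _)) (≤-trans (∑-≤ D λ d _ →
    ≤-trans (≤-reflexive (sym (∑-map (λ z → z ℤ.- d) Q (chains A D j))))
        (chains-total A D j (map (λ z → z ℤ.- d) Q) (Unique-map (λ z → z ℤ.- d)
        (λ {x} {y} _ _ eq → trans (cancel x d) (trans (cong (ℤ._+ d) eq) (sym (cancel y d)))) uQ)))
  (≤-reflexive (sym (*-assoc (length D) (length D ^ j) (length A)))))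
  where
  cancel : ∀ x d → x ≡ (x ℤ.- d) ℤ.+ d
  cancel = ℤ-Solver.solve-∀

sumℤ : List ℤ → ℤ
sumℤ []       = + 0
sumℤ (s ∷ ss) = s ℤ.+ sumℤ ss

-- Every popular s is y ↦ y + s on many y ∈ A; telescoping (a − y) + ((y + s) + …) yields many chains.
many-chains : ∀ {A D K} → SmallDoubling A D K → ∀ ss → All (_∈ popular A D K) ss → ∀ a → a ∈ A →
  length A ^ length ss ≤ (2 * K) ^ length ss * chains A D (length ss) (a ℤ.+ sumℤ ss)
many-chains {A} {D} {K} sd [] [] a a∈ = ≤-trans (≤-reflexive (sym (𝟙-yes (a ℤ.≟ a ℤ.+ + 0) (sym (ℤₚ.+-identityʳ a)))))
  (≤-trans (∈⇒≤∑ (λ x → 𝟙 (x ℤ.≟ a ℤ.+ + 0)) a∈) (≤-reflexive (sym (+-identityʳ _))))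
many-chains {A} {D} {K} sd (s ∷ ss) (s∈ ∷ ss∈) a a∈ = begin
  n * n ^ j ≤⟨ *-monoˡ-≤ (n ^ j) (∈⇒popular {A} {D} {K} s∈) ⟩
  2 * (K * rep A s) * n ^ j ≡⟨ l₁ K (rep A s) (n ^ j) ⟩
  2 * K * (rep A s * n ^ j) ≤⟨ *-monoʳ-≤ (2 * K) (≤-trans (≤-reflexive (sym (∑-*ʳ A _ (n ^ j))))
      (≤-trans (∑-mono A λ y _ → pointwise y) (≤-reflexive (∑-*ˡ A ((2 * K) ^ j) _)))) ⟩
  2 * K * ((2 * K) ^ j * ∑[ y ∈ A ] chains A D j ((y ℤ.+ s) ℤ.+ sumℤ ss)) ≡⟨ sym (*-assoc (2 * K) ((2 * K) ^ j) _) ⟩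
  (2 * K) ^ suc j * ∑[ y ∈ A ] chains A D j ((y ℤ.+ s) ℤ.+ sumℤ ss) ≡⟨ cong ((2 * K) ^ suc j *_)
      (∑-cong A λ y _ → cong (chains A D j) (l₂ y s (sumℤ ss) a)) ⟩
  (2 * K) ^ suc j * ∑[ y ∈ A ] chains A D j ((a ℤ.+ (s ℤ.+ sumℤ ss)) ℤ.- (a ℤ.- y))
    ≤⟨ *-monoʳ-≤ ((2 * K) ^ suc j) (∑-inj (λ y → a ℤ.- y) (λ d → chains A D j ((a ℤ.+ (s ℤ.+ sumℤ ss)) ℤ.- d)) unique-A
        (λ {x} {y} _ _ eq → trans (l₃ a x) (trans (cong (λ z → a ℤ.- z) eq) (sym (l₃ a y)))) (λ y∈ → diff a∈ y∈)) ⟩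
  (2 * K) ^ suc j * chains A D (suc j) (a ℤ.+ (s ℤ.+ sumℤ ss)) ∎
  where
  open ≤-Reasoning
  open SmallDoubling sd
  n = length A
  j = length ss
  l₁ : ∀ K r p → 2 * (K * r) * p ≡ 2 * K * (r * p)
  l₁ = solve-∀
  l₂ : ∀ y s σ a → (y ℤ.+ s) ℤ.+ σ ≡ (a ℤ.+ (s ℤ.+ σ)) ℤ.- (a ℤ.- y)
  l₂ = ℤ-Solver.solve-∀
  l₃ : ∀ a x → x ≡ a ℤ.- (a ℤ.- x)
  l₃ = ℤ-Solver.solve-∀
  pointwise : ∀ y → ∑[ x ∈ A ] 𝟙 (x ℤ.≟ y ℤ.+ s) * n ^ j ≤ (2 * K) ^ j * chains A D j ((y ℤ.+ s) ℤ.+ sumℤ ss)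
  pointwise y with (y ℤ.+ s) ∈ℤ? A
  ... | yes ys∈ = ≤-trans (*-monoˡ-≤ (n ^ j) (count≤1 A (y ℤ.+ s) unique-A))
      (≤-trans (≤-reflexive (+-identityʳ _)) (many-chains sd ss ss∈ (y ℤ.+ s) ys∈))
  ... | no ¬ys∈ = ≤-trans (≤-reflexive (cong (_* n ^ j) (trans
      (∑-cong A λ x x∈ → 𝟙-no (x ℤ.≟ y ℤ.+ s) λ { refl → ¬ys∈ x∈ }) (∑-0 A)))) z≤n

Reach : List ℤ → List ℤ → ℕ → ℤ → Set
Reach A S j q = ∃ λ a → ∃ λ ss → a ∈ A × length ss ≡ j × All (_∈ S) ss × q ≡ a ℤ.+ sumℤ ss

-- A substitute for Plünnecke's inequality: each point of A + jS has at least (n / 2K)^j chains, and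
-- there are at most (K n)^j n chains in total.
few-reachable : ∀ {A D K} → SmallDoubling A D K → ∀ j Q → Unique Q → (∀ {q} → q ∈ Q → Reach A (popular A D K) j q) →
  length Q ≤ (2 * (K * K)) ^ j * length A
few-reachable {A} {D} {K} sd j Q uQ reach = *-cancelʳ-≤ _ _ (n ^ j) {{m^n≢0 n j {{>-nonZero A>0}}}} (begin
  length Q * n ^ j ≤⟨ ∑-≥ Q (λ q q∈ → many q (reach q∈)) ⟩
  ∑[ q ∈ Q ] ((2 * K) ^ j * chains A D j q) ≡⟨ ∑-*ˡ Q ((2 * K) ^ j) _ ⟩
  (2 * K) ^ j * ∑ Q (chains A D j) ≤⟨ *-monoʳ-≤ ((2 * K) ^ j) (chains-total A D j Q uQ) ⟩
  (2 * K) ^ j * (length D ^ j * n) ≤⟨ *-monoʳ-≤ ((2 * K) ^ j) (*-monoˡ-≤ n (^-monoˡ-≤ j size-D)) ⟩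
  (2 * K) ^ j * ((K * n) ^ j * n) ≡⟨ cong (λ x → (2 * K) ^ j * (x * n)) (^-distribʳ-* j K n) ⟩
  (2 * K) ^ j * (K ^ j * n ^ j * n) ≡⟨ l₁ ((2 * K) ^ j) (K ^ j) (n ^ j) n ⟩
  (2 * K) ^ j * K ^ j * n * n ^ j ≡⟨ cong (λ x → x * n * n ^ j)
      (trans (sym (^-distribʳ-* j (2 * K) K)) (cong (_^ j) (*-assoc 2 K K))) ⟩
  (2 * (K * K)) ^ j * n * n ^ j ∎)
  where
  open ≤-Reasoning
  open SmallDoubling sd
  n = length A
  l₁ : ∀ a b c n → a * (b * c * n) ≡ a * b * n * c
  l₁ = solve-∀
  many : ∀ q → Reach A (popular A D K) j q → n ^ j ≤ (2 * K) ^ j * chains A D j q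
  many q (a , ss , a∈ , refl , ss∈ , refl) = many-chains sd ss ss∈ a a∈

Overlap : List ℤ → ℤ → ℤ → Set
Overlap S c f = ∃ λ s → s ∈ S × ∃ λ s′ → s′ ∈ S × c ℤ.+ s ≡ f ℤ.+ s′

overlap? : ∀ S c f → Dec (Overlap S c f)
overlap? S c f with any? (λ s → any? (λ s′ → c ℤ.+ s ℤ.≟ f ℤ.+ s′) S) S
... | yes p = let (s , s∈ , q) = find p ; (s′ , s′∈ , eq) = find q in yes (s , s∈ , s′ , s′∈ , eq)
... | no ¬p = no λ { (s , s∈ , s′ , s′∈ , eq) → ¬p (lose s∈ (lose s′∈ eq)) }

-- Ruzsa covering: a maximal family of disjoint translates of S.
covering : ∀ S {z} → z ∈ S → ∀ C → ∃ λ F → F ⊆ C × AllPairs (λ f f′ → ¬ Overlap S f f′) F ×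
    (∀ {c} → c ∈ C → ∃ λ f → f ∈ F × Overlap S c f)
covering S z∈ []      = [] , (λ ()) , [] , λ ()
covering S {z} z∈ (c ∷ C) with covering S z∈ C
... | F , F⊆ , sep , cov with any? (overlap? S c) F
...   | yes p = F , (λ x∈ → there (F⊆ x∈)) , sep , λ { (here refl) → find p ; (there c∈) → cov c∈ }
...   | no ¬p = c ∷ F , (λ { (here refl) → here refl ; (there x∈) → there (F⊆ x∈) }) ,
    All.tabulate (λ f∈ o → ¬p (lose f∈ o)) ∷ sep ,
        λ { (here refl) → c , here refl , z , z∈ , z , z∈ , refl ;
            (there c∈) → let (f , f∈ , o) = cov c∈ in f , there f∈ , o }

length-cartesianProductWith : {I J L : Set} (f : I → J → L) (xs : List I) (ys : List J) →
    length (cartesianProductWith f xs ys) ≡ length xs * length ys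
length-cartesianProductWith f []       ys = refl
length-cartesianProductWith f (x ∷ xs) ys = trans (length-++ (map (f x) ys))
    (cong₂ _+_ (length-map (f x) ys) (length-cartesianProductWith f xs ys))

unique-translates : ∀ a S F → Unique S → AllPairs (λ f f′ → ¬ Overlap S f f′) F →
    Unique (cartesianProductWith (λ f s → a ℤ.+ (f ℤ.+ s)) F S)
unique-translates a S []      uS sep = []
unique-translates a S (f ∷ F) uS (f# ∷ sep) = Uniqueₚ.++⁺ (Unique-map τ (λ {x} {y} _ _ → inj x y) uS)
    (unique-translates a S F uS sep)
  λ { (p , q) → let (s , s∈ , x≡) = ∈-map⁻ τ p
                    (f′ , s′ , f′∈ , s′∈ , x≡′) = ∈-cartesianProductWith⁻ (λ f s → a ℤ.+ (f ℤ.+ s)) F S q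
                in All.lookup f# f′∈ (s , s∈ , s′ , s′∈ , cancel a _ _ (trans (sym x≡) x≡′)) }
  where
  τ : ℤ → ℤ
  τ s = a ℤ.+ (f ℤ.+ s)
  re : ∀ a x → x ≡ (a ℤ.+ x) ℤ.- a
  re = ℤ-Solver.solve-∀
  cancel : ∀ a x y → a ℤ.+ x ≡ a ℤ.+ y → x ≡ y
  cancel a x y eq = trans (re a x) (trans (cong (λ z → z ℤ.- a) eq) (sym (re a y)))
  inj : ∀ x y → τ x ≡ τ y → x ≡ y
  inj x y eq = cancel f x y (cancel a _ _ eq)

dilate : ℕ → ℤ → ℤ
dilate zero    t = t
dilate (suc l) t = dilate l t ℤ.+ dilate l t

dilate-pos : ∀ l t → dilate l (+ t) ≡ + (2 ^ l * t)
dilate-pos zero    t = cong +_ (sym (+-identityʳ t))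
dilate-pos (suc l) t = trans (cong₂ ℤ._+_ (dilate-pos l t) (dilate-pos l t)) (cong +_ (lemma (2 ^ l) t))
  where
  lemma : ∀ q t → q * t + q * t ≡ 2 * q * t
  lemma = solve-∀

-- The sumset F + 2F + ... + 2^(l-1) F in Horner form.
remainders : List ℤ → ℕ → List ℤ
remainders F zero    = + 0 ∷ []
remainders F (suc l) = cartesianProductWith (λ f g → f ℤ.+ (g ℤ.+ g)) F (remainders F l)

length-remainders : ∀ F l → length (remainders F l) ≡ length F ^ l
length-remainders F zero    = refl
length-remainders F (suc l) = trans (length-cartesianProductWith _ F (remainders F l))
    (cong (length F *_) (length-remainders F l))

ℤ⁺ : List ℕ → List ℤ
ℤ⁺ = map (λ x → + x)

-- A + 2^l · S stays small: with W = S + S one has 2 · W ⊆ W + F, hence 2^l · W ⊆ W + F + 2 · F + … + 2^(l-1) · F.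
dilated-sumsets : ∀ {A D K} → SmallDoubling (ℤ⁺ A) D K →
  ∃ λ T → ∃ λ (V : ℕ → List ℕ) → Unique T × length A ≤ 4 * length T ×
    (∀ {l y t} → y ∈ A → t ∈ T → y + 2 ^ l * t ∈ V l) ×
    (∀ l → length (V l) ≤ (2 * (K * K)) ^ 2 * (2 * (2 * (K * K)) ^ 5) ^ l * length A)
dilated-sumsets {A} {D} {K} sd =
  let (F , F⊆ , sep , cov) = covering S (popular-0 sd) C in
  T , V F , deduplicate-!ℕ (map ℤ.∣_∣ S) , many , (λ {l} → member F cov {l}) , size F F⊆ sep
  where
  open ≤-Reasoning
  open SmallDoubling sd
  Az = ℤ⁺ A
  n = length Az
  n≡ : n ≡ length A
  n≡ = length-map (λ x → + x) A
  S = popular Az D K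
  uS : Unique S
  uS = Uniqueₚ.filter⁺ (popular? Az K) unique-D
  S+S = cartesianProductWith ℤ._+_ S S
  C = cartesianProductWith ℤ._+_ S+S S+S
  -- Shifts must be natural numbers. `S` is symmetric, so absolute values stay in it and at least
  -- half of its size survives.
  T = deduplicate _≟_ (map ℤ.∣_∣ S)
  base = deduplicate ℤ._≟_ (cartesianProductWith ℤ._+_ Az S+S)
  V : List ℤ → ℕ → List ℕ
  V F l = map ℤ.∣_∣ (cartesianProductWith ℤ._+_ base (remainders F l))
  T⁺ : ∀ {t} → t ∈ T → + t ∈ S
  T⁺ t∈ = let (s , s∈ , t≡) = ∈-map⁻ ℤ.∣_∣ (∈-deduplicate⁻ _≟_ (map ℤ.∣_∣ S) t∈) in subst (λ t → + t ∈ S) (sym t≡)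
      (abs s s∈)
    where
    abs : ∀ s → s ∈ S → + ℤ.∣ s ∣ ∈ S
    abs (+ m)      s∈ = s∈
    abs ℤ.-[1+ m ] s∈ = popular-neg sd s∈
  many : length A ≤ 4 * length T
  many = begin
    length A ≡⟨ sym n≡ ⟩
    n ≤⟨ popular-many sd ⟩
    2 * length S ≤⟨ *-monoʳ-≤ 2 (length-⊆ uS sub) ⟩
    2 * length (map (λ t → + t) T ++ map (λ t → ℤ.- + t) T) ≡⟨ cong (2 *_)
        (trans (length-++ (map (λ t → + t) T)) (cong₂ _+_ (length-map _ T) (length-map _ T))) ⟩
    2 * (length T + length T) ≡⟨ lemma (length T) ⟩
    4 * length T ∎
    where
    lemma : ∀ t → 2 * (t + t) ≡ 4 * t
    lemma = solve-∀
    sub : S ⊆ map (λ t → + t) T ++ map (λ t → ℤ.- + t) T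
    sub {+ m}      s∈ = ∈-++⁺ˡ (∈-map⁺ (λ t → + t) (∈-deduplicate⁺ _≟_ (∈-map⁺ ℤ.∣_∣ s∈)))
    sub { ℤ.-[1+ m ] } s∈ = ∈-++⁺ʳ (map (λ t → + t) T) (∈-map⁺ (λ t → ℤ.- + t) (∈-deduplicate⁺ _≟_ (∈-map⁺ ℤ.∣_∣ s∈)))
  Cover : List ℤ → Set
  Cover F = ∀ {c} → c ∈ C → ∃ λ f → f ∈ F × Overlap S c f
  split : ∀ F → Cover F → ∀ l {t} → t ∈ S → ∃ λ s → ∃ λ s′ → ∃ λ g → s ∈ S × s′ ∈ S × g ∈ remainders F l × dilate l t ≡
      (s ℤ.+ s′) ℤ.+ g
  split F cov zero    {t} t∈ = t , + 0 , + 0 , t∈ , popular-0 sd , here refl , re t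
    where
    re : ∀ t → t ≡ (t ℤ.+ + 0) ℤ.+ + 0
    re t = sym (trans (ℤₚ.+-identityʳ _) (ℤₚ.+-identityʳ t))
  split F cov (suc l) {t} t∈ =
    let (s , s′ , g , s∈ , s′∈ , g∈ , eq) = split F cov l t∈
        ss∈ = ∈-cartesianProductWith⁺ ℤ._+_ s∈ s′∈
        (f , f∈ , u , u∈ , u′ , u′∈ , o) = cov (∈-cartesianProductWith⁺ ℤ._+_ ss∈ ss∈)
    in u′ , ℤ.- u , f ℤ.+ (g ℤ.+ g) , u′∈ , popular-neg sd u∈ , ∈-cartesianProductWith⁺
        (λ f g → f ℤ.+ (g ℤ.+ g)) f∈ g∈ ,
       trans (cong₂ ℤ._+_ eq eq) (trans (re₁ s s′ g u) (trans (cong (λ x → (x ℤ.- u) ℤ.+ (g ℤ.+ g)) o) (re₂ f u′ u g)))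
    where
    re₁ : ∀ s s′ g u → ((s ℤ.+ s′) ℤ.+ g) ℤ.+ ((s ℤ.+ s′) ℤ.+ g) ≡
        ((((s ℤ.+ s′) ℤ.+ (s ℤ.+ s′)) ℤ.+ u) ℤ.- u) ℤ.+ (g ℤ.+ g)
    re₁ = ℤ-Solver.solve-∀
    re₂ : ∀ f u′ u g → ((f ℤ.+ u′) ℤ.- u) ℤ.+ (g ℤ.+ g) ≡ (u′ ℤ.+ ℤ.- u) ℤ.+ (f ℤ.+ (g ℤ.+ g))
    re₂ = ℤ-Solver.solve-∀
  member : ∀ F → Cover F → ∀ {l y t} → y ∈ A → t ∈ T → y + 2 ^ l * t ∈ V F l
  member F cov {l} {y} {t} y∈ t∈ =
    let (s , s′ , g , s∈ , s′∈ , g∈ , eq) = split F cov l (T⁺ t∈)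
        sum≡ : + (y + 2 ^ l * t) ≡ (+ y ℤ.+ (s ℤ.+ s′)) ℤ.+ g
        sum≡ = trans (cong (λ x → + y ℤ.+ x) (trans (sym (dilate-pos l t)) eq)) (sym (ℤₚ.+-assoc (+ y) (s ℤ.+ s′) g))
    in ∈-map⁺ ℤ.∣_∣ (subst (_∈ cartesianProductWith ℤ._+_ base (remainders F l)) (sym sum≡)
         (∈-cartesianProductWith⁺ ℤ._+_ (∈-deduplicate⁺ ℤ._≟_
             (∈-cartesianProductWith⁺ ℤ._+_ (∈-map⁺ (λ x → + x) y∈) (∈-cartesianProductWith⁺ ℤ._+_ s∈ s′∈))) g∈))
  base≤ : length base ≤ (2 * (K * K)) ^ 2 * n
  base≤ = few-reachable sd 2 base (deduplicate-!ℤ _) λ q∈ →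
    let (a , w , a∈ , w∈ , q≡) = ∈-cartesianProductWith⁻ ℤ._+_ Az S+S
            (∈-deduplicate⁻ ℤ._≟_ (cartesianProductWith ℤ._+_ Az S+S) q∈)
        (s , s′ , s∈ , s′∈ , w≡) = ∈-cartesianProductWith⁻ ℤ._+_ S S w∈
    in a , s ∷ s′ ∷ [] , a∈ , refl , s∈ ∷ s′∈ ∷ [] , trans q≡
        (cong (λ z → a ℤ.+ z) (trans w≡ (cong (λ z → s ℤ.+ z) (sym (ℤₚ.+-identityʳ s′)))))
  -- F lies in 4S, so its disjoint translates of S, moved by a fixed a, lie in A + 5S; hence the
  -- exponent 5.
  F≤ : ∀ F → F ⊆ C → AllPairs (λ f f′ → ¬ Overlap S f f′) F → length F ≤ 2 * (2 * (K * K)) ^ 5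
  F≤ F F⊆ sep = *-cancelʳ-≤ _ _ (length S) {{>-nonZero S>0}} (begin
    length F * length S ≡⟨ sym (length-cartesianProductWith (λ f s → a ℤ.+ (f ℤ.+ s)) F S) ⟩
    length (cartesianProductWith (λ f s → a ℤ.+ (f ℤ.+ s)) F S) ≤⟨ few-reachable sd 5 _
        (unique-translates a S F uS sep) reach ⟩
    X * n ≤⟨ *-monoʳ-≤ X (popular-many sd) ⟩
    X * (2 * length S) ≡⟨ lemma X (length S) ⟩
    2 * X * length S ∎)
    where
    X = (2 * (K * K)) ^ 5
    first : ∃ λ a → a ∈ Az
    first = let (a , a∈ , _) = ∑-pos Az (λ _ → 1) (subst (0 <_) (sym (∑-1 Az)) A>0) in a , a∈
    a = proj₁ first
    S>0 : 0 < length S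
    S>0 = >0-*ʳ 2 (length S) (<-≤-trans A>0 (popular-many sd))
    lemma : ∀ x s → x * (2 * s) ≡ 2 * x * s
    lemma = solve-∀
    re : ∀ a s₁ s₂ s₃ s₄ s → a ℤ.+ (((s₁ ℤ.+ s₂) ℤ.+ (s₃ ℤ.+ s₄)) ℤ.+ s) ≡ a ℤ.+ (s₁ ℤ.+ (s₂ ℤ.+ (s₃ ℤ.+ (s₄ ℤ.+ s))))
    re = ℤ-Solver.solve-∀
    reach : ∀ {q} → q ∈ cartesianProductWith (λ f s → a ℤ.+ (f ℤ.+ s)) F S → Reach Az S 5 q
    reach q∈ =
      let (f , s , f∈ , s∈ , q≡) = ∈-cartesianProductWith⁻ (λ f s → a ℤ.+ (f ℤ.+ s)) F S q∈
          (w , w′ , w∈ , w′∈ , f≡) = ∈-cartesianProductWith⁻ ℤ._+_ S+S S+S (F⊆ f∈)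
          (s₁ , s₂ , s₁∈ , s₂∈ , w≡) = ∈-cartesianProductWith⁻ ℤ._+_ S S w∈
          (s₃ , s₄ , s₃∈ , s₄∈ , w′≡) = ∈-cartesianProductWith⁻ ℤ._+_ S S w′∈
      in a , s₁ ∷ s₂ ∷ s₃ ∷ s₄ ∷ s ∷ [] , proj₂ first , refl , s₁∈ ∷ s₂∈ ∷ s₃∈ ∷ s₄∈ ∷ s∈ ∷ [] ,
         trans q≡ (trans (cong (λ f → a ℤ.+ (f ℤ.+ s)) (trans f≡ (cong₂ ℤ._+_ w≡ w′≡)))
             (trans (re a s₁ s₂ s₃ s₄ s) (cong (λ s → a ℤ.+ (s₁ ℤ.+ (s₂ ℤ.+ (s₃ ℤ.+ (s₄ ℤ.+ s)))))
             (sym (ℤₚ.+-identityʳ s)))))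
  size : ∀ F → F ⊆ C → AllPairs (λ f f′ → ¬ Overlap S f f′) F → ∀ l → length (V F l) ≤
      (2 * (K * K)) ^ 2 * (2 * (2 * (K * K)) ^ 5) ^ l * length A
  size F F⊆ sep l = begin
    length (V F l) ≡⟨ trans (length-map ℤ.∣_∣ (cartesianProductWith ℤ._+_ base (remainders F l)))
        (trans (length-cartesianProductWith ℤ._+_ base (remainders F l))
        (cong (length base *_) (length-remainders F l))) ⟩
    length base * length F ^ l ≤⟨ *-mono-≤ base≤ (^-monoˡ-≤ l (F≤ F F⊆ sep)) ⟩
    (2 * (K * K)) ^ 2 * n * (2 * (2 * (K * K)) ^ 5) ^ l ≡⟨ lemma ((2 * (K * K)) ^ 2) n ((2 * (2 * (K * K)) ^ 5) ^ l) ⟩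
    (2 * (K * K)) ^ 2 * (2 * (2 * (K * K)) ^ 5) ^ l * n ≡⟨ cong ((2 * (K * K)) ^ 2 * (2 * (2 * (K * K)) ^ 5) ^ l *_) n≡
        ⟩
    (2 * (K * K)) ^ 2 * (2 * (2 * (K * K)) ^ 5) ^ l * length A ∎
    where
    lemma : ∀ a n b → a * n * b ≡ a * b * n
    lemma = solve-∀

-- From small differences to density on a progression

count≤1ℕ : (xs : List ℕ) (v : ℕ) → Unique xs → ∑[ x ∈ xs ] 𝟙 (v ≟ x) ≤ 1
count≤1ℕ []       v u = z≤n
count≤1ℕ (x ∷ xs) v (x∉ ∷ u) with v ≟ x
... | yes refl = ≤-reflexive (cong suc (trans (∑-cong xs λ y y∈ → 𝟙-no (x ≟ y) λ { refl → All.lookup x∉ y∈ refl })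
    (∑-0 xs)))
... | no _     = count≤1ℕ xs v u

translate : List ℕ → ℕ → ℕ → ℕ
translate A Δ u = ∑[ c ∈ A ] 𝟙 (u ≟ Δ + c)

translate≤1 : ∀ A Δ u → Unique A → translate A Δ u ≤ 1
translate≤1 A Δ u uA = ≤-trans (≤-reflexive (sym (∑-map (λ c → Δ + c) A (λ c → 𝟙 (u ≟ c)))))
  (count≤1ℕ (map (λ c → Δ + c) A) u (Unique-map (λ c → Δ + c) (λ _ _ → +-cancelˡ-≡ Δ _ _) uA))

translate-∈ : ∀ A Δ u → 0 < translate A Δ u → ∃ λ c → c ∈ A × u ≡ Δ + c
translate-∈ A Δ u pos = let (c , c∈ , p) = ∑-pos A _ pos in c , c∈ , 𝟙>0 (u ≟ Δ + c) p

translate-total : ∀ A Δ s (xs : List ℕ) → Unique xs → ∑[ x ∈ xs ] translate A Δ (x + s) ≤ length A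
translate-total A Δ s xs uxs = ≤-trans (≤-reflexive (∑-swap xs A _)) (≤-trans (∑-≤ A {c = 1} λ c _ →
    ≤-trans (∑-mono xs λ x _ → 𝟙-mono (x + s ≟ Δ + c) (Δ + c ≟ x + s) sym)
      (≤-trans (≤-reflexive (sym (∑-map (_+ s) xs (λ y → 𝟙 (Δ + c ≟ y)))))
          (count≤1ℕ (map (_+ s) xs) (Δ + c) (Unique-map (_+ s) (λ _ _ → +-cancelʳ-≡ s _ _) uxs))))
  (≤-reflexive (*-identityʳ (length A))))

-- With this k the squared change under an almost period is at most n³ / 2K, half of the energy n³ /
-- K of the autocorrelation.
ap-samples : ℕ → ℕ → ℕ
ap-samples K λ′ = (2 + λ′) ² * (16 * K)

ap-growth : ℕ → ℕ → ℕ
ap-growth K λ′ = (2 * (K * K)) ^ 2 * (2 * (2 * (K * K)) ^ 5) ^ λ′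

-- Room for two survivors of the dyadic pigeonhole; the factor 4 is there because `dilated-sumsets`
-- provides |A| / 4 shifts.
ap-threshold : ℕ → ℕ → ℕ
ap-threshold K λ′ = 4 * ((2 * ap-growth K λ′ ^ ap-samples K λ′) ^ suc λ′ * 2)

-- The autocorrelation F of A has ∑ F ≤ n² and ∑ F² ≥ n³ / K; if F is almost d-periodic
-- then ∑ F (x) F (x + j d) ≥ n³ / 4 K for each j.
correlated⇒dense : ∀ A D K Q P W d J → W ≡ suc (2 * P) → Unique A → SmallDoubling (ℤ⁺ A) D K → (∀ {a} → a ∈ A → a ≤ P) →
  (∀ j → j < J → 2 * K * ∑[ x ∈ upTo W ] dist² (convolve A (translate A (Q + P)) (Q + x + j * d))
      (convolve A (translate A (Q + P)) (Q + x)) ≤ length A ^ 3) →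
  ∃ λ o → J ≤ 4 * K * ∑[ j ∈ upTo J ] translate A (Q + P) (o + j * d)
correlated⇒dense A D K Q P W d J W≡ uA sd A≤P periods =
  let (x , x∈ , le) = averaging XS (λ x → F x * (J * n)) (λ x → F x * (4 * K * γ x)) XS>0 weighted
      (y , y∈ , le′) = averaging A (λ _ → J) (λ y → 4 * K * ∑[ j ∈ upTo J ] α (Q + x + j * d + y)) n>0
        (begin
          ∑[ _ ∈ A ] J ≡⟨ trans (∑-const A J) (*-comm n J) ⟩
          J * n ≤⟨ *-cancelˡ-≤ (F x) {{>-nonZero (proj₂ (∈-filter⁻ F? {xs = upTo W} x∈))}} le ⟩
          4 * K * γ x ≡⟨ cong (4 * K *_) (∑-swap (upTo J) A _) ⟩
          4 * K * ∑[ y ∈ A ] ∑[ j ∈ upTo J ] α (Q + x + j * d + y) ≡⟨ sym (∑-*ˡ A (4 * K) _) ⟩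
          ∑[ y ∈ A ] (4 * K * ∑[ j ∈ upTo J ] α (Q + x + j * d + y)) ∎)
  in Q + x + y , ≤-trans le′ (≤-reflexive (cong (4 * K *_) (∑-cong (upTo J) λ j _ → cong α (re (Q + x) (j * d) y))))
  where
  open ≤-Reasoning
  open SmallDoubling sd
  n = length A
  n>0 : 0 < n
  n>0 = subst (0 <_) (length-map (λ x → + x) A) A>0
  α : ℕ → ℕ
  α = translate A (Q + P)
  F γ : ℕ → ℕ
  F x = convolve A α (Q + x)
  γ x = ∑[ j ∈ upTo J ] convolve A α (Q + x + j * d)
  F? : Decidable (λ x → 0 < F x)
  F? x = 0 <? F x
  -- Restricted to the support so that the factor F x can be cancelled after averaging.
  XS = filter F? (upTo W)
  re : ∀ x e y → x + e + y ≡ x + y + e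
  re = solve-∀
  restrict : ∀ (f : ℕ → ℕ) → ∑[ x ∈ XS ] (F x * f x) ≡ ∑[ x ∈ upTo W ] (F x * f x)
  restrict f = trans (∑-filter F? (upTo W) _) (∑-cong (upTo W) λ x _ → drop x)
    where
    drop : ∀ x → 𝟙 (F? x) * (F x * f x) ≡ F x * f x
    drop x with 0 <? F x
    ... | yes _ = +-identityʳ _
    ... | no ¬p = sym (cong (_* f x) (n≤0⇒n≡0 (≮⇒≥ ¬p)))
  F-total≤ : ∑ (upTo W) F ≤ n * n
  F-total≤ = ≤-trans (≤-reflexive (∑-swap (upTo W) A _)) (∑-≤ A λ y _ →
      ≤-trans (≤-reflexive (∑-cong (upTo W) λ x _ → cong α (re′ Q x y)))
      (translate-total A (Q + P) (Q + y) (upTo W) (upTo⁺ W)))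
    where
    re′ : ∀ Q x y → Q + x + y ≡ x + (Q + y)
    re′ = solve-∀
  F-total≥ : n * n ≤ ∑ (upTo W) F
  F-total≥ = ≤-trans (∑-≥ A λ y y∈ → ≤-trans (≤-reflexive (sym (∑-1 A))) (∑-mono A λ c c∈ → hit y c y∈ c∈))
    (≤-reflexive (sym (trans (∑-swap (upTo W) A _) (∑-cong A λ y _ → ∑-swap (upTo W) A _))))
    where
    hit : ∀ y c → y ∈ A → c ∈ A → 1 ≤ ∑[ x ∈ upTo W ] 𝟙 (Q + x + y ≟ Q + P + c)
    hit y c y∈ c∈ = ≤-trans (≤-reflexive (sym (𝟙-yes (Q + x + y ≟ Q + P + c) eq)))
        (∈⇒≤∑ (λ x → 𝟙 (Q + x + y ≟ Q + P + c)) (∈-upTo⁺ x<))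
      where
      x = P + c ∸ y
      y≤ : y ≤ P + c
      y≤ = ≤-trans (A≤P y∈) (m≤m+n P c)
      eq : Q + x + y ≡ Q + P + c
      eq = trans (+-assoc Q x y) (trans (cong (λ z → Q + z) (m∸n+n≡m y≤)) (sym (+-assoc Q P c)))
      x< : x < W
      x< = subst (x <_) (sym W≡) (s≤s (≤-trans (m∸n≤m (P + c) y)
          (≤-trans (+-monoʳ-≤ P (A≤P c∈)) (≤-reflexive (cong (λ z → P + z) (sym (+-identityʳ P)))))))
  one : ∀ (f : ℕ → ℕ) → ∑ XS f ≡ ∑[ x ∈ XS ] (f x * 1)
  one f = ∑-cong XS λ x _ → sym (*-identityʳ (f x))
  F-XS : ∑ XS F ≡ ∑ (upTo W) F
  F-XS = trans (one F) (trans (restrict (λ _ → 1)) (∑-cong (upTo W) λ x _ → *-identityʳ (F x)))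
  XS>0 : 0 < length XS
  XS>0 = let (x , x∈ , _) = ∑-pos XS F (subst (0 <_) (sym F-XS) (<-≤-trans (*-mono-< n>0 n>0) F-total≥)) in ∈⇒>0 x∈
    where
    ∈⇒>0 : ∀ {x : ℕ} {xs} → x ∈ xs → 0 < length xs
    ∈⇒>0 {xs = _ ∷ _} _ = z<s
  -- Small doubling enters here: x ↦ x - P maps the support of F into `D`.
  XS≤ : length XS ≤ K * n
  XS≤ = ≤-trans (length-inj (λ x → + x ℤ.- + P) (Uniqueₚ.filter⁺ F? (upTo⁺ W))
      (λ {x} {x′} _ _ eq → ℤₚ.+-injective (trans (back (+ x) (+ P))
      (trans (cong (ℤ._+ + P) eq) (sym (back (+ x′) (+ P)))))) into)
          (≤-trans size-D (≤-reflexive (cong (K *_) (length-map (λ x → + x) A))))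
    where
    back : ∀ x p → x ≡ (x ℤ.- p) ℤ.+ p
    back = ℤ-Solver.solve-∀
    re′ : ∀ x y p c → x ℤ.+ y ≡ p ℤ.+ c → c ℤ.- y ≡ x ℤ.- p
    re′ x y p c eq = trans (l₁ p c y) (trans (cong (λ z → z ℤ.- p ℤ.- y) (sym eq)) (l₂ x y p))
      where
      l₁ : ∀ p c y → c ℤ.- y ≡ (p ℤ.+ c) ℤ.- p ℤ.- y
      l₁ = ℤ-Solver.solve-∀
      l₂ : ∀ x y p → (x ℤ.+ y) ℤ.- p ℤ.- y ≡ x ℤ.- p
      l₂ = ℤ-Solver.solve-∀
    into : ∀ {x} → x ∈ XS → + x ℤ.- + P ∈ D
    into {x} x∈ =
      let (y , y∈ , p) = ∑-pos A (λ y → α (Q + x + y)) (proj₂ (∈-filter⁻ F? {xs = upTo W} x∈))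
          (c , c∈ , eq) = translate-∈ A (Q + P) (Q + x + y) p
          eq′ = +-cancelˡ-≡ Q (x + y) (P + c) (trans (sym (+-assoc Q x y)) (trans eq (+-assoc Q P c)))
      in subst (_∈ D) (re′ (+ x) (+ y) (+ P) (+ c) (cong +_ eq′)) (diff (∈-map⁺ (λ x → + x) c∈) (∈-map⁺ (λ x → + x) y∈))
  energy : n ^ 3 ≤ K * ∑[ x ∈ upTo W ] (F x * F x)
  energy = *-cancelˡ-≤ n {{>-nonZero n>0}} (begin
    n * n ^ 3 ≡⟨ l₁ n ⟩
    n * n * (n * n) ≤⟨ *-mono-≤ F-total≥ F-total≥ ⟩
    ∑ (upTo W) F * ∑ (upTo W) F ≡⟨ sym (cong₂ _*_ F-XS F-XS) ⟩
    ∑ XS F * ∑ XS F ≤⟨ cauchy XS F ⟩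
    length XS * ∑[ x ∈ XS ] (F x * F x) ≤⟨ *-mono-≤ XS≤ (≤-reflexive (restrict F)) ⟩
    K * n * ∑[ x ∈ upTo W ] (F x * F x) ≡⟨ l₂ K n (∑[ x ∈ upTo W ] (F x * F x)) ⟩
    n * (K * ∑[ x ∈ upTo W ] (F x * F x)) ∎)
    where
    l₁ : ∀ n → n * (n * (n * (n * 1))) ≡ n * n * (n * n)
    l₁ = solve-∀
    l₂ : ∀ K n s → K * n * s ≡ n * (K * s)
    l₂ = solve-∀
  correlation : ∀ j → j < J → n ^ 3 ≤ 4 * K * ∑[ x ∈ upTo W ] (F x * convolve A α (Q + x + j * d))
  correlation j j< = +-cancelʳ-≤ (n ^ 3) _ _ (begin
    n ^ 3 + n ^ 3 ≡⟨ cong (λ z → n ^ 3 + z) (sym (+-identityʳ (n ^ 3))) ⟩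
    2 * n ^ 3 ≤⟨ *-monoʳ-≤ 2 energy ⟩
    2 * (K * ∑[ x ∈ upTo W ] (F x * F x)) ≤⟨ *-monoʳ-≤ 2 (*-monoʳ-≤ K (∑-mono (upTo W) λ x _ → pointwise (F x) (F′ x)))
        ⟩
    2 * (K * ∑[ x ∈ upTo W ] (2 * (F x * F′ x) + dist² (F′ x) (F x))) ≡⟨ cong (λ s → 2 * (K * s))
        (trans (∑-+ (upTo W) _ _) (cong (_+ ∑[ x ∈ upTo W ] dist² (F′ x) (F x)) (∑-*ˡ (upTo W) 2 _))) ⟩
    2 * (K * (2 * ∑[ x ∈ upTo W ] (F x * F′ x) + ∑[ x ∈ upTo W ] dist² (F′ x) (F x))) ≡⟨ l₁ K
        (∑[ x ∈ upTo W ] (F x * F′ x)) (∑[ x ∈ upTo W ] dist² (F′ x) (F x)) ⟩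
    4 * K * ∑[ x ∈ upTo W ] (F x * F′ x) + 2 * K * ∑[ x ∈ upTo W ] dist² (F′ x) (F x) ≤⟨ +-monoʳ-≤
        (4 * K * ∑[ x ∈ upTo W ] (F x * F′ x)) (periods j j<) ⟩
    4 * K * ∑[ x ∈ upTo W ] (F x * F′ x) + n ^ 3 ∎)
    where
    F′ : ℕ → ℕ
    F′ x = convolve A α (Q + x + j * d)
    l₁ : ∀ K s e → 2 * (K * (2 * s + e)) ≡ 4 * K * s + 2 * K * e
    l₁ = solve-∀
    pointwise : ∀ f f′ → f * f ≤ 2 * (f * f′) + dist² f′ f
    pointwise f f′ = ≤-trans (m≤n+m (f * f) (f′ * f′)) (≤-reflexive
        (trans (dist²-eq f′ f) (cong (λ m → 2 * m + dist² f′ f) (*-comm f′ f))))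
  weighted : ∑[ x ∈ XS ] (F x * (J * n)) ≤ ∑[ x ∈ XS ] (F x * (4 * K * γ x))
  weighted = begin
    ∑[ x ∈ XS ] (F x * (J * n)) ≡⟨ trans (∑-*ʳ XS F (J * n)) (cong (_* (J * n)) F-XS) ⟩
    ∑ (upTo W) F * (J * n) ≤⟨ *-monoˡ-≤ (J * n) F-total≤ ⟩
    n * n * (J * n) ≡⟨ l₁ n J ⟩
    J * n ^ 3 ≡⟨ cong (_* n ^ 3) (sym (length-upTo J)) ⟩
    length (upTo J) * n ^ 3 ≤⟨ ∑-≥ (upTo J) (λ j j∈ → correlation j (∈-upTo⁻ j∈)) ⟩
    ∑[ j ∈ upTo J ] (4 * K * ∑[ x ∈ upTo W ] (F x * convolve A α (Q + x + j * d))) ≡⟨ trans (∑-*ˡ (upTo J) (4 * K) _)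
        (cong (4 * K *_) (trans (∑-swap (upTo J) (upTo W) _) (∑-cong (upTo W) λ x _ → ∑-*ˡ (upTo J) (F x) _))) ⟩
    4 * K * ∑[ x ∈ upTo W ] (F x * γ x) ≡⟨ trans (sym (∑-*ˡ (upTo W) (4 * K) _))
        (∑-cong (upTo W) λ x _ → l₂ (4 * K) (F x) (γ x)) ⟩
    ∑[ x ∈ upTo W ] (F x * (4 * K * γ x)) ≡⟨ sym (restrict (λ x → 4 * K * γ x)) ⟩
    ∑[ x ∈ XS ] (F x * (4 * K * γ x)) ∎
    where
    l₁ : ∀ n J → n * n * (J * n) ≡ J * (n * (n * (n * 1)))
    l₁ = solve-∀
    l₂ : ∀ c f g → c * (f * g) ≡ f * (c * g)
    l₂ = solve-∀

-- Small doubling keeps every A + 2^l T small. This is what the dyadic pigeonhole requires, in place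
-- of density in an interval.
dense-progression : ∀ A D K λ′ → Unique A → SmallDoubling (ℤ⁺ A) D K → ap-threshold K λ′ ≤ length A →
  ∃ λ Δ → ∃ λ o → ∃ λ d → 0 < d × 2 ^ suc λ′ ≤ 4 * K * ∑[ j ∈ upTo (2 ^ suc λ′) ] translate A Δ (o + j * d)
dense-progression A D K λ′ uA sd big =
  let (T , V , uT , many , member , V≤) = dilated-sumsets sd
      -- The sums of T and of A serve as crude upper bounds for their elements: windows may be
      -- arbitrarily long, as the mass of the indicator is at most n on any of them.
      M = sum T
      Q = 2 ^ λ′ * M
      Δ = Q + P
      (t′ , d , d>0 , _ , _ , near) = almost-periods A (translate A Δ) W n k v V λ′ T M uA (λ u → translate≤1 A Δ u uA)
        (λ {y} _ → translate-total A Δ y (upTo (W + 4 * Q)) (upTo⁺ (W + 4 * Q))) n>0 n>0 k>0 v>0 uT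
        (λ t∈ → ≤-trans (∈⇒≤∑ (λ t → t) t∈) (≤-reflexive (∑-id T)))
        (λ {l} _ y∈ t∈ → member {l} y∈ t∈)
        (λ {l} l≤ → ≤-trans (V≤ l) (*-monoˡ-≤ n (*-monoʳ-≤ ((2 * (K * K)) ^ 2)
            (^-monoʳ-≤ (2 * (2 * (K * K)) ^ 5) {{>-nonZero (*-mono-< (z<s {1})
            (m^n>0 (2 * (K * K)) {{>-nonZero q>0}} 5))}} l≤))))
        (*-cancelˡ-≤ 4 (≤-trans big many))
      (o , dense) = correlated⇒dense A D K Q P W d (2 ^ suc λ′) refl uA sd
          (λ a∈ → ≤-trans (∈⇒≤∑ (λ a → a) a∈) (≤-reflexive (∑-id A))) (λ j j< → scale _ (near j j<))
  in Δ , o , d , d>0 , dense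
  where
  open SmallDoubling sd
  n = length A
  P = sum A
  W = suc (2 * P)
  k = ap-samples K λ′
  v = ap-growth K λ′
  n>0 : 0 < n
  n>0 = subst (0 <_) (length-map (λ x → + x) A) A>0
  q>0 : 0 < 2 * (K * K)
  q>0 = *-mono-< (z<s {1}) (*-mono-< K>0 K>0)
  k>0 : 0 < k
  k>0 = *-mono-< (z<s {(1 + λ′) + (1 + λ′) * (2 + λ′)}) (*-mono-< (z<s {15}) K>0)
  v>0 : 0 < v
  v>0 = *-mono-< (m^n>0 (2 * (K * K)) {{>-nonZero q>0}} 2)
    (m^n>0 (2 * (2 * (K * K)) ^ 5) {{>-nonZero (*-mono-< (z<s {1}) (m^n>0 (2 * (K * K)) {{>-nonZero q>0}} 5))}} λ′)
  ∑-id : ∀ xs → ∑ xs (λ x → x) ≡ sum xs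
  ∑-id []       = refl
  ∑-id (x ∷ xs) = cong (_+_ x) (∑-id xs)
  scale : ∀ s → k * s ≤ (2 + λ′) ² * (8 * (n ² * n)) → 2 * K * s ≤ n ^ 3
  scale s le = *-cancelˡ-≤ (8 * (2 + λ′) ²) (≤-trans (≤-reflexive (l₁ ((2 + λ′) ²) K s))
      (≤-trans le (≤-reflexive (l₂ ((2 + λ′) ²) n))))
    where
    l₁ : ∀ c K s → 8 * c * (2 * K * s) ≡ c * (16 * K) * s
    l₁ = solve-∀
    l₂ : ∀ c n → c * (8 * (n * n * n)) ≡ 8 * c * (n * (n * (n * 1)))
    l₂ = solve-∀

MidpointedIn : ℕ → List ℕ → Set
MidpointedIn m A = ∃ λ Z → length Z ≡ m × Unique Z × Z ⊆ A × (∀ {z z′} → z ∈ Z → z′ ∈ Z → ∃ λ y → z + z′ ≡ y + y ×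
    y ∈ A)

midpointed-translate : ∀ A Δ m → Midpointed m (translate A Δ) → MidpointedIn m A
midpointed-translate A Δ m (Z , len , uZ , Z⊆ , mid) =
  map (_∸ Δ) Z , trans (length-map _ Z) len , Unique-map (_∸ Δ)
      (λ {x} {y} x∈ y∈ eq → trans (point (Z⊆ x∈)) (trans (cong (λ z → Δ + z) eq) (sym (point (Z⊆ y∈))))) uZ ,
  (λ z∈ → let (x , x∈ , z≡) = ∈-map⁻ (_∸ Δ) z∈ in subst (_∈ A) (sym z≡) (inA (Z⊆ x∈))) ,
  λ z∈ z′∈ → let (x , x∈ , z≡) = ∈-map⁻ (_∸ Δ) z∈
                 (x′ , x′∈ , z′≡) = ∈-map⁻ (_∸ Δ) z′∈
                 (y , eq , y∈) = mid x∈ x′∈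
             in y ∸ Δ , trans (cong₂ _+_ z≡ z′≡) (sums x x′ y (Z⊆ x∈) (Z⊆ x′∈) y∈ eq) , inA y∈
  where
  α = translate A Δ
  point : ∀ {x} → 0 < α x → x ≡ Δ + (x ∸ Δ)
  point {x} p = let (c , _ , eq) = translate-∈ A Δ x p in sym (m+[n∸m]≡n (≤-trans (m≤m+n Δ c) (≤-reflexive (sym eq))))
  inA : ∀ {x} → 0 < α x → x ∸ Δ ∈ A
  inA {x} p = let (c , c∈ , eq) = translate-∈ A Δ x p in subst (_∈ A) (sym (trans (cong (_∸ Δ) eq) (m+n∸m≡n Δ c))) c∈
  lemma : ∀ Δ a b → Δ + a + (Δ + b) ≡ Δ + Δ + (a + b)
  lemma = solve-∀
  sums : ∀ x x′ y → 0 < α x → 0 < α x′ → 0 < α y → x + x′ ≡ y + y → (x ∸ Δ) + (x′ ∸ Δ) ≡ (y ∸ Δ) + (y ∸ Δ)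
  sums x x′ y p p′ q eq = +-cancelˡ-≡ (Δ + Δ) _ _ (trans (sym (lemma Δ (x ∸ Δ) (x′ ∸ Δ)))
      (trans (sym (cong₂ _+_ (point p) (point p′)))
    (trans eq (trans (cong₂ _+_ (point q) (point q)) (lemma Δ (y ∸ Δ) (y ∸ Δ))))))

-- The sum graph

edge? : ∀ S x y → Dec (x ≢ y × x + y ∈ S)
edge? S x y = ¬? (x ≟ y) ×-dec (x + y ∈? S)

edge : List ℕ → ℕ → ℕ → ℕ
edge S x y = 𝟙 (edge? S x y)

edge-sym : ∀ S x y → edge S x y ≡ edge S y x
edge-sym S x y = ≤-antisym (half x y) (half y x)
  where
  half : ∀ x y → edge S x y ≤ edge S y x
  half x y = 𝟙-mono (edge? S x y) (edge? S y x) λ { (x≢y , s∈) → (λ eq → x≢y (sym eq)) , subst (_∈ S) (+-comm x y) s∈ }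

Independent : List ℕ → List ℕ → ℕ → Set
Independent S L h = ∃ λ Z → length Z ≡ h × Unique Z × Z ⊆ L × (∀ {z z′} → z ∈ Z → z′ ∈ Z → z ≢ z′ → z + z′ ∉ S)

independent-⊆ : ∀ {S L L′ h} → L ⊆ L′ → Independent S L h → Independent S L′ h
independent-⊆ sub (Z , len , uZ , Z⊆ , ind) = Z , len , uZ , (λ z∈ → sub (Z⊆ z∈)) , ind

-- Choosing x discards x and its neighbours, at most δ vertices. Degrees are measured in the full
-- list `L`, so the bound persists while `Ls` shrinks.
greedy : ∀ S L δ h Ls → Unique Ls → Ls ⊆ L → (∀ {x} → x ∈ Ls → suc (∑ L (edge S x)) ≤ δ) → 0 < δ → h * δ ≤ length Ls →
    Independent S Ls h
greedy S L δ zero    Ls uL sub low δ>0 big = [] , refl , [] , (λ ()) , λ ()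
greedy S L δ (suc h) [] uL sub low δ>0 big = ⊥-elim (<⇒≱ (<-≤-trans δ>0 (m≤m+n δ (h * δ))) big)
greedy S L δ (suc h) (x ∷ Ls) (x∉ ∷ uL) sub low δ>0 big =
  let (Z , len , uZ , Z⊆ , ind) = rec in
  x ∷ Z , cong suc len , All.tabulate (λ z∈ → All.lookup x∉ (rest (Z⊆ z∈))) ∷ uZ ,
  (λ { (here refl) → here refl ; (there z∈) → there (rest (Z⊆ z∈)) }) ,
  λ { (here refl) (here refl) ne _ → ne refl
    ; (here refl) (there z∈) ne s∈ → separate (Z⊆ z∈) (ne , s∈)
    ; (there z∈) (here refl) ne s∈ → separate (Z⊆ z∈) ((λ eq → ne (sym eq)) , subst (_∈ S) (+-comm _ x) s∈)
    ; (there z∈) (there z′∈) → ind z∈ z′∈ }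
  where
  free? : Decidable (λ y → ¬ (x ≢ y × x + y ∈ S))
  free? y = ¬? (edge? S x y)
  Ls′ = filter free? Ls
  rest : Ls′ ⊆ Ls
  rest z∈ = proj₁ (∈-filter⁻ free? z∈)
  separate : ∀ {z} → z ∈ Ls′ → ¬ (x ≢ z × x + z ∈ S)
  separate z∈ = proj₂ (∈-filter⁻ free? {xs = Ls} z∈)
  covered : length Ls ≤ length Ls′ + ∑ L (edge S x)
  covered = begin
    length Ls ≡⟨ sym (∑-1 Ls) ⟩
    ∑[ _ ∈ Ls ] 1 ≤⟨ ∑-mono Ls (λ y _ → split y) ⟩
    ∑[ y ∈ Ls ] (𝟙 (free? y) + edge S x y) ≡⟨ ∑-+ Ls _ _ ⟩
    ∑[ y ∈ Ls ] 𝟙 (free? y) + ∑ Ls (edge S x) ≤⟨ +-mono-≤ (≤-reflexive (sym (length-filter free? Ls)))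
        (∑-⊆ (edge S x) uL (λ y∈ → sub (there y∈))) ⟩
    length Ls′ + ∑ L (edge S x) ∎
    where
    open ≤-Reasoning
    split : ∀ y → 1 ≤ 𝟙 (free? y) + edge S x y
    split y with edge? S x y
    ... | yes _ = ≤-refl
    ... | no _  = ≤-refl
  rec : Independent S Ls′ h
  rec = greedy S L δ h Ls′ (Uniqueₚ.filter⁺ free? uL) (λ z∈ → sub (there (rest z∈))) (λ z∈ → low (there (rest z∈))) δ>0
    (+-cancelˡ-≤ δ _ _ (≤-trans big (≤-trans (s≤s covered) (≤-trans (≤-reflexive (sym (+-suc (length Ls′) _)))
        (≤-trans (+-monoʳ-≤ (length Ls′) (low (here refl))) (≤-reflexive (+-comm (length Ls′) δ)))))))

-- If at least half of the vertices have 2h (deg + 1) ≤ n, the greedy choice succeeds among them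
-- with δ = n / 2h. Otherwise more than half have larger degree, and 8h ≤ n absorbs the 1 added to
-- the degrees.
independent-or-dense : ∀ S L h → Unique L → 0 < h → 8 * h ≤ length L →
  Independent S L h ⊎ length L ² ≤ 8 * h * ∑[ x ∈ L ] ∑[ y ∈ L ] edge S x y
independent-or-dense S L h uL h>0 big = go (n ≤? 2 * length Ls)
  where
  open ≤-Reasoning
  n = length L
  instance
    2h≢0 : NonZero (2 * h)
    2h≢0 = >-nonZero (*-mono-< (z<s {1}) h>0)
  deg : ℕ → ℕ
  deg x = ∑ L (edge S x)
  low? : Decidable (λ x → 2 * h * suc (deg x) ≤ n)
  low? x = 2 * h * suc (deg x) ≤? n
  Ls = filter low? L
  δ = n / (2 * h)
  go : Dec (n ≤ 2 * length Ls) → Independent S L h ⊎ n ² ≤ 8 * h * ∑ L deg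
  go (yes p) = inj₁ (independent-⊆ {S} (λ z∈ → proj₁ (∈-filter⁻ low? z∈))
      (greedy S L δ h Ls (Uniqueₚ.filter⁺ low? uL) (λ z∈ → proj₁ (∈-filter⁻ low? z∈))
      (λ {x} x∈ → ≤-trans (≤-reflexive (sym (m*n/n≡m (suc (deg x)) (2 * h))))
          (/-mono-≤ (≤-trans (≤-reflexive (*-comm (suc (deg x)) (2 * h))) (proj₂ (∈-filter⁻ low? {xs = L} x∈))) ≤-refl))
      (m≥n⇒m/n>0 (≤-trans (*-monoˡ-≤ h {2} {8} (≤ᵇ⇒≤ 2 8 _)) big))
      (*-cancelˡ-≤ 2 (≤-trans (≤-reflexive (l h δ)) (≤-trans (m/n*n≤m n (2 * h)) p)))))
    where
    l : ∀ h d → 2 * (h * d) ≡ d * (2 * h)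
    l = solve-∀
  go (no ¬p) = inj₂ nn≤
    where
    l₂ : ∀ n s h d → 4 * (n * s + 2 * h * (n + d)) ≡ n * (2 * (2 * s)) + 8 * h * n + 8 * h * d
    l₂ = solve-∀
    pointwise : ∀ x → n ≤ n * 𝟙 (low? x) + 2 * h * suc (deg x)
    pointwise x with 2 * h * suc (deg x) ≤? n
    ... | yes _ = ≤-trans (≤-reflexive (sym (*-identityʳ n))) (m≤m+n (n * 1) _)
    ... | no ¬q = ≤-trans (<⇒≤ (≰⇒> ¬q)) (m≤n+m _ (n * 0))
    nn≤ : n * n ≤ 8 * h * ∑ L deg
    nn≤ = +-cancelʳ-≤ (2 * (n * n) + n * n) _ _ (begin
      n * n + (2 * (n * n) + n * n) ≡⟨ l₃ (n * n) ⟩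
      4 * (n * n) ≤⟨ *-monoʳ-≤ 4 (∑-≥ L (λ x _ → pointwise x)) ⟩
      4 * ∑[ x ∈ L ] (n * 𝟙 (low? x) + 2 * h * suc (deg x)) ≡⟨ cong (4 *_)
          (trans (∑-+ L _ _) (cong₂ _+_ (trans (∑-*ˡ L n _) (cong (n *_) (sym (length-filter low? L))))
          (trans (∑-*ˡ L (2 * h) _) (cong (2 * h *_) (trans (∑-+ L (λ _ → 1) deg) (cong (_+ ∑ L deg) (∑-1 L))))))) ⟩
      4 * (n * length Ls + 2 * h * (n + ∑ L deg)) ≡⟨ l₂ n (length Ls) h (∑ L deg) ⟩
      n * (2 * (2 * length Ls)) + 8 * h * n + 8 * h * ∑ L deg ≤⟨ +-monoˡ-≤ (8 * h * ∑ L deg)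
          (+-mono-≤ (*-monoʳ-≤ n (*-monoʳ-≤ 2 (<⇒≤ (≰⇒> ¬p)))) (*-monoˡ-≤ n big)) ⟩
      n * (2 * n) + n * n + 8 * h * ∑ L deg ≡⟨ l₄ n (8 * h * ∑ L deg) ⟩
      8 * h * ∑ L deg + (2 * (n * n) + n * n) ∎)
      where
      l₃ : ∀ x → x + (2 * x + x) ≡ 4 * x
      l₃ = solve-∀
      l₄ : ∀ n d → n * (2 * n) + n * n + d ≡ d + (2 * (n * n) + n * n)
      l₄ = solve-∀

-- Elements whose doubles avoid the set

edges-below : ℕ → List ℕ → List ℕ → ℕ → ℕ
edges-below x S L y = 𝟙 (y <? x) * edge S x y

-- Each edge is charged to its larger end point, which halves the total; some x then has n / 2c
-- smaller neighbours.
dense⇒large-vertex : ∀ S L c → 0 < length L → length L ² ≤ c * ∑[ x ∈ L ] ∑[ y ∈ L ] edge S x y →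
  ∃ λ x → length L ≤ 2 * c * ∑ L (edges-below x S L)
dense⇒large-vertex S L c n>0 dense =
  let (x , _ , le) = averaging L (λ _ → n) (λ x → 2 * c * ∑ L (edges-below x S L)) n>0 summed in x , le
  where
  open ≤-Reasoning
  n = length L
  pointwise : ∀ x y → edge S x y ≤ edges-below x S L y + edges-below y S L x
  pointwise x y = go (edge? S x y) (<-cmp x y)
    where
    go : (d : Dec (x ≢ y × x + y ∈ S)) → Tri (x < y) (x ≡ y) (x > y) → 𝟙 d ≤ edges-below x S L y + edges-below y S L x
    go (no _)          _              = z≤n
    go (yes e)         (tri> _ _ y<x) = ≤-trans (≤-reflexive (sym
        (cong₂ _*_ (𝟙-yes (y <? x) y<x) (𝟙-yes (edge? S x y) e)))) (m≤m+n _ _)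
    go (yes e)         (tri< x<y _ _) = ≤-trans (≤-reflexive (sym
        (cong₂ _*_ (𝟙-yes (x <? y) x<y) (trans (edge-sym S y x) (𝟙-yes (edge? S x y) e))))) (m≤n+m _ _)
    go (yes (x≢y , _)) (tri≈ _ x≡y _) = ⊥-elim (x≢y x≡y)
  E = ∑[ x ∈ L ] ∑ L (edges-below x S L)
  summed : ∑[ _ ∈ L ] n ≤ ∑[ x ∈ L ] (2 * c * ∑ L (edges-below x S L))
  summed = begin
    ∑[ _ ∈ L ] n ≡⟨ ∑-const L n ⟩
    n ² ≤⟨ dense ⟩
    c * ∑[ x ∈ L ] ∑[ y ∈ L ] edge S x y ≤⟨ *-monoʳ-≤ c (∑-mono L λ x _ → ∑-mono L λ y _ → pointwise x y) ⟩
    c * ∑[ x ∈ L ] ∑[ y ∈ L ] (edges-below x S L y + edges-below y S L x) ≡⟨ cong (c *_)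
        (trans (∑-cong L λ x _ → ∑-+ L _ _) (trans (∑-+ L _ _) (cong (λ z → E + z) (∑-swap L L _)))) ⟩
    c * (E + E) ≡⟨ lemma c E ⟩
    2 * c * E ≡⟨ sym (∑-*ˡ L (2 * c) _) ⟩
    ∑[ x ∈ L ] (2 * c * ∑ L (edges-below x S L)) ∎
    where
    lemma : ∀ c e → c * (e + e) ≡ 2 * c * e
    lemma = solve-∀

window? : ∀ x s → Dec (x ≤ s × s < 2 * x)
window? x s = (x ≤? s) ×-dec (s <? 2 * x)

-- For y < x the sum x + y is below 2x, so distinct smaller neighbours give distinct elements of X
-- or of the part of Y in [x, 2x).
edges-below≤ : ∀ X Y x → Unique Y → ∑ Y (edges-below x (X ++ Y) Y) ≤ length X + length (filter (window? x) Y)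
edges-below≤ X Y x uY = ≤-trans (≤-reflexive (∑-cong Y λ y _ → sym (*-identityʳ _)))
  (≤-trans (∑-push Y (X ++ filter (window? x) Y) (edges-below x (X ++ Y) Y) (λ _ → 1) (λ _ → 1) (λ y → x + y) uY
      (λ y → *-mono-≤ (𝟙≤1 (y <? x)) (𝟙≤1 (edge? (X ++ Y) x y))) (+-cancelˡ-≡ x _ _)
      (λ {y} _ p → into y p , ≤-refl))
    (≤-reflexive (trans (∑-1 (X ++ filter (window? x) Y)) (length-++ X))))
  where
  into : ∀ y → 0 < edges-below x (X ++ Y) Y y → x + y ∈ X ++ filter (window? x) Y
  into y p = [ ∈-++⁺ˡ , (λ s∈ → ∈-++⁺ʳ X (∈-filter⁺ (window? x) s∈
      (m≤m+n x y , +-monoʳ-< x (<-≤-trans y<x (m≤m+n x 0))))) ]′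
               (∈-++⁻ X (proj₂ (𝟙>0 (edge? (X ++ Y) x y) (>0-*ʳ (𝟙 (y <? x)) _ p))))
    where
    y<x : y < x
    y<x = 𝟙>0 (y <? x) (>0-*ˡ (𝟙 (y <? x)) _ p)

block? : ∀ x q j → Dec (2 ^ j * x ≤ q × q < 2 ^ j * (2 * x))
block? x q j = (2 ^ j * x ≤? q) ×-dec (q <? 2 ^ j * (2 * x))

-- Recursion on the scale: block j + 1 of x is block j of 2x, and block 0 of x lies below 2x.
blocks-disjoint : ∀ R x q → ∑[ j ∈ upTo R ] 𝟙 (block? x q j) ≤ 1
blocks-disjoint zero    x q = z≤n
blocks-disjoint (suc R) x q = ≤-trans (≤-reflexive (∑-upTo-suc R (λ j → 𝟙 (block? x q j)))) (go (q <? 2 * x))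
  where
  next : ∑[ j ∈ upTo R ] 𝟙 (block? x q (suc j)) ≤ ∑[ j ∈ upTo R ] 𝟙 (block? (2 * x) q j)
  next = ∑-mono (upTo R) λ j _ → 𝟙-mono (block? x q (suc j)) (block? (2 * x) q j)
      λ { (p , p′) → subst (_≤ q) (re (2 ^ j) x) p , subst (q <_) (re (2 ^ j) (2 * x)) p′ }
    where
    re : ∀ c x → 2 * c * x ≡ c * (2 * x)
    re = solve-∀
  go : Dec (q < 2 * x) → 𝟙 (block? x q 0) + ∑[ j ∈ upTo R ] 𝟙 (block? x q (suc j)) ≤ 1
  go (yes q<) = +-mono-≤ (𝟙≤1 (block? x q 0)) (≤-trans next (≤-reflexive
      (trans (∑-cong (upTo R) λ j _ → 𝟙-no (block? (2 * x) q j)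
    λ { (p , _) → <⇒≱ q< (≤-trans (m≤n*m (2 * x) (2 ^ j) {{m^n≢0 2 j}}) p) }) (∑-0 (upTo R)))))
  go (no ¬q<) = +-mono-≤ (≤-reflexive (𝟙-no (block? x q 0) λ { (_ , p) → ¬q< (subst (q <_) (+-identityʳ (2 * x)) p) }))
      (≤-trans next (blocks-disjoint R (2 * x) q))

-- The multiples 2^j v, v ∈ V ⊆ [x, 2x), are distinct.
dyadic-multiples : ∀ R x V Q → Unique V → (∀ {v} → v ∈ V → x ≤ v × v < 2 * x) →
  ∑[ j ∈ upTo R ] ∑[ v ∈ V ] 𝟙 (2 ^ j * v ∈? Q) ≤ length Q
dyadic-multiples R x V Q uV V⊆ = begin
  ∑[ j ∈ upTo R ] ∑[ v ∈ V ] 𝟙 (2 ^ j * v ∈? Q) ≤⟨ ∑-mono (upTo R) (λ j _ → ∑-mono V λ v _ → member (2 ^ j * v)) ⟩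
  ∑[ j ∈ upTo R ] ∑[ v ∈ V ] ∑[ q ∈ Q ] 𝟙 (q ≟ 2 ^ j * v) ≡⟨ trans (∑-cong (upTo R) λ j _ → ∑-swap V Q _)
      (∑-swap (upTo R) Q _) ⟩
  ∑[ q ∈ Q ] ∑[ j ∈ upTo R ] ∑[ v ∈ V ] 𝟙 (q ≟ 2 ^ j * v) ≤⟨ ∑-≤ Q
      (λ q _ → ≤-trans (∑-mono (upTo R) λ j _ → one q j) (blocks-disjoint R x q)) ⟩
  length Q * 1 ≡⟨ *-identityʳ (length Q) ⟩
  length Q ∎
  where
  open ≤-Reasoning
  member : ∀ u → 𝟙 (u ∈? Q) ≤ ∑[ q ∈ Q ] 𝟙 (q ≟ u)
  member u with u ∈? Q
  ... | yes u∈ = ≤-trans (≤-reflexive (sym (𝟙-yes (u ≟ u) refl))) (∈⇒≤∑ (λ q → 𝟙 (q ≟ u)) u∈)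
  ... | no _   = z≤n
  one : ∀ q j → ∑[ v ∈ V ] 𝟙 (q ≟ 2 ^ j * v) ≤ 𝟙 (block? x q j)
  one q j with block? x q j
  ... | yes _ = ≤-trans (≤-reflexive (sym (∑-map (2 ^ j *_) V (λ u → 𝟙 (q ≟ u)))))
                  (count≤1ℕ (map (2 ^ j *_) V) q (Unique-map (2 ^ j *_)
                      (λ {v} {v′} _ _ eq → *-cancelˡ-≡ v v′ (2 ^ j) {{m^n≢0 2 j}} eq) uV))
  ... | no ¬b = ≤-reflexive (trans (∑-cong V λ v v∈ → 𝟙-no (q ≟ 2 ^ j * v)
      λ { refl → ¬b (*-monoʳ-≤ (2 ^ j) (proj₁ (V⊆ v∈)) , *-monoʳ-< (2 ^ j) {{m^n≢0 2 j}} (proj₂ (V⊆ v∈))) }) (∑-0 V))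

undoubled? : ∀ S y → Dec (y + y ∉ S)
undoubled? S y = ¬? (y + y ∈? S)

-- Follow v, 2v, 4v, … from each v ∈ V until it leaves Y: it does so at an element of B or through X, or after many steps.
doubling-chains : ∀ X Y x V R → Unique V → V ⊆ Y → (∀ {v} → v ∈ V → x ≤ v × v < 2 * x) →
  R * length V ≤ length Y + R * (length (filter (undoubled? (X ++ Y)) Y) + length X)
doubling-chains X Y x V R uV V⊆Y V⊆ = begin
  R * length V ≡⟨ cong (_* length V) (sym (length-upTo R)) ⟩
  length (upTo R) * length V ≤⟨ ∑-≥ (upTo R) (λ j _ → ≤-trans (chain j) (+-monoʳ-≤ (c j) (leaving j))) ⟩
  ∑[ j ∈ upTo R ] (c j + (length B + length X)) ≡⟨ trans (∑-+ (upTo R) c _)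
      (cong (λ z → ∑ (upTo R) c + z) (trans (∑-const (upTo R) _) (cong (_* (length B + length X)) (length-upTo R)))) ⟩
  ∑ (upTo R) c + R * (length B + length X) ≤⟨ +-monoˡ-≤ (R * (length B + length X)) (dyadic-multiples R x V Y uV V⊆) ⟩
  length Y + R * (length B + length X) ∎
  where
  open ≤-Reasoning
  S = X ++ Y
  B = filter (undoubled? S) Y
  c β ξ : ℕ → ℕ
  c j = ∑[ v ∈ V ] 𝟙 (2 ^ j * v ∈? Y)
  β j = ∑[ v ∈ V ] 𝟙 (2 ^ j * v ∈? B)
  ξ j = ∑[ v ∈ V ] 𝟙 (2 ^ j * v ∈? X)
  pointwise : ∀ j v → 𝟙 (2 ^ j * v ∈? Y) ≤ 𝟙 (2 ^ suc j * v ∈? Y) + (𝟙 (2 ^ j * v ∈? B) + 𝟙 (2 ^ suc j * v ∈? X))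
  pointwise j v = go (2 ^ j * v ∈? Y) (2 ^ j * v + 2 ^ j * v ∈? S)
    where
    double : 2 ^ j * v + 2 ^ j * v ≡ 2 ^ suc j * v
    double = re (2 ^ j) v
      where
      re : ∀ c v → c * v + c * v ≡ 2 * c * v
      re = solve-∀
    go : (d : Dec (2 ^ j * v ∈ Y)) → Dec (2 ^ j * v + 2 ^ j * v ∈ S) → 𝟙 d ≤ 𝟙 (2 ^ suc j * v ∈? Y) +
        (𝟙 (2 ^ j * v ∈? B) + 𝟙 (2 ^ suc j * v ∈? X))
    go (no _)   _        = z≤n
    go (yes u∈) (no ¬s)  = ≤-trans (≤-reflexive (sym (𝟙-yes (2 ^ j * v ∈? B) (∈-filter⁺ (undoubled? S) u∈ ¬s))))
        (≤-trans (m≤m+n _ _) (m≤n+m _ (𝟙 (2 ^ suc j * v ∈? Y))))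
    go (yes u∈) (yes s∈) = [ (λ p → ≤-trans (≤-reflexive (sym (𝟙-yes (2 ^ suc j * v ∈? X) (subst (_∈ X) double p))))
        (≤-trans (m≤n+m _ _) (m≤n+m _ (𝟙 (2 ^ suc j * v ∈? Y))))) ,
                             (λ p → ≤-trans (≤-reflexive (sym (𝟙-yes (2 ^ suc j * v ∈? Y) (subst (_∈ Y) double p))))
                                 (m≤m+n _ _)) ]′ (∈-++⁻ X s∈)
  step : ∀ j → c j ≤ c (suc j) + (β j + ξ (suc j))
  step j = ≤-trans (∑-mono V λ v _ → pointwise j v) (≤-reflexive
      (trans (∑-+ V _ _) (cong (λ z → c (suc j) + z) (∑-+ V _ _))))
  -- Bounds the chains that ended before step j: an end is charged to 2^i v in B or to 2^(i+1) v in
  -- X.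
  lost : ℕ → ℕ
  lost j = ∑[ i ∈ upTo j ] (β i + ξ (suc i))
  chain : ∀ j → length V ≤ c j + lost j
  chain zero    = ≤-trans (≤-reflexive (sym (∑-1 V))) (≤-trans
      (∑-mono V λ v v∈ → ≤-reflexive (sym (𝟙-yes (2 ^ 0 * v ∈? Y) (subst (_∈ Y) (sym (+-identityʳ v)) (V⊆Y v∈)))))
      (m≤m+n _ _))
  chain (suc j) = ≤-trans (chain j) (≤-trans (+-monoˡ-≤ (lost j) (step j))
      (≤-reflexive (trans (re (c (suc j)) (β j + ξ (suc j)) (lost j)) (cong (λ z → c (suc j) + z) (sym last)))))
    where
    re : ∀ a b l → a + b + l ≡ a + (l + b)
    re = solve-∀
    last : lost (suc j) ≡ lost j + (β j + ξ (suc j))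
    last = trans (cong (λ n → ∑[ i ∈ upTo n ] (β i + ξ (suc i))) (sym (+-comm j 1)))
        (trans (∑-upTo-+ j 1 (λ i → β i + ξ (suc i)))
             (cong (λ z → lost j + z) (trans (+-identityʳ _) (cong (λ i → β i + ξ (suc i)) (+-identityʳ j)))))
  leaving : ∀ j → lost j ≤ length B + length X
  leaving j = ≤-trans (≤-reflexive (∑-+ (upTo j) β (λ i → ξ (suc i)))) (+-mono-≤ (dyadic-multiples j x V B uV V⊆)
    (≤-trans (m≤n+m _ (ξ 0)) (≤-trans (≤-reflexive (sym (∑-upTo-suc j ξ))) (dyadic-multiples (suc j) x V X uV V⊆))))

-- The edges force |X| + |V| ≥ n / 16h. If 64h doublings kept most chains from V inside Y, far more
-- than n distinct multiples would lie there. So many chains end; the bound on |X| limits those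
-- ending through X, and the others end in B.
many-undoubled : ∀ X Y h → Unique Y → 0 < length Y → 128 * (h * length X) ≤ length Y →
  length Y ² ≤ 8 * h * ∑[ x ∈ Y ] ∑[ y ∈ Y ] edge (X ++ Y) x y → length Y ≤
      32 * (h * length (filter (undoubled? (X ++ Y)) Y))
many-undoubled X Y h uY n>0 X≤ dense = *-cancelˡ-≤ 2 (+-cancelʳ-≤ (2 * n) _ _ (begin
    2 * n + 2 * n ≡⟨ l₁ n ⟩
    4 * n ≤⟨ *-monoʳ-≤ 4 (≤-trans large (*-monoʳ-≤ (2 * (8 * h)) (edges-below≤ X Y x uY))) ⟩
    4 * (2 * (8 * h) * (length X + length V)) ≡⟨ l₂ h (length X) (length V) ⟩
    64 * (h * length X) + 64 * h * length V ≤⟨ +-monoʳ-≤ (64 * (h * length X))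
        (doubling-chains X Y x V (64 * h) (Uniqueₚ.filter⁺ (window? x) uY) (λ v∈ → proj₁ (∈-filter⁻ (window? x) v∈))
        (λ v∈ → proj₂ (∈-filter⁻ (window? x) {xs = Y} v∈))) ⟩
    64 * (h * length X) + (n + 64 * h * (length B + length X)) ≡⟨ l₃ h (length X) n (length B) ⟩
    2 * (32 * (h * length B)) + n + 128 * (h * length X) ≤⟨ +-monoʳ-≤ (2 * (32 * (h * length B)) + n) X≤ ⟩
    2 * (32 * (h * length B)) + n + n ≡⟨ l₄ (2 * (32 * (h * length B))) n ⟩
    2 * (32 * (h * length B)) + 2 * n ∎))
  where
  open ≤-Reasoning
  n = length Y
  B = filter (undoubled? (X ++ Y)) Y
  vertex = dense⇒large-vertex (X ++ Y) Y (8 * h) n>0 dense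
  x = proj₁ vertex
  large = proj₂ vertex
  V = filter (window? x) Y
  l₁ : ∀ n → 2 * n + 2 * n ≡ 4 * n
  l₁ = solve-∀
  l₂ : ∀ h x v → 4 * (2 * (8 * h) * (x + v)) ≡ 64 * (h * x) + 64 * h * v
  l₂ = solve-∀
  l₃ : ∀ h x n b → 64 * (h * x) + (n + 64 * h * (b + x)) ≡ 2 * (32 * (h * b)) + n + 128 * (h * x)
  l₃ = solve-∀
  l₄ : ∀ b n → b + n + n ≡ b + 2 * n
  l₄ = solve-∀

-- The dichotomy is used twice: on Y its dense case yields the large set `B`, and on `B` it yields
-- the dense graph for Balog-Szemerédi-Gowers, whose sums lie in S with |S| ≤ 64 h |B|.
dense⇒independent : ∀ X Y h r κ λ′ c L M K t → c ≡ 8 * h → L ≡ 64 * h → M ≡ 64 * (c * c) → K ≡ 16 * (c * c) * M ² *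
    (L * L * L * L) → Unique Y → 0 < h → h ≤ 2 ^ r →
  4 * K ≤ 2 ^ κ → interval-exponent r κ ≤ suc λ′ → 128 * (h * length X) ≤ length Y → c * (32 * h) ≤ length Y →
  ap-threshold K λ′ ≤ t → t * (4 * c) * (32 * h) ≤ length Y → Independent (X ++ Y) Y h
dense⇒independent X Y h r κ λ′ c L M K t c≡ L≡ M≡ K≡ uY h>0 h≤ 4K≤ λ≥ X≤ big₁ t≥ big₂ =
  [ (λ i → i) , (λ dense → [ independent-⊆ {S} (λ z∈ → proj₁ (∈-filter⁻ (undoubled? S) z∈)) , structured (many dense) ]′
                             (graph B uB (large c big₁ (many dense)))) ]′
    (graph Y uY (≤-trans (m≤m*n c (32 * h) {{>-nonZero (*-mono-< (z<s {31}) h>0)}}) big₁))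
  where
  open ≤-Reasoning
  S = X ++ Y
  n = length Y
  B = filter (undoubled? S) Y
  uB : Unique B
  uB = Uniqueₚ.filter⁺ (undoubled? S) uY
  c>0 : 0 < c
  c>0 = subst (0 <_) (sym c≡) (*-mono-< (z<s {7}) h>0)
  n>0 : 0 < n
  n>0 = <-≤-trans (*-mono-< c>0 (*-mono-< (z<s {31}) h>0)) big₁
  graph : ∀ L′ → Unique L′ → c ≤ length L′ → Independent S L′ h ⊎ length L′ ² ≤ c * ∑[ x ∈ L′ ] ∑[ y ∈ L′ ] edge S x y
  graph L′ uL′ le = subst (λ e → Independent S L′ h ⊎ length L′ ² ≤ e * ∑[ x ∈ L′ ] ∑[ y ∈ L′ ] edge S x y) (sym c≡)
      (independent-or-dense S L′ h uL′ h>0 (≤-trans (≤-reflexive (sym c≡)) le))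
  many : n ² ≤ c * ∑[ x ∈ Y ] ∑[ y ∈ Y ] edge S x y → n ≤ 32 * (h * length B)
  many dense = many-undoubled X Y h uY n>0 X≤ (subst (λ e → n ² ≤ e * ∑[ x ∈ Y ] ∑[ y ∈ Y ] edge S x y) c≡ dense)
  large : ∀ m → m * (32 * h) ≤ n → n ≤ 32 * (h * length B) → m ≤ length B
  large m le le′ = *-cancelʳ-≤ _ _ (32 * h) {{>-nonZero (*-mono-< (z<s {31}) h>0)}}
      (≤-trans le (≤-trans le′ (≤-reflexive (re h (length B)))))
    where
    re : ∀ h b → 32 * (h * b) ≡ b * (32 * h)
    re = solve-∀
  structured : n ≤ 32 * (h * length B) → length B ² ≤ c * ∑[ x ∈ B ] ∑[ y ∈ B ] edge S x y → Independent S Y h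
  structured n≤ denseB =
    let (Δ , o , d , d>0 , dense) = dense-progression A (differences A) K λ′ distinct sd (≤-trans t≥ t≤) in finish Δ o d
            d>0 dense
    where
    B>0 : 0 < length B
    B>0 = <-≤-trans c>0 (large c big₁ n≤)
    W : WellConnected B (edge S) c M
    W = well-connected B (edge S) c M M≡ uB B>0 (λ x y → 𝟙≤1 (edge? S x y)) (edge-sym S) c>0 denseB
    open WellConnected W renaming (large to large-A)
    S≤ : length S ≤ L * length B
    S≤ = begin
      length S ≡⟨ length-++ X ⟩
      length X + n ≤⟨ +-monoˡ-≤ n (≤-trans (m≤n*m (length X) h {{>-nonZero h>0}})
          (≤-trans (m≤n*m (h * length X) 128) X≤)) ⟩
      n + n ≤⟨ +-mono-≤ n≤ n≤ ⟩
      32 * (h * length B) + 32 * (h * length B) ≡⟨ re h (length B) ⟩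
      64 * h * length B ≡⟨ cong (_* length B) (sym L≡) ⟩
      L * length B ∎
      where
      re : ∀ h b → 32 * (h * b) + 32 * (h * b) ≡ 64 * h * b
      re = solve-∀
    A>0 : 0 < length A
    A>0 = >0-*ʳ (4 * c) (length A) (<-≤-trans B>0 large-A)
    sd : SmallDoubling (ℤ⁺ A) (differences A) K
    sd = record
      { unique-A = Unique-map (λ x → + x) (λ _ _ → ℤₚ.+-injective) distinct
      ; unique-D = deduplicate-!ℤ (cartesianProductWith (λ x y → + x ℤ.- + y) A A)
      ; diff     = λ x∈ y∈ → let (x , x∈′ , x≡) = ∈-map⁻ (λ x → + x) x∈ ; (y , y∈′ , y≡) = ∈-map⁻ (λ x → + x) y∈
                             in subst₂ (λ x y → x ℤ.- y ∈ differences A) (sym x≡) (sym y≡) (∈-differences x∈′ y∈′)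
      ; size-D   = ≤-trans (few-differences B (edge S) S c M L uB B>0 (λ x y → 𝟙≤1 (edge? S x y)) (edge-sym S)
          (λ {x} {y} _ _ p → proj₂ (𝟙>0 (edge? S x y) p)) S≤ W)
                     (≤-reflexive (cong₂ _*_ (sym K≡) (sym (length-map (λ x → + x) A))))
      ; A>0      = subst (0 <_) (sym (length-map (λ x → + x) A)) A>0
      ; K>0      = subst (0 <_) (sym K≡) (*-mono-< (*-mono-< (*-mono-< (z<s {15}) (*-mono-< c>0 c>0))
          (*-mono-< M>0 M>0)) (*-mono-< (*-mono-< (*-mono-< L>0 L>0) L>0) L>0)) }
      where
      L>0 : 0 < L
      L>0 = subst (0 <_) (sym L≡) (*-mono-< (z<s {63}) h>0)
      M>0 : 0 < M
      M>0 = subst (0 <_) (sym M≡) (*-mono-< (z<s {63}) (*-mono-< c>0 c>0))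
    t≤ : t ≤ length A
    t≤ = *-cancelˡ-≤ (4 * c) {{>-nonZero (*-mono-< (z<s {3}) c>0)}}
           (≤-trans (≤-reflexive (*-comm (4 * c) t)) (≤-trans (large (t * (4 * c)) big₂ n≤) large-A))
    extract : MidpointedIn (2 ^ r) A → Independent S Y h
    extract (Z , len , uZ , Z⊆ , mid) =
      take h Z , trans (length-take h Z) (m≤n⇒m⊓n≡m (≤-trans h≤ (≤-reflexive (sym len)))) , Uniqueₚ.take⁺ h uZ ,
      (λ z∈ → proj₁ (∈-filter⁻ (undoubled? S) (sub (Z⊆ (prefix z∈))))) ,
      λ z∈ z′∈ _ s∈ → let (y , eq , y∈) = mid (prefix z∈) (prefix z′∈) in proj₂
          (∈-filter⁻ (undoubled? S) {xs = Y} (sub y∈)) (subst (_∈ S) eq s∈)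
      where
      prefix : ∀ {z} → z ∈ take h Z → z ∈ Z
      prefix {z} z∈ = subst (z ∈_) (take++drop≡id h Z) (∈-++⁺ˡ z∈)
    finish : ∀ Δ o d → 0 < d → 2 ^ suc λ′ ≤ 4 * K * ∑[ j ∈ upTo (2 ^ suc λ′) ] translate A Δ (o + j * d) →
        Independent S Y h
    finish Δ o d d>0 dense = extract (midpointed-translate A Δ (2 ^ r) (midpointed-affine (translate A Δ) o d d>0
      (dense⇒midpointed r κ (suc λ′) λ≥ (λ j → translate A Δ (o + j * d)) (λ j → translate≤1 A Δ (o + j * d) distinct)
        (≤-trans dense (*-monoˡ-≤ (∑[ j ∈ upTo (2 ^ suc λ′) ] translate A Δ (o + j * d)) 4K≤)))))

-- A lower bound for the cut G

ℕtoℚ≡ : ∀ n → ℕtoℚ n ≡ mkℚ (+ n) 0 (Coprimality.sym (1-coprimeTo n))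
ℕtoℚ≡ n = ℚₚ.normalize-coprime (Coprimality.sym (1-coprimeTo n))

ℕtoℚ-mono-≤ : ∀ {m n} → m ≤ n → ℕtoℚ m ℚ.≤ ℕtoℚ n
ℕtoℚ-mono-≤ {m} {n} m≤n rewrite ℕtoℚ≡ m | ℕtoℚ≡ n = ℚ.*≤* (ℤₚ.*-monoʳ-≤-nonNeg (+ 1) (ℤ.+≤+ m≤n))

ℕtoℚ-mono-< : ∀ {m n} → m < n → ℕtoℚ m ℚ.< ℕtoℚ n
ℕtoℚ-mono-< {m} {n} m<n rewrite ℕtoℚ≡ m | ℕtoℚ≡ n = ℚ.*<* (ℤₚ.*-monoʳ-<-pos (+ 1) (ℤ.+<+ m<n))

ℕtoℚ-cancel-≤ : ∀ {m n} → ℕtoℚ m ℚ.≤ ℕtoℚ n → m ≤ n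
ℕtoℚ-cancel-≤ {m} {n} le = ≮⇒≥ λ n<m → ℚₚ.<-irrefl refl (ℚₚ.<-≤-trans (ℕtoℚ-mono-< n<m) le)

ℕtoℚ-* : ∀ m n → ℕtoℚ (m * n) ≡ ℕtoℚ m ℚ.* ℕtoℚ n
ℕtoℚ-* m n rewrite ℕtoℚ≡ m | ℕtoℚ≡ n = cong (ℚ._/ 1) (ℤₚ.pos-* m n)

0≤ℕtoℚ : ∀ n → 0ℚ ℚ.≤ ℕtoℚ n
0≤ℕtoℚ n = ℕtoℚ-mono-≤ {0} {n} z≤n

ℚ-*-mono-≤ : ∀ {p q r s} → 0ℚ ℚ.≤ r → 0ℚ ℚ.≤ q → p ℚ.≤ q → r ℚ.≤ s → p ℚ.* r ℚ.≤ q ℚ.* s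
ℚ-*-mono-≤ {p} {q} {r} {s} 0≤r 0≤q p≤q r≤s = ℚₚ.≤-trans (ℚₚ.*-monoʳ-≤-nonNeg r {{ℚ.nonNegative 0≤r}} p≤q)
    (ℚₚ.*-monoˡ-≤-nonNeg q {{ℚ.nonNegative 0≤q}} r≤s)

ℚ-0≤* : ∀ {p q} → 0ℚ ℚ.≤ p → 0ℚ ℚ.≤ q → 0ℚ ℚ.≤ p ℚ.* q
ℚ-0≤* {p} {q} 0≤p 0≤q = ℚₚ.≤-trans (ℚₚ.≤-reflexive (sym (ℚₚ.*-zeroˡ q)))
    (ℚₚ.*-monoʳ-≤-nonNeg q {{ℚ.nonNegative 0≤q}} 0≤p)

reciprocal : ∀ j → ℕtoℚ (suc j) ℚ.* (+ 1 ℚ./ suc j) ≡ 1ℚ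
reciprocal j = ℚₚ.toℚᵘ-injective (ℚᵘₚ.≃-trans (ℚₚ.toℚᵘ-homo-* (ℕtoℚ (suc j)) (+ 1 ℚ./ suc j))
  (ℚᵘₚ.≃-trans (ℚᵘₚ.*-cong (ℚₚ.toℚᵘ-fromℚᵘ (ℚᵘ.mkℚᵘ (+ suc j) 0)) (ℚₚ.toℚᵘ-fromℚᵘ (ℚᵘ.mkℚᵘ (+ 1) j)))
    (ℚᵘ.*≡* (cong +_ (lemma j)))))
  where
  lemma : ∀ j → (1 + j) * 1 * 1 ≡ 1 * (1 * (1 + j))
  lemma = solve-∀

0≤reciprocal : ∀ j → 0ℚ ℚ.≤ + 1 ℚ./ suc j
0≤reciprocal j = ℚₚ.nonNegative⁻¹ (+ 1 ℚ./ suc j) {{ℚₚ.normalize-nonNeg 1 (suc j)}}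

0≤expTerm : ∀ j {p} → 0ℚ ℚ.≤ p → 0ℚ ℚ.≤ expTerm j p
0≤expTerm zero    0≤p = 0≤ℕtoℚ 1
0≤expTerm (suc j) 0≤p = ℚ-0≤* (ℚ-0≤* (0≤expTerm j 0≤p) 0≤p) (0≤reciprocal j)

0≤expSum : ∀ k {p} → 0ℚ ℚ.≤ p → 0ℚ ℚ.≤ expSum k p
0≤expSum zero    0≤p = ℚₚ.≤-refl
0≤expSum (suc k) 0≤p = ℚₚ.≤-trans (0≤expSum k 0≤p) (ℚₚ.≤-trans (ℚₚ.≤-reflexive (sym (ℚₚ.+-identityʳ _)))
    (ℚₚ.+-monoʳ-≤ (expSum k _) (0≤expTerm k 0≤p)))

-- The j-th term of exp (2m) is a product of j factors 2m / i ≥ 2.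
expTerm≥ : ∀ m j → j ≤ m → ℕtoℚ (2 ^ j) ℚ.≤ expTerm j (ℕtoℚ (2 * m))
expTerm≥ m zero    j≤ = ℚₚ.≤-refl
expTerm≥ m (suc j) j≤ = begin
  ℕtoℚ (2 * 2 ^ j) ≡⟨ trans (cong ℕtoℚ (*-comm 2 (2 ^ j))) (ℕtoℚ-* (2 ^ j) 2) ⟩
  ℕtoℚ (2 ^ j) ℚ.* ℕtoℚ 2 ≤⟨ ℚ-*-mono-≤ (0≤ℕtoℚ 2) (0≤expTerm j (0≤ℕtoℚ (2 * m))) (expTerm≥ m j (<⇒≤ j≤)) two≤ ⟩
  expTerm j p ℚ.* (p ℚ.* (+ 1 ℚ./ suc j)) ≡⟨ sym (ℚₚ.*-assoc (expTerm j p) p (+ 1 ℚ./ suc j)) ⟩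
  expTerm j p ℚ.* p ℚ.* (+ 1 ℚ./ suc j) ∎
  where
  open ℚₚ.≤-Reasoning
  p = ℕtoℚ (2 * m)
  two≤ : ℕtoℚ 2 ℚ.≤ p ℚ.* (+ 1 ℚ./ suc j)
  two≤ = begin
    ℕtoℚ 2 ≡⟨ sym (trans (cong (ℕtoℚ 2 ℚ.*_) (reciprocal j)) (ℚₚ.*-identityʳ (ℕtoℚ 2))) ⟩
    ℕtoℚ 2 ℚ.* (ℕtoℚ (suc j) ℚ.* (+ 1 ℚ./ suc j)) ≡⟨ sym (ℚₚ.*-assoc (ℕtoℚ 2) (ℕtoℚ (suc j)) (+ 1 ℚ./ suc j)) ⟩
    ℕtoℚ 2 ℚ.* ℕtoℚ (suc j) ℚ.* (+ 1 ℚ./ suc j) ≡⟨ cong (ℚ._* (+ 1 ℚ./ suc j)) (sym (ℕtoℚ-* 2 (suc j))) ⟩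
    ℕtoℚ (2 * suc j) ℚ.* (+ 1 ℚ./ suc j) ≤⟨ ℚₚ.*-monoʳ-≤-nonNeg (+ 1 ℚ./ suc j) {{ℚ.nonNegative (0≤reciprocal j)}}
        (ℕtoℚ-mono-≤ (*-monoʳ-≤ 2 j≤)) ⟩
    p ℚ.* (+ 1 ℚ./ suc j) ∎

_∋ⁿ_ : Cut → ℕ → Set
L ∋ⁿ n = L (ℕtoℚ n)

natC-∋ : ∀ m n → m < n → natC n ∋ⁿ m
natC-∋ m n = ℕtoℚ-mono-<

-- At 2m the term of index m of the exponential series is already at least 2^m, and the terms before
-- it are nonnegative.
expC-∋ : ∀ L m a → L ∋ⁿ (2 * m) → a < 2 ^ m → expC L ∋ⁿ a
expC-∋ L m a p∈ a< = ℕtoℚ (2 * m) , p∈ , 0≤ℕtoℚ (2 * m) , suc m ,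
  ℚₚ.<-≤-trans (ℕtoℚ-mono-< a<) (ℚₚ.≤-trans (expTerm≥ m m ≤-refl)
    (ℚₚ.≤-trans (ℚₚ.≤-reflexive (sym (ℚₚ.+-identityˡ _))) (ℚₚ.+-monoˡ-≤ (expTerm m (ℕtoℚ (2 * m)))
        (0≤expSum m (0≤ℕtoℚ (2 * m))))))

scaleC-∋ : ∀ L c a b → 1ℚ ℚ.≤ c → L ∋ⁿ a → b < a → scaleC c L ∋ⁿ b
scaleC-∋ L c a b 1≤c p∈ b<a = ℕtoℚ a , p∈ , 0≤ℕtoℚ a ,
  ℚₚ.<-≤-trans (ℕtoℚ-mono-< b<a) (ℚₚ.≤-trans (ℚₚ.≤-reflexive (sym (ℚₚ.*-identityˡ (ℕtoℚ a))))
      (ℚₚ.*-monoʳ-≤-nonNeg (ℕtoℚ a) {{ℚ.nonNegative (0≤ℕtoℚ a)}} 1≤c))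

1≤^ℚ : ∀ {p} e → 1ℚ ℚ.≤ p → 1ℚ ℚ.≤ p ^ℚ e
1≤^ℚ zero    1≤p = ℚₚ.≤-refl
1≤^ℚ {p} (suc e) 1≤p = ℚₚ.≤-trans (ℚₚ.≤-reflexive (sym (ℚₚ.*-identityˡ 1ℚ)))
    (ℚ-*-mono-≤ (0≤ℕtoℚ 1) (ℚₚ.≤-trans (0≤ℕtoℚ 1) 1≤p) 1≤p (1≤^ℚ e 1≤p))

powC-∋ : ∀ L a b e → 0 < e → L ∋ⁿ a → b < a → powC L e ∋ⁿ b
powC-∋ L a b (suc e) _ p∈ b<a = ℕtoℚ a , p∈ , 0≤ℕtoℚ a ,
  ℚₚ.<-≤-trans (ℕtoℚ-mono-< b<a) (ℚₚ.≤-trans (ℚₚ.≤-reflexive (sym (ℚₚ.*-identityʳ (ℕtoℚ a))))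
    (ℚₚ.*-monoˡ-≤-nonNeg (ℕtoℚ a) {{ℚ.nonNegative (0≤ℕtoℚ a)}} (1≤^ℚ e (ℕtoℚ-mono-≤ {1} {a} (≤-trans (s≤s z≤n) b<a)))))

-- Built from the inside out: each exponential turns 2m into 2^m. The summands 4, 3 and 1 absorb the
-- halving and the strictness of the cuts, while the scaling s ≥ 1 and the power e ≥ 1 do not
-- decrease a value that is at least 1.
tower-∋ : ∀ n s e x → 2 * (4 + x) < n → 0 < s → 0 < e →
  expC (scaleC (ℕtoℚ s) (expC (powC (scaleC 1ℚ (expC (natC n))) e))) ∋ⁿ (2 ^ (2 ^ (2 ^ x)))
tower-∋ n s e x n> s>0 e>0 =
  expC-∋ L₅ m₃ _ (scaleC-∋ L₄ (ℕtoℚ s) (suc (2 * m₃)) (2 * m₃) (ℕtoℚ-mono-≤ s>0)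
    (expC-∋ L₃ m₂ (suc (2 * m₃)) (powC-∋ L₂ (suc (2 * m₂)) (2 * m₂) e e>0
      (scaleC-∋ L₁ 1ℚ (2 + 2 * m₂) (suc (2 * m₂)) ℚₚ.≤-refl
        (expC-∋ (natC n) (4 + x) (2 + 2 * m₂) (natC-∋ _ n n>) b₁) ≤-refl) ≤-refl) b₂) ≤-refl)
    (^-monoʳ-< 2 (s≤s (s≤s z≤n)) (n<1+n (2 ^ (2 ^ x))))
  where
  L₁ L₂ L₃ L₄ L₅ : Cut
  L₁ = expC (natC n)
  L₂ = scaleC 1ℚ L₁
  L₃ = powC L₂ e
  L₄ = expC L₃
  L₅ = scaleC (ℕtoℚ s) L₄
  m₂ = 3 + 2 ^ x
  m₃ = 1 + 2 ^ (2 ^ x)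
  bound₁ : ∀ y → 1 ≤ y → 2 + (2 * (3 + y)) < 16 * y
  bound₁ (suc y) _ = ≤-trans (m≤m+n _ (5 + 14 * y)) (≤-reflexive (lemma y))
    where
    lemma : ∀ y → 3 + (2 * (3 + (1 + y))) + (5 + 14 * y) ≡ 16 * (1 + y)
    lemma = solve-∀
  bound₂ : ∀ y → 1 ≤ y → 1 + (2 * (1 + y)) < 8 * y
  bound₂ (suc y) _ = ≤-trans (m≤m+n _ (2 + 6 * y)) (≤-reflexive (lemma y))
    where
    lemma : ∀ y → 2 + (2 * (1 + (1 + y))) + (2 + 6 * y) ≡ 8 * (1 + y)
    lemma = solve-∀
  b₁ : 2 + 2 * m₂ < 2 ^ (4 + x)
  b₁ = <-≤-trans (bound₁ (2 ^ x) (m^n>0 2 x)) (≤-reflexive (sym (^-distribˡ-+-* 2 4 x)))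
  b₂ : 1 + 2 * m₃ < 2 ^ m₂
  b₂ = <-≤-trans (bound₂ (2 ^ (2 ^ x)) (m^n>0 2 (2 ^ x))) (≤-reflexive (sym (^-distribˡ-+-* 2 3 (2 ^ x))))

G-tower : ∀ h N x → 1 < h → 2 * (4 + x) < h ^ 32770 → G 1ℚ h ≤ᶜ N → 2 ^ (2 ^ (2 ^ x)) ≤ N
G-tower h N x 1<h x< le = ℕtoℚ-cancel-≤ (le _ (tower-∋ (h ^ 32770) (h ^ 182) (h * (h + 1) ∸ 1) x x<
  (m^n>0 h {{>-nonZero h>0}} 182) (m<n⇒0<n∸m (*-mono-≤ {2} {h} {1} {h + 1} 1<h (m≤n+m 1 h)))))
  where
  h>0 = <-trans (s≤s z≤n) 1<h

-- Size of the parameters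

n<2^n : ∀ n → n < 2 ^ n
n<2^n zero    = z<s
n<2^n (suc n) = begin-strict
  suc n <⟨ s<s (n<2^n n) ⟩
  1 + 2 ^ n ≤⟨ +-monoˡ-≤ (2 ^ n) (m^n>0 2 n) ⟩
  2 ^ n + 2 ^ n ≡⟨ cong (λ z → 2 ^ n + z) (sym (+-identityʳ (2 ^ n))) ⟩
  2 ^ suc n ∎
  where open ≤-Reasoning

*-≤2^ : ∀ {a b} x y → a ≤ 2 ^ x → b ≤ 2 ^ y → a * b ≤ 2 ^ (x + y)
*-≤2^ x y p q = ≤-trans (*-mono-≤ p q) (≤-reflexive (sym (^-distribˡ-+-* 2 x y)))

^-≤2^ : ∀ {a} x n → a ≤ 2 ^ x → a ^ n ≤ 2 ^ (x * n)
^-≤2^ x n p = ≤-trans (^-monoˡ-≤ n p) (≤-reflexive (^-*-assoc 2 x n))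

-- The product K s u dominates. The constant 6162 is rounded up to 2^14 because 2^14 · 128 = 128³ in
-- `cubing`.
crude-window : ∀ κ λ′ K u s P → 1 ≤ K → κ ≤ K → λ′ ≤ u → suc λ′ ≤ u → K * s * u ≡ 2048 * P → 1 ≤ P → K ≤ P → u ≤ P →
  7 + (8 + κ + λ′ + (1 + (2 + κ) * s) * suc λ′) ≤ 16384 * P
crude-window κ λ′ K u s P 1≤K κ≤K λ≤u sλ≤u Ksu≡ 1≤P K≤P u≤P = begin
  7 + (8 + κ + λ′ + (1 + (2 + κ) * s) * suc λ′)
    ≤⟨ +-monoʳ-≤ 7 (+-mono-≤ (+-mono-≤ (+-monoʳ-≤ 8 κ≤K) λ≤u)
        (*-mono-≤ (+-monoʳ-≤ 1 (*-monoˡ-≤ s (≤-trans (+-monoʳ-≤ 2 κ≤K) 2+K≤3K))) sλ≤u)) ⟩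
  7 + (8 + K + u + (1 + 3 * K * s) * u) ≡⟨ l₂ K u s ⟩
  15 * 1 + (K + u + u) + 3 * (K * s * u) ≤⟨ +-mono-≤ (+-mono-≤ (*-monoʳ-≤ 15 1≤P) (+-mono-≤ (+-mono-≤ K≤P u≤P) u≤P))
      (≤-reflexive (cong (3 *_) Ksu≡)) ⟩
  15 * P + (P + P + P) + 3 * (2048 * P) ≡⟨ l₃ P ⟩
  6162 * P ≤⟨ *-monoˡ-≤ P {6162} {16384} (≤ᵇ⇒≤ 6162 16384 _) ⟩
  16384 * P ∎
  where
  open ≤-Reasoning
  l₂ : ∀ K u s → 7 + (8 + K + u + (1 + 3 * K * s) * u) ≡ 15 * 1 + (K + u + u) + 3 * (K * s * u)
  l₂ = solve-∀
  l₃ : ∀ P → 15 * P + (P + P + P) + 3 * (2048 * P) ≡ 6162 * P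
  l₃ = solve-∀
  2+K≤3K : 2 + K ≤ 3 * K
  2+K≤3K = ≤-trans (+-monoˡ-≤ K (*-monoʳ-≤ 2 1≤K)) (≤-reflexive (l K))
    where
    l : ∀ K → 2 * K + K ≡ 3 * K
    l = solve-∀

n≤product : ∀ a b u → 1 ≤ a → 1 ≤ b → u ≤ a * (b * u)
n≤product a b u 1≤a 1≤b = ≤-trans (≤-reflexive (l u)) (*-mono-≤ 1≤a (*-monoˡ-≤ u 1≤b))
  where
  l : ∀ u → u ≡ 1 * (1 * u)
  l = solve-∀

precision-square : ∀ κ λ′ K u → K ≡ 2 ^ κ → u ≡ 2 + λ′ → sample-size κ λ′ ≡ u * u * (32 * (8 * (K * K) * (8 * (K * K))))
precision-square κ λ′ K u refl refl = refl

window-exponent-bound : ∀ κ λ′ K u P → K ≡ 2 ^ κ → u ≡ 2 + λ′ → P ≡ K * K * K * K * K * (u * u * u) →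
    7 + window-exponent κ λ′ ≤ 16384 * P
window-exponent-bound κ λ′ K u P K≡ u≡ P≡ = crude-window κ λ′ K u (sample-size κ λ′) P 1≤K
    (subst (κ ≤_) (sym K≡) (<⇒≤ (n<2^n κ)))
  (subst (λ′ ≤_) (sym u≡) (m≤n+m λ′ 2)) (subst (suc λ′ ≤_) (sym u≡) (n≤1+n (suc λ′)))
  (trans (cong (λ s → K * s * u) (precision-square κ λ′ K u K≡ u≡)) (trans (l₁ u K) (cong (2048 *_) (sym P≡))))
  (subst (1 ≤_) (sym P≡) (*-mono-≤ 1≤K⁵ 1≤u³))
  (subst (K ≤_) (sym P≡) (≤-trans (n≤product (K * K * K * K) 1 K 1≤K⁴ ≤-refl)
      (≤-trans (≤-reflexive (cong (K * K * K * K *_) (+-identityʳ K)))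
      (m≤m*n (K * K * K * K * K) (u * u * u) {{>-nonZero 1≤u³}}))))
  (subst (u ≤_) (sym P≡) (n≤product (K * K * K * K * K) (u * u) u 1≤K⁵ (*-mono-≤ 1≤u 1≤u)))
  where
  l₁ : ∀ u K → K * (u * u * (32 * (8 * (K * K) * (8 * (K * K))))) * u ≡ 2048 * (K * K * K * K * K * (u * u * u))
  l₁ = solve-∀
  1≤K : 1 ≤ K
  1≤K = subst (1 ≤_) (sym K≡) (m^n>0 2 κ)
  1≤u : 1 ≤ u
  1≤u = subst (1 ≤_) (sym u≡) (s≤s z≤n)
  1≤u³ : 1 ≤ u * u * u
  1≤u³ = *-mono-≤ (*-mono-≤ 1≤u 1≤u) 1≤u
  1≤K⁴ : 1 ≤ K * K * K * K
  1≤K⁴ = *-mono-≤ (*-mono-≤ (*-mono-≤ 1≤K 1≤K) 1≤K) 1≤K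
  1≤K⁵ : 1 ≤ K * K * K * K * K
  1≤K⁵ = *-mono-≤ 1≤K⁴ 1≤K

2^[7+3κ] : ∀ κ K → K ≡ 2 ^ κ → 2 ^ (7 + 3 * κ) ≡ 128 * (K * K * K)
2^[7+3κ] κ K refl = trans (^-distribˡ-+-* 2 7 (3 * κ)) (cong (128 *_)
    (trans (cong (2 ^_) (l κ)) (trans (^-distribˡ-+-* 2 (κ + κ) κ) (cong (_* K) (^-distribˡ-+-* 2 κ κ)))))
  where
  l : ∀ κ → 3 * κ ≡ κ + κ + κ
  l = solve-∀

cubing : ∀ K u q W B → 1 ≤ K → q ≡ 128 * (K * K * K) → W ≤ 16384 * (K * K * K * K * K * (u * u * u)) → u * q ≤ B →
    W * q ≤ B * B * B
cubing K u q W B 1≤K refl W≤ uq≤ = begin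
  W * (128 * (K * K * K)) ≤⟨ *-monoˡ-≤ (128 * (K * K * K)) W≤ ⟩
  16384 * (K * K * K * K * K * (u * u * u)) * (128 * (K * K * K)) ≤⟨ m≤m*n _ K {{>-nonZero 1≤K}} ⟩
  16384 * (K * K * K * K * K * (u * u * u)) * (128 * (K * K * K)) * K ≡⟨ l₁ K u ⟩
  u * (128 * (K * K * K)) * (u * (128 * (K * K * K))) * (u * (128 * (K * K * K))) ≤⟨ *-mono-≤ (*-mono-≤ uq≤ uq≤) uq≤ ⟩
  B * B * B ∎
  where
  open ≤-Reasoning
  l₁ : ∀ K u → 16384 * (K * K * K * K * K * (u * u * u)) * (128 * (K * K * K)) * K ≡ u * (128 * (K * K * K)) *
      (u * (128 * (K * K * K))) * (u * (128 * (K * K * K)))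
  l₁ = solve-∀

-- The factor 2^(7 + 3κ) absorbs the lower order terms, so that one increment just cubes the left-hand side.
increment-length-bound : ∀ κ ℓ₀ y f → (2 + ℓ₀) * 2 ^ (7 + 3 * κ) ≤ 2 ^ y →
    (2 + increment-length κ ℓ₀ f) * 2 ^ (7 + 3 * κ) ≤ 2 ^ (3 ^ f * y)
increment-length-bound κ ℓ₀ y zero    base = ≤-trans base (≤-reflexive (cong (2 ^_) (sym (+-identityʳ y))))
increment-length-bound κ ℓ₀ y (suc f) base = ≤-trans
  (cubing (2 ^ κ) (2 + increment-length κ ℓ₀ f) (2 ^ (7 + 3 * κ)) (2 + increment-length κ ℓ₀ (suc f)) (2 ^ (3 ^ f * y))
      (m^n>0 2 κ)
    (2^[7+3κ] κ (2 ^ κ) refl) (window-exponent-bound κ (increment-length κ ℓ₀ f) (2 ^ κ)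
        (2 + increment-length κ ℓ₀ f) _ refl refl refl) (increment-length-bound κ ℓ₀ y f base))
  (≤-reflexive (trans (sym (trans (^-distribˡ-+-* 2 (x + x) x) (cong (_* 2 ^ x) (^-distribˡ-+-* 2 x x))))
      (cong (2 ^_) (l₂ (3 ^ f) y))))
  where
  x = 3 ^ f * y
  l₂ : ∀ a y → a * y + a * y + a * y ≡ 3 * a * y
  l₂ = solve-∀

-- log₂ y grows by at most 2f = 128 (κ + 1) in a round, which also replaces κ by 5 + 3κ. As 3 + (5 +
-- 3κ) ≤ 3 (3 + κ), the bound 129 · 4^(r+1) (3 + κ) has a quarter to spare for the increments.
interval-exponent-bound : ∀ r κ → ∃ λ y → (2 + interval-exponent r κ) * 2 ^ (7 + 3 * κ) ≤ 2 ^ y × y ≤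
    2 ^ (129 * (4 ^ r * (3 + κ)))
interval-exponent-bound zero κ = 8 + 3 * κ , ≤-refl , (begin
  8 + 3 * κ ≤⟨ m≤m+n _ (1 + κ * 1) ⟩
  8 + 3 * κ + (1 + κ * 1) ≤⟨ ≤-trans (≤-reflexive (l κ)) (m≤m+n _ (120 + 125 * κ + 258)) ⟩
  9 + 4 * κ + (120 + 125 * κ + 258) ≡⟨ l₂ κ ⟩
  129 * (4 ^ 0 * (3 + κ)) ≤⟨ <⇒≤ (n<2^n _) ⟩
  2 ^ (129 * (4 ^ 0 * (3 + κ))) ∎)
  where
  open ≤-Reasoning
  l : ∀ κ → 8 + 3 * κ + (1 + κ * 1) ≡ 9 + 4 * κ
  l = solve-∀
  l₂ : ∀ κ → 9 + 4 * κ + (120 + 125 * κ + 258) ≡ 129 * (1 * (3 + κ))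
  l₂ = solve-∀
interval-exponent-bound (suc r) κ =
  let (y , p , q) = interval-exponent-bound r (5 + 3 * κ) in
  3 ^ f * y ,
  increment-length-bound κ (interval-exponent r (5 + 3 * κ)) y f
      (≤-trans (*-monoʳ-≤ (2 + interval-exponent r (5 + 3 * κ)) {2 ^ (7 + 3 * κ)} {2 ^ (7 + 3 * (5 + 3 * κ))}
      (^-monoʳ-≤ 2 {7 + 3 * κ} {7 + 3 * (5 + 3 * κ)} (+-monoʳ-≤ 7
      (*-monoʳ-≤ 3 {κ} {5 + 3 * κ} (≤-trans (m≤n*m κ 3) (m≤n+m (3 * κ) 5)))))) p) ,
  (begin
    3 ^ f * y ≤⟨ *-≤2^ (2 * f) _ (≤-trans (^-monoˡ-≤ f (n≤1+n 3)) (≤-reflexive (^-*-assoc 2 2 f))) q ⟩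
    2 ^ (2 * f + 129 * (4 ^ r * (3 + (5 + 3 * κ)))) ≤⟨ ^-monoʳ-≤ 2 (exponent (4 ^ r) (m^n>0 4 r)) ⟩
    2 ^ (129 * (4 ^ suc r * (3 + κ))) ∎)
  where
  open ≤-Reasoning
  f = 64 * suc κ
  exponent : ∀ a → 1 ≤ a → 2 * f + 129 * (a * (3 + (5 + 3 * κ))) ≤ 129 * (4 * a * (3 + κ))
  exponent (suc a) _ = ≤-trans (m≤m+n _ (516 * a + 129 * (a * κ) + κ + 388)) (≤-reflexive (l κ a))
    where
    l : ∀ κ a → 2 * (64 * (1 + κ)) + 129 * ((1 + a) * (3 + (5 + 3 * κ))) + (516 * a + 129 * (a * κ) + κ + 388) ≡
        129 * (4 * (1 + a) * (3 + κ))
    l = solve-∀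

threshold-exponent : ℕ → ℕ → ℕ → ℕ
threshold-exponent κ K λ′ = 3 + (1 + (6 + 10 * κ) * (2 + λ′) * ((2 + λ′) * (2 + λ′) * (16 * K))) * (2 + λ′)

ap-threshold-bound : ∀ κ K λ′ → K ≤ 2 ^ κ → ap-threshold K λ′ ≤ 2 ^ threshold-exponent κ K λ′
ap-threshold-bound κ K λ′ K≤ = begin
  4 * ((2 * v ^ k) ^ suc λ′ * 2) ≡⟨ l₁ ((2 * v ^ k) ^ suc λ′) ⟩
  8 * (2 * v ^ k) ^ suc λ′ ≤⟨ *-≤2^ {8} {(2 * v ^ k) ^ suc λ′} 3 ((1 + (6 + 10 * κ) * u * k) * suc λ′) ≤-refl
      (^-≤2^ {2 * v ^ k} (1 + (6 + 10 * κ) * u * k) (suc λ′) (*-≤2^ {2} {v ^ k} 1 ((6 + 10 * κ) * u * k) ≤-refl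
      (^-≤2^ {v} ((6 + 10 * κ) * u) k v≤))) ⟩
  2 ^ (3 + (1 + (6 + 10 * κ) * u * k) * suc λ′) ≤⟨ ^-monoʳ-≤ 2
      (+-monoʳ-≤ 3 (*-monoʳ-≤ (1 + (6 + 10 * κ) * u * k) (n≤1+n (suc λ′)))) ⟩
  2 ^ threshold-exponent κ K λ′ ∎
  where
  open ≤-Reasoning
  u = 2 + λ′
  k = ap-samples K λ′
  v = ap-growth K λ′
  q = 1 + (κ + κ)
  l₁ : ∀ x → 4 * (x * 2) ≡ 8 * x
  l₁ = solve-∀
  2KK≤ : 2 * (K * K) ≤ 2 ^ q
  2KK≤ = *-≤2^ 1 (κ + κ) ≤-refl (*-≤2^ κ κ K≤ K≤)
  v≤ : v ≤ 2 ^ ((6 + 10 * κ) * u)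
  v≤ = ≤-trans (*-≤2^ (q * 2) ((1 + q * 5) * λ′) (^-≤2^ q 2 2KK≤)
      (^-≤2^ (1 + q * 5) λ′ (*-≤2^ 1 (q * 5) ≤-refl (^-≤2^ q 5 2KK≤))))
    (^-monoʳ-≤ 2 {q * 2 + (1 + q * 5) * λ′} {(6 + 10 * κ) * u}
        (≤-trans (m≤m+n (q * 2 + (1 + q * 5) * λ′) (10 + 16 * κ)) (≤-reflexive (l₂ κ λ′))))
    where
    l₂ : ∀ κ m → (1 + (κ + κ)) * 2 + (1 + (1 + (κ + κ)) * 5) * m + (10 + 16 * κ) ≡ (6 + 10 * κ) * (2 + m)
    l₂ = solve-∀

-- The threshold exponent has order p² u⁴, where p = 2^κ bounds κ, K and r; the fourth power of u q
-- with q = 128 p³ dominates it.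
crude-threshold : ∀ r κ K u p P q B → 1 + κ ≤ p → K ≤ p → r ≤ p → 1 ≤ p → 1 ≤ u → P ≡ p * p * (u * u * u * u) → q ≡
    128 * (p * p * p) → u * q ≤ B →
  3 + r + (3 + (1 + (6 + 10 * κ) * u * (u * u * (16 * K))) * u) ≤ B * B * B * B
crude-threshold r κ K u p P q B 1+κ≤p K≤ r≤ 1≤p 1≤u P≡ q≡ uq≤ = begin
  3 + r + (3 + (1 + (6 + 10 * κ) * u * (u * u * (16 * K))) * u)
    ≤⟨ +-mono-≤ (+-monoʳ-≤ 3 r≤) (+-monoʳ-≤ 3 (*-monoˡ-≤ u (+-monoʳ-≤ 1
        (*-mono-≤ (*-monoˡ-≤ u 6+10κ≤) (*-monoʳ-≤ (u * u) (*-monoʳ-≤ 16 K≤)))))) ⟩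
  3 + p + (3 + (1 + 10 * p * u * (u * u * (16 * p))) * u) ≡⟨ l₁ p u ⟩
  6 * 1 + (p + u) + 160 * (p * p * (u * u * u * u)) ≤⟨ +-mono-≤ (+-mono-≤ (*-monoʳ-≤ 6 1≤P) (+-mono-≤ p≤P u≤P))
      (≤-reflexive (cong (160 *_) (sym P≡))) ⟩
  6 * P + (P + P) + 160 * P ≡⟨ l₂ P ⟩
  168 * P ≤⟨ *-monoˡ-≤ P {168} {16384} (≤ᵇ⇒≤ 168 16384 _) ⟩
  16384 * P ≤⟨ m≤m*n (16384 * P) (p * p * p * p) {{>-nonZero 1≤p⁴}} ⟩
  16384 * P * (p * p * p * p) ≡⟨ trans (cong (λ P → 16384 * P * (p * p * p * p)) P≡)
      (trans (l₃ p u) (cong (λ q → u * u * (u * q) * (u * q)) (sym q≡))) ⟩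
  u * u * (u * q) * (u * q) ≤⟨ *-monoˡ-≤ (u * q) (*-monoˡ-≤ (u * q)
      (*-mono-≤ (m≤m*n u q {{>-nonZero q>0}}) (m≤m*n u q {{>-nonZero q>0}}))) ⟩
  u * q * (u * q) * (u * q) * (u * q) ≤⟨ *-mono-≤ (*-mono-≤ (*-mono-≤ uq≤ uq≤) uq≤) uq≤ ⟩
  B * B * B * B ∎
  where
  open ≤-Reasoning
  l₁ : ∀ p u → 3 + p + (3 + (1 + 10 * p * u * (u * u * (16 * p))) * u) ≡ 6 * 1 + (p + u) + 160 *
      (p * p * (u * u * u * u))
  l₁ = solve-∀
  l₂ : ∀ P → 6 * P + (P + P) + 160 * P ≡ 168 * P
  l₂ = solve-∀
  l₃ : ∀ p u → 16384 * (p * p * (u * u * u * u)) * (p * p * p * p) ≡ u * u * (u * (128 * (p * p * p))) *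
      (u * (128 * (p * p * p)))
  l₃ = solve-∀
  1≤p⁴ : 1 ≤ p * p * p * p
  1≤p⁴ = *-mono-≤ (*-mono-≤ (*-mono-≤ 1≤p 1≤p) 1≤p) 1≤p
  1≤u³ : 1 ≤ u * u * u
  1≤u³ = *-mono-≤ (*-mono-≤ 1≤u 1≤u) 1≤u
  6+10κ≤ : 6 + 10 * κ ≤ 10 * p
  6+10κ≤ = ≤-trans (m≤m+n _ 4) (≤-trans (≤-reflexive (l κ)) (*-monoʳ-≤ 10 1+κ≤p))
    where
    l : ∀ κ → 6 + 10 * κ + 4 ≡ 10 * (1 + κ)
    l = solve-∀
  1≤P : 1 ≤ P
  1≤P = subst (1 ≤_) (sym P≡) (*-mono-≤ (*-mono-≤ 1≤p 1≤p) (*-mono-≤ 1≤u³ 1≤u))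
  p≤P : p ≤ P
  p≤P = subst (p ≤_) (sym P≡) (≤-trans (m≤m*n p p {{>-nonZero 1≤p}})
      (m≤m*n (p * p) (u * u * u * u) {{>-nonZero (*-mono-≤ 1≤u³ 1≤u)}}))
  u≤P : u ≤ P
  u≤P = subst (u ≤_) (sym P≡) (n≤product (p * p) (u * u * u) u (*-mono-≤ 1≤p 1≤p) 1≤u³)
  q>0 : 0 < q
  q>0 = subst (0 <_) (sym q≡) (*-mono-≤ {1} {128} (s≤s z≤n) (*-mono-≤ (*-mono-≤ 1≤p 1≤p) 1≤p))

threshold-exponent-bound : ∀ r κ K λ′ y → K ≤ 2 ^ κ → r ≤ κ → (2 + λ′) * 2 ^ (7 + 3 * κ) ≤ 2 ^ y →
  3 + r + threshold-exponent κ K λ′ ≤ 2 ^ (4 * y)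
threshold-exponent-bound r κ K λ′ y K≤ r≤ le = ≤-trans
  (crude-threshold r κ K (2 + λ′) (2 ^ κ) _ (2 ^ (7 + 3 * κ)) (2 ^ y) (n<2^n κ) K≤ (≤-trans r≤ (<⇒≤ (n<2^n κ)))
      (m^n>0 2 κ) (s≤s z≤n) refl (2^[7+3κ] κ (2 ^ κ) refl) le)
  (≤-reflexive (sym (trans (cong (2 ^_) (l y)) (trans (^-distribˡ-+-* 2 (y + y + y) y)
      (cong (_* 2 ^ y) (trans (^-distribˡ-+-* 2 (y + y) y) (cong (_* 2 ^ y) (^-distribˡ-+-* 2 y y))))))))
  where
  l : ∀ y → 4 * y ≡ y + y + y + y
  l = solve-∀

binary-magnitude : ∀ h → 0 < h → ∃ λ r → h ≤ 2 ^ r × 2 ^ r ≤ 2 * h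
binary-magnitude (suc zero)    _ = 0 , ≤-refl , s≤s z≤n
binary-magnitude (suc (suc h)) _ = let (r , h≤ , ≤2h) = binary-magnitude (suc h) z<s in go r h≤ ≤2h
    (suc (suc h) ≤? 2 ^ r)
  where
  go : ∀ r → suc h ≤ 2 ^ r → 2 ^ r ≤ 2 * suc h → Dec (suc (suc h) ≤ 2 ^ r) → ∃ λ r → suc (suc h) ≤ 2 ^ r × 2 ^ r ≤
      2 * suc (suc h)
  go r h≤ ≤2h (yes p) = r , p , ≤-trans ≤2h (*-monoʳ-≤ 2 (n≤1+n (suc h)))
  go r h≤ ≤2h (no ¬p) = suc r , ≤-trans (+-mono-≤ (m^n>0 2 r) h≤)
      (≤-reflexive (cong (λ z → 2 ^ r + z) (sym (+-identityʳ (2 ^ r))))) ,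
    *-monoʳ-≤ 2 (<⇒≤ (≰⇒> ¬p))

product-bound : ∀ c L M x y z e → c ≤ 2 ^ x → L ≤ 2 ^ y → M ≤ 2 ^ z → 2 + (4 + (x + x) + (z + z) + (y + y + y + y)) ≡
    e →
  4 * (16 * (c * c) * M ² * (L * L * L * L)) ≤ 2 ^ e
product-bound c L M x y z e c≤ L≤ M≤ eq = subst (λ e → 4 * (16 * (c * c) * M ² * (L * L * L * L)) ≤ 2 ^ e) eq
    (*-≤2^ {4} {16 * (c * c) * (M * M) * (L * L * L * L)} 2 (4 + (x + x) + (z + z) + (y + y + y + y)) ≤-refl
  (*-≤2^ {16 * (c * c) * (M * M)} {L * L * L * L} (4 + (x + x) + (z + z)) (y + y + y + y)
    (*-≤2^ {16 * (c * c)} {M * M} (4 + (x + x)) (z + z) (*-≤2^ {16} {c * c} 4 (x + x) ≤-refl (*-≤2^ {c} {c} x x c≤ c≤))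
        (*-≤2^ {M} {M} z z M≤ M≤))
    (*-≤2^ {L * L * L} {L} (y + y + y) y (*-≤2^ {L * L} {L} (y + y) y (*-≤2^ {L} {L} y y L≤ L≤) L≤) L≤)))

-- K has degree 10 in h: 2 from c², 4 from M², 4 from L⁴. The powers of two in 4 K multiply to 2^60.
doubling-constant-bound : ∀ h r κ x y z c L M K → h ≤ 2 ^ r → c ≡ 8 * h → L ≡ 64 * h → M ≡ 64 * (c * c) → K ≡
    16 * (c * c) * M ² * (L * L * L * L) →
  x ≡ 3 + r → y ≡ 6 + r → z ≡ 6 + (x + x) → κ ≡ 60 + 10 * r → 4 * K ≤ 2 ^ κ
doubling-constant-bound h r κ x y z c L M K h≤ c≡ L≡ M≡ K≡ x≡ y≡ z≡ κ≡ = subst (λ K → 4 * K ≤ 2 ^ κ) (sym K≡)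
  (product-bound c L M x y z κ c≤ L≤ M≤ (trans (cong₂ (λ x y → 2 + (4 + (x + x) + (z + z) + (y + y + y + y))) x≡ y≡)
    (trans (cong (λ z → 2 + (4 + (3 + r + (3 + r)) + (z + z) + (6 + r + (6 + r) + (6 + r) + (6 + r))))
        (trans z≡ (cong (λ x → 6 + (x + x)) x≡))) (trans (l r) (sym κ≡)))))
  where
  scale : ∀ {a b n} i e → a ≡ n * b → n ≤ 2 ^ i → b ≤ 2 ^ e → ∀ {f} → f ≡ i + e → a ≤ 2 ^ f
  scale i e refl n≤ b≤ refl = *-≤2^ i e n≤ b≤
  c≤ : c ≤ 2 ^ x
  c≤ = scale 3 r c≡ ≤-refl h≤ x≡
  L≤ : L ≤ 2 ^ y
  L≤ = scale 6 r L≡ ≤-refl h≤ y≡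
  M≤ : M ≤ 2 ^ z
  M≤ = scale 6 (x + x) M≡ ≤-refl (*-≤2^ {c} {c} x x c≤ c≤) z≡
  l : ∀ r → 2 + (4 + (3 + r + (3 + r)) + (6 + (3 + r + (3 + r)) + (6 + (3 + r + (3 + r)))) +
      (6 + r + (6 + r) + (6 + r) + (6 + r))) ≡ 60 + 10 * r
  l = solve-∀

cubic≤quintic : ∀ h a H → 256 ≤ h → H ≡ h * (h * h) → a ≤ 42830 * H → a ≤ h ^ 5
cubic≤quintic h a H h≥ H≡ a≤ = ≤-trans a≤ (≤-trans (*-monoˡ-≤ H {42830} {65536} (≤ᵇ⇒≤ 42830 65536 _))
    (≤-trans (*-monoˡ-≤ H {65536} {h * h} (*-mono-≤ {256} {h} {256} {h} h≥ h≥))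
  (≤-reflexive (trans (cong (h * h *_) H≡) (l₂ h)))))
  where
  l₂ : ∀ h → h * h * (h * (h * h)) ≡ h * (h * (h * (h * (h * 1))))
  l₂ = solve-∀

-- 4^r ≤ 4 h² and r ≤ 2 h make the left side cubic in h; its constant 42830 is below 256² ≤ h².
exponent≤h⁵ : ∀ h r → 256 ≤ h → 2 ^ r ≤ 2 * h → 2 + 129 * (4 ^ r * (3 + (60 + 10 * r))) ≤ h ^ 5
exponent≤h⁵ h r h≥ 2^r≤ = cubic≤quintic h _ (h * (h * h)) h≥ refl (begin
  2 + 129 * (4 ^ r * (3 + (60 + 10 * r))) ≤⟨ +-mono-≤ 2≤ (*-monoʳ-≤ 129 {4 ^ r * (3 + (60 + 10 * r))}
      {2 * h * (2 * h) * (83 * h)} (*-mono-≤ 4^r≤ 63≤)) ⟩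
  2 * (h * (h * h)) + 129 * (2 * h * (2 * h) * (83 * h)) ≡⟨ l₁ h ⟩
  42830 * (h * (h * h)) ∎)
  where
  open ≤-Reasoning
  1≤h : 1 ≤ h
  1≤h = ≤-trans (≤ᵇ⇒≤ 1 256 _) h≥
  4^r≤ : 4 ^ r ≤ 2 * h * (2 * h)
  4^r≤ = ≤-trans (≤-reflexive (^-distribʳ-* r 2 2)) (*-mono-≤ 2^r≤ 2^r≤)
  2≤ : 2 ≤ 2 * (h * (h * h))
  2≤ = *-monoʳ-≤ 2 {1} {h * (h * h)} (*-mono-≤ 1≤h (*-mono-≤ 1≤h 1≤h))
  63≤ : 3 + (60 + 10 * r) ≤ 83 * h
  63≤ = ≤-trans (+-mono-≤ {63} {63 * h} {10 * r} {20 * h} (*-monoʳ-≤ 63 {1} {h} 1≤h)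
      (≤-trans (*-monoʳ-≤ 10 {r} {2 * h} (≤-trans (<⇒≤ (n<2^n r)) 2^r≤)) (≤-reflexive (sym (*-assoc 10 2 h)))))
      (≤-reflexive (l h))
    where
    l : ∀ h → 63 * h + 20 * h ≡ 83 * h
    l = solve-∀
  l₁ : ∀ h → 2 * (h * (h * h)) + 129 * (2 * h * (2 * h) * (83 * h)) ≡ 42830 * (h * (h * h))
  l₁ = solve-∀

-- Removal of X from Y and choice of parameters

∉? : ∀ X y → Dec (y ∉ X)
∉? X y = ¬? (y ∈? X)

∈-outside : ∀ X Y → Y ⊆ X ++ filter (∉? X) Y
∈-outside X Y {s} s∈ with s ∈? X
... | yes p = ∈-++⁺ˡ p
... | no ¬p = ∈-++⁺ʳ X (∈-filter⁺ (∉? X) s∈ ¬p)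

length-outside : ∀ X Y → Unique Y → length Y ≤ length X + length (filter (∉? X) Y)
length-outside X Y uY = ≤-trans (length-⊆ uY (∈-outside X Y)) (≤-reflexive (length-++ X))

outside-large : ∀ h x y n → 256 ≤ h → h ^ 29 * x ≤ y → y ≤ x + n → 128 * (h * x) ≤ n
outside-large h x y n h≥ x≤ y≤ = +-cancelˡ-≤ x _ _ (begin
  x + 128 * (h * x) ≡⟨ l₁ h x ⟩
  (1 + 128 * h) * x ≤⟨ *-monoˡ-≤ x (+-monoˡ-≤ (128 * h) 1≤h) ⟩
  (h + 128 * h) * x ≡⟨ cong (_* x) (l₂ h) ⟩
  129 * h * x ≤⟨ *-monoˡ-≤ x (*-monoˡ-≤ h {129} {h} (≤-trans (≤ᵇ⇒≤ 129 256 _) h≥)) ⟩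
  h * h * x ≡⟨ cong (λ e → h * e * x) (sym (*-identityʳ h)) ⟩
  h ^ 2 * x ≤⟨ *-monoˡ-≤ x (^-monoʳ-≤ h {{>-nonZero 1≤h}} {2} {29} (≤ᵇ⇒≤ 2 29 _)) ⟩
  h ^ 29 * x ≤⟨ ≤-trans x≤ y≤ ⟩
  x + n ∎)
  where
  open ≤-Reasoning
  1≤h : 1 ≤ h
  1≤h = ≤-trans (≤ᵇ⇒≤ 1 256 _) h≥
  l₁ : ∀ h x → x + 128 * (h * x) ≡ (1 + 128 * h) * x
  l₁ = solve-∀
  l₂ : ∀ h → h + 128 * h ≡ 129 * h
  l₂ = solve-∀

tower-dominates : ∀ h r κ K λ′ y x → h ≤ 2 ^ r → K ≤ 2 ^ κ → r ≤ κ → (2 + λ′) * 2 ^ (7 + 3 * κ) ≤ 2 ^ y →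
  y ≤ 2 ^ (129 * (4 ^ r * (3 + κ))) → 2 + 129 * (4 ^ r * (3 + κ)) ≤ x → 8 * h * 2 ^ threshold-exponent κ K λ′ ≤
      2 ^ (2 ^ (2 ^ x))
tower-dominates h r κ K λ′ y x h≤ K≤ r≤ bound y≤ x≥ = ≤-trans
  (*-≤2^ {8 * h} {2 ^ threshold-exponent κ K λ′} (3 + r) (threshold-exponent κ K λ′)
      (*-≤2^ {8} {h} 3 r ≤-refl h≤) ≤-refl)
  (^-monoʳ-≤ 2 (≤-trans (threshold-exponent-bound r κ K λ′ y K≤ r≤ bound)
    (^-monoʳ-≤ 2 (≤-trans (*-≤2^ {4} {y} 2 (129 * (4 ^ r * (3 + κ))) ≤-refl y≤) (^-monoʳ-≤ 2 x≥)))))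

-- λ′ is the exponent that r rounds from density 2^(-κ) require. The lower bound for |X|, multiplied
-- by 128 h, then exceeds every threshold on the part of Y outside X.
independent-outside : ∀ h X Y r κ c L M K → c ≡ 8 * h → L ≡ 64 * h → M ≡ 64 * (c * c) → K ≡ 16 * (c * c) * M ² *
    (L * L * L * L) →
  κ ≡ 60 + 10 * r → 256 ≤ h → h ≤ 2 ^ r → 2 ^ r ≤ 2 * h → Unique Y → h ^ 29 * length X ≤ length Y →
      2 ^ (2 ^ (2 ^ (h ^ 5))) ≤ length X →
  Independent (X ++ filter (∉? X) Y) (filter (∉? X) Y) h
independent-outside h X Y r κ c L M K c≡ L≡ M≡ K≡ κ≡ h≥ h≤ ≤2h uY X≤Y X≥ =
  let (y , bound , y≤) = interval-exponent-bound r κ in go (interval-exponent r κ) y ≤-refl bound y≤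
  where
  open ≤-Reasoning
  h>0 : 0 < h
  h>0 = ≤-trans (≤ᵇ⇒≤ 1 256 _) h≥
  Y′ = filter (∉? X) Y
  4K≤ : 4 * K ≤ 2 ^ κ
  4K≤ = doubling-constant-bound h r κ _ _ _ c L M K h≤ c≡ L≡ M≡ K≡ refl refl refl κ≡
  r≤κ : r ≤ κ
  r≤κ = subst (r ≤_) (sym κ≡) (≤-trans (m≤n*m r 10) (m≤n+m (10 * r) 60))
  x≤ : 2 + 129 * (4 ^ r * (3 + κ)) ≤ h ^ 5
  x≤ = subst (λ κ → 2 + 129 * (4 ^ r * (3 + κ)) ≤ h ^ 5) (sym κ≡) (exponent≤h⁵ h r h≥ ≤2h)
  X≤ : 128 * (h * length X) ≤ length Y′
  X≤ = outside-large h (length X) (length Y) (length Y′) h≥ X≤Y (length-outside X Y uY)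
  go : ∀ λ′ y → interval-exponent r κ ≤ λ′ → (2 + λ′) * 2 ^ (7 + 3 * κ) ≤ 2 ^ y → y ≤ 2 ^ (129 * (4 ^ r * (3 + κ))) →
      Independent (X ++ Y′) Y′ h
  go λ′ y λ≥ bound y≤ = finish (2 ^ τ) (m^n>0 2 τ) (ap-threshold-bound κ K λ′ K≤)
    (≤-trans (tower-dominates h r κ K λ′ y (h ^ 5) h≤ K≤ r≤κ bound y≤ x≤) X≥)
    where
    τ = threshold-exponent κ K λ′
    K≤ : K ≤ 2 ^ κ
    K≤ = ≤-trans (m≤n*m K 4) 4K≤
    finish : ∀ t → 0 < t → ap-threshold K λ′ ≤ t → 8 * h * t ≤ length X → Independent (X ++ Y′) Y′ h
    finish t t>0 t≥ 8ht≤ = dense⇒independent X Y′ h r κ λ′ c L M K t c≡ L≡ M≡ K≡ (Uniqueₚ.filter⁺ (∉? X) uY) h>0 h≤ 4K≤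
        (≤-trans λ≥ (n≤1+n λ′)) X≤
      (≤-trans (*-monoʳ-≤ c (m≤m*n (32 * h) t {{>-nonZero t>0}}))
          (≤-trans (≤-trans (≤-reflexive (trans (cong (_* (32 * h * t)) c≡) (l₁ h t)))
          (*-monoˡ-≤ (h * (h * t)) {256} {1024} (≤ᵇ⇒≤ 256 1024 _))) 1024≤)) t≥
      (≤-trans (≤-reflexive (trans (cong (λ c → t * (4 * c) * (32 * h)) c≡) (l₂ h t))) 1024≤)
      where
      l₁ : ∀ h t → 8 * h * (32 * h * t) ≡ 256 * (h * (h * t))
      l₁ = solve-∀
      l₂ : ∀ h t → t * (4 * (8 * h)) * (32 * h) ≡ 1024 * (h * (h * t))
      l₂ = solve-∀
      l₃ : ∀ h t → 1024 * (h * (h * t)) ≡ 128 * (h * (8 * h * t))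
      l₃ = solve-∀
      1024≤ : 1024 * (h * (h * t)) ≤ length Y′
      1024≤ = ≤-trans (≤-reflexive (l₃ h t)) (≤-trans (*-monoʳ-≤ 128 (*-monoʳ-≤ h 8ht≤)) X≤)

small-power : ∀ h → 256 ≤ h → 2 * (4 + h ^ 5) < h ^ 32770
small-power h h≥ = <-≤-trans below (^-monoʳ-≤ h {{>-nonZero h>0}} {6} {32770} (≤ᵇ⇒≤ 6 32770 _))
  where
  open ≤-Reasoning
  h>0 : 0 < h
  h>0 = ≤-trans (≤ᵇ⇒≤ 1 256 _) h≥
  crude : ∀ p → 1 ≤ p → 2 * (4 + p) < 256 * p
  crude (suc p) _ = ≤-trans (m≤m+n _ (245 + 254 * p)) (≤-reflexive (l p))
    where
    l : ∀ p → 1 + 2 * (4 + (1 + p)) + (245 + 254 * p) ≡ 256 * (1 + p)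
    l = solve-∀
  below : 2 * (4 + h ^ 5) < h ^ 6
  below = <-≤-trans (crude (h ^ 5) (m^n>0 h {{>-nonZero h>0}} 5)) (*-monoˡ-≤ (h ^ 5) {256} {h} h≥)

theorem3p3 : Σ ℚ λ C → 0ℚ ℚ.< C × Σ ℕ λ h₀ →
    ∀ (h : ℕ) → h₀ ≤ h → ∀ (X Y : PosFinSet) →
    h ^ 29 * ∣ X ∣ ≤ ∣ Y ∣ → G C h ≤ᶜ ∣ X ∣ →
    Σ PosFinSet λ Z → ∣ Z ∣ ≡ h
    × (∀ z → z ∈ˢ Z → z ∈ˢ Y)
    × (∀ z → z ∈ˢ Z → z ∉ˢ X)
    × SumFreeWrt Z (λ s → s ∈ˢ X ⊎ s ∈ˢ Y)
-- With `C` = 1 the cut already exceeds 2^(2^(2^(h^5))), and h ≥ 256 absorbs the numerical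
-- constants, such as 42830 ≤ h².
theorem3p3 = 1ℚ , ℕtoℚ-mono-< {0} {1} z<s , 256 , λ h h≥ X Y X≤Y G≤ →
  let (r , h≤ , ≤2h) = binary-magnitude h (≤-trans (≤ᵇ⇒≤ 1 256 _) h≥)
      (Z , len , uZ , Z⊆ , ind) = independent-outside h (elems X) (elems Y) r
          (60 + 10 * r) _ _ _ _ refl refl refl refl refl h≥ h≤ ≤2h (unique Y) X≤Y
                                    (G-tower h ∣ X ∣ (h ^ 5) (≤-trans (≤ᵇ⇒≤ 2 256 _) h≥) (small-power h h≥) G≤)
      outside = λ {z} z∈ → ∈-filter⁻ (∉? (elems X)) {xs = elems Y} (Z⊆ {z} z∈)
      member : ∀ {s} → s ∈ elems X ⊎ s ∈ elems Y → s ∈ elems X ++ filter (∉? (elems X)) (elems Y)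
      member = [ ∈-++⁺ˡ , ∈-outside (elems X) (elems Y) ]′
  in mkSet Z uZ (All.tabulate λ z∈ → All.lookup (pos Y) (proj₁ (outside z∈))) , len ,
     (λ z z∈ → proj₁ (outside z∈)) , (λ z z∈ → proj₂ (outside z∈)) , λ b b′ b∈ b′∈ b≢ s∈ → ind b∈ b′∈ b≢ (member s∈)
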